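{- There exist sets $A\subseteq\{0,1\}^+$ that are $\mathbf P$-levelable, not $\mathbf{FPT}_{\mathrm{su}}$-levelable, and not $\mathbf{FPT}$-levelable.
   Context: A Turing machine $\Phi$ is a partial decision procedure for $A$ if $\Phi(x)=1\Rightarrow x\in A$ and $\Phi(x)=0\Rightarrow x\notin A$; $\mathrm{dom}(\Phi)=\{x:\Phi(x)\in\{0,1\}\}$. A $\mathbf P$-approximation (resp. $O(n^c)$-approximation) for $A$ is a partial decision procedure for $A$ halting on all inputs in polynomial time (resp. time $O(n^c)$); a $\mathbf P$-slice for $A$ is the domain of a $\mathbf P$-approximation. A $\mathbf P$-slice $S$ for $A$ is maximal if $S'\setminus S$ is finite for every $\mathbf P$-slice $S'$ for $A$. $A$ is $\mathbf P$-levelable if it has no maximal $\mathbf P$-slice. A parameter space is a nonempty set $\Omega$ with a reflexive, transitive, directed relation $\preccurlyeq$ and an injective encoding into $\{0,1\}^+$; $|k|$ is the encoding length. A parameterization over $\Omega$ is $\eta\subseteq\{0,1\}^+\times\Omega$ such that for every $x$, $\{k:(x,k)\in\eta\}$ is nonempty and upward closed; $\eta_k=\{x:(x,k)\in\eta\}$. $\eta$ has imix if for every $k$ there is $k'$ with $\eta_{k'}\setminus\eta_k$ infinite. $\mu_\eta(x)=\min\{|k|:(x,k)\in\eta\}$; $\mathrm{gap}_{\eta_1,\eta_2}(n)=\max\{\mu_{\eta_1}(x):\mu_{\eta_2}(x)\le n\}\in\mathbb N\cup\{\infty\}$ (max of empty set is $0$); $\eta_1\preccurlyeq_{\mathrm{nu}}\eta_2$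 if $\mathrm{gap}_{\eta_1,\eta_2}(n)<\infty$ for all $n$; $\eta_1\preccurlyeq\eta_2$ if $\mathrm{gap}_{\eta_1,\eta_2}$ is bounded by a computable function. For a constant $c$: $(A,\eta)\in\mathbf{FPT}^c_{\mathrm{su}}$ if there is a Turing machine $\Psi$ with two inputs such that for every $k$, $\Psi(k,\cdot)$ is an $O(n^c)$-approximation for $A$ with domain $\eta_k$; $(A,\eta)\in\mathbf{FPT}^c$ if moreover there is a computable $f$ with running time of $\Psi(k,\cdot)$ at most $f(k)\cdot n^c$. $A$ is $\mathbf{FPT}_{\mathrm{su}}$-levelable if there is $c_0$ such that for all $c\ge c_0$ there is $\eta$ with $(A,\eta)\in\mathbf{FPT}^c_{\mathrm{su}}$ such that every $\eta'\preccurlyeq_{\mathrm{nu}}\eta$ with $(A,\eta')\in\mathbf{FPT}^c_{\mathrm{su}}$ has imix. $A$ is $\mathbf{FPT}$-levelable if the same holds with $\mathbf{FPT}^c$ and $\preccurlyeq$ in place of $\mathbf{FPT}^c_{\mathrm{su}}$ and $\preccurlyeq_{\mathrm{nu}}$. -}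

module Defs where

open import Level using (Level) renaming (suc to lsuc)
open import Data.Bool using (Bool; true; false; if_then_else_)
open import Data.Nat using (ℕ; zero; suc; _+_; _*_; _^_; _≤_)
open import Data.Fin using (Fin; toℕ) renaming (zero to fz; suc to fs)
open import Data.List using (List; []; _∷_; _++_; map; replicate; takeWhile)
open import Data.List.NonEmpty using (List⁺; toList) renaming (length to length⁺)
open import Data.List.Membership.Propositional using (_∈_)
open import Data.Vec using (Vec; zipWith; lookup) renaming (map to vmap; replicate to vreplicate; _∷_ to _∷v_)
open import Data.Maybe using (Maybe; just; nothing)
open import Data.Product using (Σ; ∃; _×_; _,_; proj₁)
open import Data.Sum using (_⊎_)
open import Relation.Nullary using (¬_; does)
open import Relation.Binary.PropositionalEquality using (_≡_)
open import Data.Nat.Properties using (_≟_)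

Str : Set
Str = List⁺ Bool

len : Str → ℕ
len = length⁺

-- Deterministic multi-tape Turing machines (two-way infinite tapes).
-- Tape symbols of a machine: Fin (4 + extra), where
--   code 0 = blank, 1 = bit 0, 2 = bit 1, 3 = separator '#',
--   further codes are auxiliary work symbols.

data Move : Set where
  mL mR mS : Move

record Tape (Γ : Set) : Set where
  constructor tape
  field
    left  : List Γ   -- cells left of the head, nearest first
    hd    : Γ
    right : List Γ   -- cells right of the head, nearest first

record TM : Set where
  field
    nStates : ℕ
    extra   : ℕ
    work    : ℕ            -- number of tapes is suc work; tape 0 is the input/output tape
    start   : Fin (suc nStates)
    -- transition: nothing = halt
    δ : Fin (suc nStates) → Vec (Fin (4 + extra)) (suc work) →
        Maybe (Fin (suc nStates) × Vec (Fin (4 + extra)) (suc work) × Vec Move (suc work))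

module _ (M : TM) where
  open TM M

  Sym : Set
  Sym = Fin (4 + extra)

  blank : Sym
  blank = fz

  Config : Set
  Config = Fin (suc nStates) × Vec (Tape Sym) (suc work)

  moveTape : Move → Tape Sym → Tape Sym
  moveTape mL (tape [] h r)       = tape [] blank (h ∷ r)
  moveTape mL (tape (l ∷ ls) h r) = tape ls l (h ∷ r)
  moveTape mR (tape l h [])       = tape (h ∷ l) blank []
  moveTape mR (tape l h (r ∷ rs)) = tape (h ∷ l) r rs
  moveTape mS t                   = t

  writeTape : Sym → Tape Sym → Tape Sym
  writeTape s (tape l _ r) = tape l s r

  step : Config → Maybe Config
  step (q , ts) with δ q (vmap Tape.hd ts)
  ... | nothing = nothing
  ... | just (q' , ws , ms) = just (q' , zipWith moveTape ms (zipWith writeTape ws ts))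

  output : Config → List ℕ
  output (_ , ts) with lookup ts fz
  ... | tape _ h r = map toℕ (takeWhile (λ s → Relation.Nullary.¬? (toℕ s ≟ 0)) (h ∷ r))

  -- run with fuel: fuel (suc T) allows T transitions followed by halting
  runFor : ℕ → Config → Maybe (List ℕ)
  runFor zero c = nothing
  runFor (suc f) c with step c
  ... | nothing = just (output c)
  ... | just c' = runFor f c'

data InSym : Set where
  i0 i1 ihash : InSym

module _ (M : TM) where
  open TM M

  inSym : InSym → Sym M
  inSym i0    = fs fz
  inSym i1    = fs (fs fz)
  inSym ihash = fs (fs (fs fz))

  initTape : List InSym → Tape (Sym M)
  initTape []       = tape [] (blank M) []
  initTape (a ∷ as) = tape [] (inSym a) (map inSym as)

  initConfig : List InSym → Config M
  initConfig w = start , (initTape w ∷v vreplicate _ (tape [] (blank M) []))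

HaltsWithin : TM → List InSym → ℕ → List ℕ → Set
HaltsWithin M w T o = runFor M (suc T) (initConfig M w) ≡ just o

Halts : TM → List InSym → List ℕ → Set
Halts M w o = ∃ λ T → HaltsWithin M w T o

bits : List Bool → List InSym
bits = map (λ b → if b then i1 else i0)

strIn : Str → List InSym
strIn x = bits (toList x)

-- the output value "b" (codes: bit 0 = 1, bit 1 = 2)
outBit : Bool → List ℕ
outBit b = (if b then 2 else 1) ∷ []

-- unary output of a natural number m: m copies of the symbol '1'
unary : ℕ → List ℕ
unary m = replicate m 2

ComputableNat : (ℕ → ℕ) → Set
ComputableNat g = ∃ λ M → ∀ n → Halts M (replicate (suc n) i1) (unary (g n))

Finite : (Str → Set) → Set
Finite S = ∃ λ (l : List Str) → ∀ x → S x → x ∈ l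

Infinite : (Str → Set) → Set
Infinite S = ¬ Finite S

PartialDecidesVia : (Str → Set) → TM → (Str → List InSym) → Set
PartialDecidesVia A Φ inp =
  ∀ x → (Halts Φ (inp x) (outBit true) → A x) × (Halts Φ (inp x) (outBit false) → ¬ A x)

PartialDecides : (Str → Set) → TM → Set
PartialDecides A Φ = PartialDecidesVia A Φ strIn

DomVia : TM → (Str → List InSym) → Str → Set
DomVia Φ inp x = ∃ λ b → Halts Φ (inp x) (outBit b)

Dom : TM → Str → Set
Dom Φ = DomVia Φ strIn

PApprox : (Str → Set) → TM → Set
PApprox A Φ =
  (∃ λ c → ∃ λ d → ∀ x → ∃ λ o → HaltsWithin Φ (strIn x) (d * len x ^ c) o)
  × PartialDecides A Φ

-- A is P-levelable: there is no maximal P-slice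
-- (a P-slice is Dom Φ for a P-approximation Φ; maximal: Dom Φ' \ Dom Φ finite for all P-slices)
PLevelable : (Str → Set) → Set
PLevelable A =
  ¬ (∃ λ Φ → PApprox A Φ × (∀ Φ' → PApprox A Φ' → Finite (λ x → Dom Φ' x × ¬ Dom Φ x)))

record ParamSpace : Set₁ where
  field
    Ω        : Set
    _≼_      : Ω → Ω → Set
    elem     : Ω
    ≼-refl   : ∀ k → k ≼ k
    ≼-trans  : ∀ {k k' k''} → k ≼ k' → k' ≼ k'' → k ≼ k''
    directed : ∀ k k' → ∃ λ k'' → (k ≼ k'') × (k' ≼ k'')
    enc      : Ω → Str
    enc-inj  : ∀ {k k'} → enc k ≡ enc k' → k ≡ k'

  ∣_∣ : Ω → ℕ
  ∣ k ∣ = len (enc k)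

record Param (P : ParamSpace) : Set₁ where
  open ParamSpace P
  field
    η       : Str → Ω → Set
    nonempt : ∀ x → ∃ λ k → η x k
    upward  : ∀ x {k k'} → k ≼ k' → η x k → η x k'

module _ {P : ParamSpace} (η : Param P) where
  open ParamSpace P
  open Param η renaming (η to rel)

  Imix : Set
  Imix = ∀ k → ∃ λ k' → Infinite (λ x → rel x k' × ¬ rel x k)

-- gap_{η1,η2}(n) ≤ m, i.e. every x with μ_{η2}(x) ≤ n has μ_{η1}(x) ≤ m
GapLE : {P₁ P₂ : ParamSpace} → Param P₁ → Param P₂ → ℕ → ℕ → Set
GapLE {P₁} {P₂} η₁ η₂ n m =
  ∀ x (k₂ : ParamSpace.Ω P₂) → Param.η η₂ x k₂ → ParamSpace.∣_∣ P₂ k₂ ≤ n →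
    ∃ λ (k₁ : ParamSpace.Ω P₁) → Param.η η₁ x k₁ × ParamSpace.∣_∣ P₁ k₁ ≤ m

_≼nu_ : {P₁ P₂ : ParamSpace} → Param P₁ → Param P₂ → Set
η₁ ≼nu η₂ = ∀ n → ∃ λ m → GapLE η₁ η₂ n m

_≼p_ : {P₁ P₂ : ParamSpace} → Param P₁ → Param P₂ → Set
η₁ ≼p η₂ = ∃ λ g → ComputableNat g × ∀ n → GapLE η₁ η₂ n (g n)

module _ {P : ParamSpace} where
  open ParamSpace P

  pairIn : Ω → Str → List InSym
  pairIn k x = strIn (enc k) ++ (ihash ∷ strIn x)

  ComputableΩ : (Ω → ℕ) → Set
  ComputableΩ f = ∃ λ M → ∀ k → Halts M (strIn (enc k)) (unary (f k))

  SliceFor : (Str → Set) → Param P → TM → Ω → Set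
  SliceFor A η Ψ k =
    PartialDecidesVia A Ψ (pairIn k) × (∀ x → (DomVia Ψ (pairIn k) x → Param.η η x k)
                                             × (Param.η η x k → DomVia Ψ (pairIn k) x))

  FPTsu : ℕ → (Str → Set) → Param P → Set
  FPTsu c A η = ∃ λ Ψ → ∀ k →
    (∃ λ d → ∀ x → ∃ λ o → HaltsWithin Ψ (pairIn k x) (d * len x ^ c) o)
    × SliceFor A η Ψ k

  FPT : ℕ → (Str → Set) → Param P → Set
  FPT c A η = ∃ λ Ψ → ∃ λ f → ComputableΩ f × ∀ k →
    (∀ x → ∃ λ o → HaltsWithin Ψ (pairIn k x) (f k * len x ^ c) o)
    × SliceFor A η Ψ k

FPTsuLevelable : (Str → Set) → Set₁
FPTsuLevelable A = ∃ λ c₀ → ∀ c → c₀ ≤ c →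
  Σ ParamSpace λ P → Σ (Param P) λ η → FPTsu c A η ×
    (∀ (P' : ParamSpace) (η' : Param P') → η' ≼nu η → FPTsu c A η' → Imix η')

FPTLevelable : (Str → Set) → Set₁
FPTLevelable A = ∃ λ c₀ → ∀ c → c₀ ≤ c →
  Σ ParamSpace λ P → Σ (Param P) λ η → FPT c A η ×
    (∀ (P' : ParamSpace) (η' : Param P') → η' ≼p η → FPT c A η' → Imix η')

{-# OPTIONS --safe #-}
-- The set A contains subsets S₀ ⊆ S₁ ⊆ … such that S_i is decidable in time O(n^(E i)) and almost
-- contains every O(n^(E i))-slice of A, whereas S_(i+1) ∖ S_i is infinite.  So no P-slice is maximal,
-- and adding S_i to all slices of a parameterization destroys imix without leaving FPT^(E i).
--
-- S_i consists of the survivors among the candidates x = 1ᵃ01ᵐ0ʳ (with 0 < r) of level a ≤ i, where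
-- a ≤ L = m + r.  For each of the first L - 1 codes of machines, the last candidate with the given a
-- and L on which the machine answers within |x|^(D a) steps is excluded.  As there are L candidates,
-- one survives.  On the other hand, a machine that runs in time n^(E i) and answers on infinitely many
-- candidates of levels above i answers on infinitely many excluded ones.  Outside of all S_i the set A
-- is defined by diagonalization: each code gets the opportunity to answer wrongly.  Hence a fast
-- machine which is correct on A answers only finitely often outside of S_i.
--
-- To decide S_i in polynomial time a universal machine is needed.  It runs queue machines, to which
-- multi-tape Turing machines are reduced with polynomial overhead.

module Submission where

open import Defs
open import Data.Bool.Base using (Bool; true; false; if_then_else_; not; _∧_; _∨_; T)
open import Data.Empty using (⊥)
open import Data.Unit.Base using (⊤; tt)
open import Data.Nat.Base using (ℕ; zero; suc; >-nonZero; _+_; _*_; _∸_; _^_; _⊔_; _≡ᵇ_; _≤_; _<_; z≤n; s≤s; _≤′_; ≤′-refl; ≤′-step)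
open import Data.Nat.Properties
open import Data.Fin.Base using (Fin; zero; suc; toℕ; _↑ˡ_; _↑ʳ_; splitAt)
import Data.Fin.Base as F
import Data.Fin.Properties as Fₚ
open import Data.List.Base using (List; []; _∷_; _++_; length; replicate; takeWhile)
import Data.List.Base as L
import Data.List.Properties as Lₚ
open import Data.List.NonEmpty.Base using (List⁺; _∷_; toList)
open import Data.Vec.Base using (Vec; []; _∷_)
import Data.Vec.Base as V
import Data.Vec.Properties as Vₚ
open import Data.Maybe.Base using (Maybe; just; nothing; maybe)
import Data.Maybe.Base as M
open import Data.Product.Base using (Σ; ∃; ∃₂; _×_; _,_; proj₁; proj₂; map₁; map₂)
open import Data.Sum.Base using (_⊎_; inj₁; inj₂; [_,_]′)
open import Function.Base using (_∘_; id; case_of_; _$_)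
open import Relation.Nullary using (¬_; Dec; yes; no; contradiction; does; ¬?)
open import Relation.Binary.PropositionalEquality using (_≡_; _≢_; refl; sym; trans; cong; cong₂; subst; module ≡-Reasoning)
open import Data.Fin.Patterns using (0F; 1F; 2F; 3F; 4F; 5F; 6F; 7F; 9F)
open import Data.List.Membership.Propositional using (_∈_)
open import Data.List.Membership.Propositional.Properties using (∈-map⁺; ∈-++⁺ˡ; ∈-++⁺ʳ; ∈-cartesianProductWith⁺; ∈-allFin)
open import Data.List.Relation.Unary.Any using (here; there)
open import Data.Nat.Solver using (module +-*-Solver)

-- The obstacle: `S_(i+1)` must be decidable and yet escape all machines that are as fast as `S_i`,
-- though such machines cannot be recognized. Excluding everything that they answer on would leave
-- nothing, since some codes answer on all long strings. One candidate for each code and each pair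
-- of a and L is enough: infinitely many answers outside of all `S_i` already contradict the
-- diagonalization. The exponents come from the simulation. A machine running in time O(n^c) is
-- simulated in K n^(3(c+1)) steps, hence in n^(3c+4) steps once n is at least K. Deciding `S_i`
-- multiplies the clock n^(D i) by about n^2, for all pairs of a candidate and a code. So c = D i +
-- 2 is the exponent that the clock of the next level has to beat. The diagonalization is a priority
-- argument in which every code acts at most once and the least one wins. There is no excluded
-- middle: which codes ever act is left undecided, and the bounds on the domains are obtained under
-- a double negation. This is enough because all three claims about A are negations.

Γ : ℕ → Set
Γ e = Fin (4 + e)

-- Tapes are kept without explicit trailing blanks.
push : ∀ {n} → Fin (suc n) → List (Fin (suc n)) → List (Fin (suc n))
push zero    []      = []
push zero    (x ∷ l) = zero ∷ x ∷ l
push (suc i) l       = suc i ∷ l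

posL posR : ∀ {n} → List (Fin (suc n)) → List (Fin (suc n)) → Tape (Fin (suc n))
posL []      r = tape [] zero r
posL (a ∷ l) r = tape l a r
posR l []      = tape l zero []
posR l (a ∷ r) = tape l a r

-- Operations preserve the normal form. Hence an erased tape is literally `blankT`, and a loop can
-- return to literally the same tapes.
mv : ∀ {n} → Fin (suc n) × Move → Tape (Fin (suc n)) → Tape (Fin (suc n))
mv (s , mL) (tape l _ r) = posL l (push s r)
mv (s , mR) (tape l _ r) = posR (push s l) r
mv (s , mS) (tape l _ r) = tape l s r

trim : ∀ {n} → List (Fin (suc n)) → List (Fin (suc n))
trim []      = []
trim (x ∷ l) = push x (trim l)

normT : ∀ {n} → Tape (Fin (suc n)) → Tape (Fin (suc n))
normT (tape l h r) = tape (trim l) h (trim r)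

-- Program fragments with time bounds

Op : ℕ → Set
Op e = Γ e × Move

Tapes : ℕ → ℕ → Set
Tapes e k = Vec (Tape (Γ e)) k

app : ∀ {e k} → Vec (Op e) k → Tapes e k → Tapes e k
app = V.zipWith mv

heads : ∀ {e k} → Tapes e k → Vec (Γ e) k
heads = V.map Tape.hd

stay : ∀ {e k} → Vec (Γ e) k → Vec (Op e) k
stay = V.map (_, mS)

-- A machine fragment; "nothing" as the next location means leaving the fragment.
record Frag (e k : ℕ) : Set where
  field
    size       : ℕ
    entry      : Fin size
    transition : Fin size → Vec (Γ e) k → Maybe (Fin size) × Vec (Op e) k
open Frag using (size; entry)

-- The number is only an upper bound on the time, because `leave` admits every positive one. Runs of
-- different lengths can thus be given a common bound.
data Run {e k} (p : Frag e k) : Fin (size p) → Tapes e k → ℕ → Tapes e k → Set where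
  leave : ∀ {l s ops} t → Frag.transition p l (heads s) ≡ (nothing , ops) → Run p l s (suc t) (app ops s)
  next  : ∀ {l l′ s ops t s′} → Frag.transition p l (heads s) ≡ (just l′ , ops) →
          Run p l′ (app ops s) t s′ → Run p l s (suc t) s′

Exec : ∀ {e k} → Frag e k → Tapes e k → ℕ → Tapes e k → Set
Exec p s t s′ = Run p (entry p) s t s′

weakenR : ∀ {e k} {p : Frag e k} {l s t t′ s′} → t ≤ t′ → Run p l s t s′ → Run p l s t′ s′
weakenR (s≤s le) (leave _ eq)  = leave _ eq
weakenR (s≤s le) (next eq r)   = next eq (weakenR le r)

app-stay : ∀ {e k} (s : Tapes e k) → app (stay (heads s)) s ≡ s
app-stay []               = refl
app-stay (tape l h r ∷ s) = cong (tape l h r ∷_) (app-stay s)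

act : ∀ {e k} → (Vec (Γ e) k → Vec (Op e) k) → Frag e k
act f = record { size = 1 ; entry = zero ; transition = λ _ v → nothing , f v }

exec-act : ∀ {e k} (f : Vec (Γ e) k → Vec (Op e) k) s {t} → Exec (act f) s (suc t) (app (f (heads s)) s)
exec-act f s = leave _ refl

infixr 5 _⨟_

seqTrans : ∀ {e k} (p q : Frag e k) → Fin (size p) ⊎ Fin (size q) → Vec (Γ e) k →
           Maybe (Fin (size p + size q)) × Vec (Op e) k
seqTrans p q (inj₁ a) v = map₁ (just ∘ maybe (_↑ˡ size q) (size p ↑ʳ entry q)) (Frag.transition p a v)
seqTrans p q (inj₂ b) v = map₁ (M.map (size p ↑ʳ_)) (Frag.transition q b v)

_⨟_ : ∀ {e k} → Frag e k → Frag e k → Frag e k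
p ⨟ q = record
  { size  = size p + size q
  ; entry = entry p ↑ˡ size q
  ; transition = λ l v → seqTrans p q (splitAt (size p) l) v
  }

module _ {e k : ℕ} {p q : Frag e k} where

  seq-right : ∀ {l s t s′} → Run q l s t s′ → Run (p ⨟ q) (size p ↑ʳ l) s t s′
  seq-right {l} {s} (leave t eq) = leave t
    (trans (cong (λ z → seqTrans p q z (heads s)) (Fₚ.splitAt-↑ʳ (size p) (size q) l))
           (cong (map₁ (M.map (size p ↑ʳ_))) eq))
  seq-right {l} {s} (next eq r) = next
    (trans (cong (λ z → seqTrans p q z (heads s)) (Fₚ.splitAt-↑ʳ (size p) (size q) l))
           (cong (map₁ (M.map (size p ↑ʳ_))) eq))
    (seq-right r)

  seq-left : ∀ {l s t s′ t′ s″} → Run p l s t s′ → Exec q s′ t′ s″ → Run (p ⨟ q) (l ↑ˡ size q) s (t + t′) s″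
  seq-left {l} {s} {t′ = t′} (leave t eq) x = next
    (trans (cong (λ z → seqTrans p q z (heads s)) (Fₚ.splitAt-↑ˡ (size p) l (size q)))
           (cong (map₁ (just ∘ maybe (_↑ˡ size q) (size p ↑ʳ entry q))) eq))
    (weakenR (m≤n+m t′ t) (seq-right x))
  seq-left {l} {s} (next eq r) x = next
    (trans (cong (λ z → seqTrans p q z (heads s)) (Fₚ.splitAt-↑ˡ (size p) l (size q)))
           (cong (map₁ (just ∘ maybe (_↑ˡ size q) (size p ↑ʳ entry q))) eq))
    (seq-left r x)

  exec-seq : ∀ {s t s′ t′ s″} → Exec p s t s′ → Exec q s′ t′ s″ → Exec (p ⨟ q) s (t + t′) s″
  exec-seq = seq-left

whileTrans : ∀ {e k} → (Vec (Γ e) k → Bool) → (p : Frag e k) → Fin (suc (size p)) → Vec (Γ e) k →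
             Maybe (Fin (suc (size p))) × Vec (Op e) k
whileTrans c p zero    v = (if c v then just (suc (entry p)) else nothing) , stay v
whileTrans c p (suc l) v = map₁ (just ∘ maybe suc zero) (Frag.transition p l v)

while : ∀ {e k} → (Vec (Γ e) k → Bool) → Frag e k → Frag e k
while c p = record { size = suc (size p) ; entry = zero ; transition = whileTrans c p }

module _ {e k : ℕ} {c : Vec (Γ e) k → Bool} {p : Frag e k} where

  exec-done : ∀ {s t} → c (heads s) ≡ false → Exec (while c p) s (suc t) s
  exec-done {s} {t} eq = subst (Exec (while c p) s (suc t)) (app-stay s)
    (leave t (cong (λ b → (if b then just (suc (entry p)) else nothing) , stay (heads s)) eq))

  while-body : ∀ {l s t s′ t′ s″} → Run p l s t s′ → Exec (while c p) s′ t′ s″ →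
               Run (while c p) (suc l) s (t + t′) s″
  while-body {t′ = t′} (leave t eq) x =
    next (cong (map₁ (just ∘ maybe suc zero)) eq) (weakenR (m≤n+m t′ t) x)
  while-body (next eq r) x = next (cong (map₁ (just ∘ maybe suc zero)) eq) (while-body r x)

  exec-loop : ∀ {s t s′ t′ s″} → c (heads s) ≡ true → Exec p s t s′ → Exec (while c p) s′ t′ s″ →
              Exec (while c p) s (suc (t + t′)) s″
  exec-loop {s} eq x y = next
    (cong (λ b → (if b then just (suc (entry p)) else nothing) , stay (heads s)) eq)
    (subst (λ z → Run (while c p) (suc (entry p)) z _ _) (sym (app-stay s)) (while-body x y))

ifTrans : ∀ {e k} → (Vec (Γ e) k → Bool) → (p q : Frag e k) → Fin (suc (size p + size q)) → Vec (Γ e) k →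
          Maybe (Fin (suc (size p + size q))) × Vec (Op e) k
ifTrans c p q zero    v = just (suc (if c v then entry p ↑ˡ size q else size p ↑ʳ entry q)) , stay v
ifTrans c p q (suc l) v with splitAt (size p) l
... | inj₁ a = map₁ (M.map (suc ∘ (_↑ˡ size q))) (Frag.transition p a v)
... | inj₂ b = map₁ (M.map (suc ∘ (size p ↑ʳ_))) (Frag.transition q b v)

ifte : ∀ {e k} → (Vec (Γ e) k → Bool) → Frag e k → Frag e k → Frag e k
ifte c p q = record { size = suc (size p + size q) ; entry = zero ; transition = ifTrans c p q }

module _ {e k : ℕ} {c : Vec (Γ e) k → Bool} {p q : Frag e k} where

  if-left-eq : ∀ l v → ifTrans c p q (suc (l ↑ˡ size q)) v ≡ map₁ (M.map (suc ∘ (_↑ˡ size q))) (Frag.transition p l v)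
  if-left-eq l v rewrite Fₚ.splitAt-↑ˡ (size p) l (size q) = refl

  if-right-eq : ∀ l v → ifTrans c p q (suc (size p ↑ʳ l)) v ≡ map₁ (M.map (suc ∘ (size p ↑ʳ_))) (Frag.transition q l v)
  if-right-eq l v rewrite Fₚ.splitAt-↑ʳ (size p) (size q) l = refl

  if-left : ∀ {l s t s′} → Run p l s t s′ → Run (ifte c p q) (suc (l ↑ˡ size q)) s t s′
  if-left {l} {s} (leave t eq) = leave t (trans (if-left-eq l (heads s)) (cong (map₁ (M.map (suc ∘ (_↑ˡ size q)))) eq))
  if-left {l} {s} (next eq r)  = next (trans (if-left-eq l (heads s)) (cong (map₁ (M.map (suc ∘ (_↑ˡ size q)))) eq)) (if-left r)

  if-right : ∀ {l s t s′} → Run q l s t s′ → Run (ifte c p q) (suc (size p ↑ʳ l)) s t s′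
  if-right {l} {s} (leave t eq) = leave t (trans (if-right-eq l (heads s)) (cong (map₁ (M.map (suc ∘ (size p ↑ʳ_)))) eq))
  if-right {l} {s} (next eq r)  = next (trans (if-right-eq l (heads s)) (cong (map₁ (M.map (suc ∘ (size p ↑ʳ_)))) eq)) (if-right r)

  exec-then : ∀ {s t s′} → c (heads s) ≡ true → Exec p s t s′ → Exec (ifte c p q) s (suc t) s′
  exec-then {s} eq x = next
    (cong (λ b → just (suc (if b then entry p ↑ˡ size q else size p ↑ʳ entry q)) , stay (heads s)) eq)
    (subst (λ z → Run (ifte c p q) _ z _ _) (sym (app-stay s)) (if-left x))

  exec-else : ∀ {s t s′} → c (heads s) ≡ false → Exec q s t s′ → Exec (ifte c p q) s (suc t) s′
  exec-else {s} eq x = next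
    (cong (λ b → just (suc (if b then entry p ↑ˡ size q else size p ↑ʳ entry q)) , stay (heads s)) eq)
    (subst (λ z → Run (ifte c p q) _ z _ _) (sym (app-stay s)) (if-right x))

takeV : ∀ {A : Set} j {k} → Vec A (j + k) → Vec A j
takeV zero    _       = []
takeV (suc j) (x ∷ v) = x ∷ takeV j v

dropV : ∀ {A : Set} j {k} → Vec A (j + k) → Vec A k
dropV zero    v       = v
dropV (suc j) (x ∷ v) = dropV j v

onLeft : ∀ {e} j {k} → Frag e j → Frag e (j + k)
onLeft j p = record
  { size = size p ; entry = entry p
  ; transition = λ l v → map₂ (V._++ stay (dropV j v)) (Frag.transition p l (takeV j v)) }

onRight : ∀ {e} j {k} → Frag e k → Frag e (j + k)
onRight j p = record
  { size = size p ; entry = entry p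
  ; transition = λ l v → map₂ (stay (takeV j v) V.++_) (Frag.transition p l (dropV j v)) }

heads-take : ∀ {e j k} (s : Tapes e j) (u : Tapes e k) → takeV j (heads (s V.++ u)) ≡ heads s
heads-take []      u = refl
heads-take (x ∷ s) u = cong (Tape.hd x ∷_) (heads-take s u)

heads-drop : ∀ {e j k} (s : Tapes e j) (u : Tapes e k) → dropV j (heads (s V.++ u)) ≡ heads u
heads-drop []      u = refl
heads-drop (x ∷ s) u = heads-drop s u

app-++ : ∀ {e j k} (o : Vec (Op e) j) (o′ : Vec (Op e) k) s u → app (o V.++ o′) (s V.++ u) ≡ app o s V.++ app o′ u
app-++ []      o′ []      u = refl
app-++ (x ∷ o) o′ (y ∷ s) u = cong (mv x y ∷_) (app-++ o o′ s u)

module _ {e j k : ℕ} where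

  run-left : ∀ {p : Frag e j} {l s t s′} (u : Tapes e k) → Run p l s t s′ → Run (onLeft j p) l (s V.++ u) t (s′ V.++ u)
  run-left {p} {l} {s} u (leave {ops = ops} t eq) =
    subst (Run (onLeft j p) l (s V.++ u) (suc t))
      (trans (app-++ ops (stay (heads u)) s u) (cong (app ops s V.++_) (app-stay u)))
      (leave t (trans (cong₂ (λ a b → map₂ (V._++ stay b) (Frag.transition p l a)) (heads-take s u) (heads-drop s u))
                      (cong (map₂ (V._++ stay (heads u))) eq)))
  run-left {p} {l} {s} u (next {l′ = l′} {ops = ops} eq r) = next
    (trans (cong₂ (λ a b → map₂ (V._++ stay b) (Frag.transition p l a)) (heads-take s u) (heads-drop s u))
           (cong (map₂ (V._++ stay (heads u))) eq))
    (subst (λ z → Run (onLeft j p) l′ z _ _)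
      (sym (trans (app-++ ops (stay (heads u)) s u) (cong (app ops s V.++_) (app-stay u))))
      (run-left u r))

  run-right : ∀ {p : Frag e k} {l s t s′} (u : Tapes e j) → Run p l s t s′ → Run (onRight j p) l (u V.++ s) t (u V.++ s′)
  run-right {p} {l} {s} u (leave {ops = ops} t eq) =
    subst (Run (onRight j p) l (u V.++ s) (suc t))
      (trans (app-++ (stay (heads u)) ops u s) (cong (V._++ app ops s) (app-stay u)))
      (leave t (trans (cong₂ (λ a b → map₂ (stay a V.++_) (Frag.transition p l b)) (heads-take u s) (heads-drop u s))
                      (cong (map₂ (stay (heads u) V.++_)) eq)))
  run-right {p} {l} {s} u (next {l′ = l′} {ops = ops} eq r) = next
    (trans (cong₂ (λ a b → map₂ (stay a V.++_) (Frag.transition p l b)) (heads-take u s) (heads-drop u s))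
           (cong (map₂ (stay (heads u) V.++_)) eq))
    (subst (λ z → Run (onRight j p) l′ z _ _)
      (sym (trans (app-++ (stay (heads u)) ops u s) (cong (V._++ app ops s) (app-stay u))))
      (run-right u r))

-- Translating between Turing machines and fragments

blankT : ∀ {e} → Tape (Γ e)
blankT = tape [] zero []

sy : ∀ {e} → InSym → Γ e
sy i0    = suc zero
sy i1    = suc (suc zero)
sy ihash = suc (suc (suc zero))

inT : ∀ {e} → List InSym → Tape (Γ e)
inT []      = blankT
inT (a ∷ w) = tape [] (sy a) (L.map sy w)

outT : ∀ {e} → Tape (Γ e) → List ℕ
outT (tape _ h r) = L.map toℕ (takeWhile (λ s → ¬? (toℕ s ≟ 0)) (h ∷ r))

outS : ∀ {e k} → Tapes e (suc k) → List ℕ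
outS s = outT (V.head s)

-- Leaving the fragment becomes a transition into the additional state `zero`, which has no
-- transition. So a run of t steps makes t transitions and then halts.
toTM : ∀ {e k} → Frag e (suc k) → TM
toTM {e} {k} p = record
  { nStates = Frag.size p ; extra = e ; work = k ; start = suc (Frag.entry p) ; δ = δ }
  where
    δ : Fin (suc (Frag.size p)) → Vec (Γ e) (suc k) → Maybe (Fin (suc (Frag.size p)) × Vec (Γ e) (suc k) × Vec Move (suc k))
    δ zero    v = nothing
    δ (suc l) v = just ( maybe suc zero (proj₁ (Frag.transition p l v))
                       , V.map proj₁ (proj₂ (Frag.transition p l v)) , V.map proj₂ (proj₂ (Frag.transition p l v)))

norm-left-cons : ∀ {n} (a s : Fin (suc n)) l r → tape (trim l) a (push s r) ≡ mv (s , mL) (tape (push a (trim l)) s r)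
norm-left-cons (suc a) s l       r = refl
norm-left-cons zero    s l       r with trim l
... | []    = refl
... | _ ∷ _ = refl

norm-right-cons : ∀ {n} (a s : Fin (suc n)) l r → tape (push s l) a (trim r) ≡ mv (s , mR) (tape l s (push a (trim r)))
norm-right-cons (suc a) s l r = refl
norm-right-cons zero    s l r with trim r
... | []    = refl
... | _ ∷ _ = refl

mv-head : ∀ {n} (o : Fin (suc n) × Move) l h h′ r → mv o (tape l h r) ≡ mv o (tape l h′ r)
mv-head (s , mL) []      h h′ r       = refl
mv-head (s , mL) (x ∷ l) h h′ r       = refl
mv-head (s , mR) l       h h′ []      = refl
mv-head (s , mR) l       h h′ (x ∷ r) = refl
mv-head (s , mS) l       h h′ r       = refl

norm-mv : ∀ M m s t → normT (moveTape M m (writeTape M s t)) ≡ mv (s , m) (normT t)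
norm-mv M mL s (tape [] h r)      = refl
norm-mv M mL s (tape (a ∷ l) h r) =
  trans (norm-left-cons a s l (trim r)) (mv-head (s , mL) (push a (trim l)) s h (trim r))
norm-mv M mR s (tape l h [])      = refl
norm-mv M mR s (tape l h (a ∷ r)) =
  trans (norm-right-cons a s (trim l) r) (mv-head (s , mR) (trim l) s h (push a (trim r)))
norm-mv M mS s (tape l h r)       = refl

norm-step : ∀ M {k} (ops : Vec (Sym M × Move) k) ts →
  V.map normT (V.zipWith (moveTape M) (V.map proj₂ ops) (V.zipWith (writeTape M) (V.map proj₁ ops) ts))
  ≡ V.zipWith mv ops (V.map normT ts)
norm-step M []              []       = refl
norm-step M ((s , m) ∷ ops) (t ∷ ts) = cong₂ _∷_ (norm-mv M m s t) (norm-step M ops ts)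

takeWhile-push : ∀ {n} (s : Fin (suc n)) l → let f = takeWhile (λ s → ¬? (toℕ s ≟ 0)) in f (push s l) ≡ f (s ∷ l)
takeWhile-push zero    []      = refl
takeWhile-push zero    (_ ∷ _) = refl
takeWhile-push (suc s) l       = refl

takeWhile-trim : ∀ {n} (l : List (Fin (suc n))) → let f = takeWhile (λ s → ¬? (toℕ s ≟ 0)) in f (trim l) ≡ f l
takeWhile-trim []          = refl
takeWhile-trim (zero ∷ l)  = takeWhile-push zero (trim l)
takeWhile-trim (suc i ∷ l) = cong (suc i ∷_) (takeWhile-trim l)

output-outT : ∀ M c → output M c ≡ outT (normT (V.lookup (proj₂ c) zero))
output-outT M (q , tape l zero r    ∷ ts) = refl
output-outT M (q , tape l (suc i) r ∷ ts) = cong (λ z → L.map toℕ (suc i ∷ z)) (sym (takeWhile-trim r))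

output-outS : ∀ M c {s} → V.map normT (proj₂ c) ≡ s → output M c ≡ outS s
output-outS M (q , t ∷ ts) refl = output-outT M (q , t ∷ ts)

heads-norm : ∀ {n k} (ts : Vec (Tape (Fin (suc n))) k) → V.map Tape.hd (V.map normT ts) ≡ V.map Tape.hd ts
heads-norm []       = refl
heads-norm (t ∷ ts) = cong (Tape.hd t ∷_) (heads-norm ts)

step-just : ∀ M {q ts q′ ws ms} → TM.δ M q (V.map Tape.hd ts) ≡ just (q′ , ws , ms) →
            step M (q , ts) ≡ just (q′ , V.zipWith (moveTape M) ms (V.zipWith (writeTape M) ws ts))
step-just M eq rewrite eq = refl

runFor-just : ∀ M {c c′} f → step M c ≡ just c′ → runFor M (suc f) c ≡ runFor M f c′
runFor-just M f eq rewrite eq = refl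

runFor-nothing : ∀ M c f → step M c ≡ nothing → runFor M (suc f) c ≡ just (output M c)
runFor-nothing M c f eq rewrite eq = refl

toTM-run : ∀ {e k} {p : Frag e (suc k)} {l s t s′} → Run p l s t s′ → ∀ ts → V.map normT ts ≡ s →
           runFor (toTM p) (suc t) (suc l , ts) ≡ just (outS s′)
toTM-run {p = p} {l} (leave {ops = ops} t eq) ts refl =
  trans (runFor-just (toTM p) (suc t) (step-just (toTM p)
          (trans (cong (λ v → TM.δ (toTM p) (suc l) v) (sym (heads-norm ts)))
                 (cong (λ z → just (maybe suc zero (proj₁ z) , V.map proj₁ (proj₂ z) , V.map proj₂ (proj₂ z))) eq))))
        (trans (runFor-nothing (toTM p) (zero , ts′) t refl)
               (cong just (output-outS (toTM p) (zero , ts′) (norm-step (toTM p) ops ts))))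
  where
    ts′ = V.zipWith (moveTape (toTM p)) (V.map proj₂ ops) (V.zipWith (writeTape (toTM p)) (V.map proj₁ ops) ts)
toTM-run {p = p} {l} {t = suc t} (next {ops = ops} eq r) ts refl =
  trans (runFor-just (toTM p) (suc t) (step-just (toTM p)
          (trans (cong (λ v → TM.δ (toTM p) (suc l) v) (sym (heads-norm ts)))
                 (cong (λ z → just (maybe suc zero (proj₁ z) , V.map proj₁ (proj₂ z) , V.map proj₂ (proj₂ z))) eq))))
        (toTM-run r _ (norm-step (toTM p) ops ts))

runFor-mono : ∀ M {f f′ c o} → f ≤ f′ → runFor M f c ≡ just o → runFor M f′ c ≡ just o
runFor-mono M {suc f} {suc f′} {c} (s≤s le) eq with step M c
... | nothing = eq
... | just c′ = runFor-mono M le eq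

halts-mono : ∀ M {w t t′ o} → t ≤ t′ → HaltsWithin M w t o → HaltsWithin M w t′ o
halts-mono M le = runFor-mono M (s≤s le)

just-injective : ∀ {A : Set} {x y : A} → just x ≡ just y → x ≡ y
just-injective refl = refl

halts-unique : ∀ M {w o o′} → Halts M w o → Halts M w o′ → o ≡ o′
halts-unique M {w} (t , h) (t′ , h′) = just-injective
  (trans (sym (halts-mono M {w} (m≤m⊔n t t′) h)) (halts-mono M {w} (m≤n⊔m t t′) h′))

inSyms-trim : ∀ M w → trim (L.map (inSym M) w) ≡ L.map sy w
inSyms-trim M []          = refl
inSyms-trim M (i0 ∷ w)    = cong (_ ∷_) (inSyms-trim M w)
inSyms-trim M (i1 ∷ w)    = cong (_ ∷_) (inSyms-trim M w)
inSyms-trim M (ihash ∷ w) = cong (_ ∷_) (inSyms-trim M w)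

inSym-sy : ∀ M a → inSym M a ≡ sy a
inSym-sy M i0    = refl
inSym-sy M i1    = refl
inSym-sy M ihash = refl

initTape-norm : ∀ M w → normT (initTape M w) ≡ inT w
initTape-norm M []      = refl
initTape-norm M (a ∷ w) = cong₂ (tape []) (inSym-sy M a) (inSyms-trim M w)

map-replicate : ∀ {A B : Set} (f : A → B) n x → V.map f (V.replicate n x) ≡ V.replicate n (f x)
map-replicate f zero    x = refl
map-replicate f (suc n) x = cong (f x ∷_) (map-replicate f n x)

initS : ∀ {e} k → List InSym → Tapes e (suc k)
initS k w = inT w ∷ V.replicate k blankT

init-norm : ∀ M w → V.map normT (proj₂ (initConfig M w)) ≡ initS (TM.work M) w
init-norm M w = cong₂ _∷_ (initTape-norm M w) (map-replicate normT (TM.work M) _)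

toTM-halts : ∀ {e k} {p : Frag e (suc k)} {w t s′} → Exec p (initS k w) t s′ → HaltsWithin (toTM p) w t (outS s′)
toTM-halts {p = p} {w} x = toTM-run x _ (init-norm (toTM p) w)

module _ {e e′ : ℕ} (le : e ≤ e′) where

  emb : Γ e → Γ e′
  emb s = F.inject≤ s (+-monoʳ-≤ 4 le)

  -- Two machines with different alphabets will share their tapes' alphabet in one program. Symbols
  -- outside the image of `emb` never occur in the simulated runs, and the value `zero` for them is
  -- a dummy.
  unemb : Γ e′ → Γ e
  unemb s with toℕ s <? 4 + e
  ... | yes p = F.fromℕ< p
  ... | no  _ = zero

  unemb-emb : ∀ s → unemb (emb s) ≡ s
  unemb-emb s with toℕ (emb s) <? 4 + e
  ... | yes p = Fₚ.toℕ-injective (trans (Fₚ.toℕ-fromℕ< p) (Fₚ.toℕ-inject≤ s _))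
  ... | no ¬p = contradiction (subst (_< 4 + e) (sym (Fₚ.toℕ-inject≤ s _)) (Fₚ.toℕ<n s)) ¬p

  embT : Tape (Γ e) → Tape (Γ e′)
  embT (tape l h r) = tape (L.map emb l) (emb h) (L.map emb r)

  push-emb : ∀ s l → L.map emb (push s l) ≡ push (emb s) (L.map emb l)
  push-emb zero    []      = refl
  push-emb zero    (x ∷ l) = refl
  push-emb (suc s) l       = refl

  mv-emb : ∀ s m t → embT (mv (s , m) t) ≡ mv (emb s , m) (embT t)
  mv-emb s mL (tape [] h r)      = cong (tape [] zero) (push-emb s r)
  mv-emb s mL (tape (a ∷ l) h r) = cong (tape (L.map emb l) (emb a)) (push-emb s r)
  mv-emb s mR (tape l h [])      = cong (λ z → tape z zero []) (push-emb s l)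
  mv-emb s mR (tape l h (a ∷ r)) = cong (λ z → tape z (emb a) (L.map emb r)) (push-emb s l)
  mv-emb s mS (tape l h r)       = refl

  outT-emb : ∀ t → outT (embT t) ≡ outT t
  outT-emb (tape l h r) = go (h ∷ r)
    where
      go : ∀ l → L.map toℕ (takeWhile (λ s → ¬? (toℕ s ≟ 0)) (L.map emb l)) ≡ L.map toℕ (takeWhile (λ s → ¬? (toℕ s ≟ 0)) l)
      go []          = refl
      go (zero ∷ l)  = refl
      go (suc s ∷ l) = cong₂ _∷_ (Fₚ.toℕ-inject≤ (suc s) (+-monoʳ-≤ 4 le)) (go l)

  emb-sy : ∀ a → emb (sy a) ≡ sy a
  emb-sy i0    = refl
  emb-sy i1    = refl
  emb-sy ihash = refl

  embT-inT : ∀ w → embT (inT w) ≡ inT w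
  embT-inT []      = refl
  embT-inT (a ∷ w) = cong₂ (tape []) (emb-sy a) (trans (sym (Lₚ.map-∘ w)) (Lₚ.map-cong emb-sy w))

module _ (M : TM) {e : ℕ} (le : TM.extra M ≤ e) where
  open TM M

  ofδ : Vec (Γ e) (suc work) → Maybe (Fin (suc nStates) × Vec (Γ extra) (suc work) × Vec Move (suc work)) →
        Maybe (Fin (suc nStates)) × Vec (Op e) (suc work)
  ofδ v nothing               = nothing , stay v
  ofδ v (just (q′ , ws , ms)) = just q′ , V.zip (V.map (emb le) ws) ms

  ofTM : Frag e (suc work)
  ofTM = record { size = suc nStates ; entry = start ; transition = λ q v → ofδ v (δ q (V.map (unemb le) v)) }

  embS : ∀ {k} → Vec (Tape (Γ extra)) k → Tapes e k
  embS = V.map (embT le ∘ normT)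

  unemb-heads : ∀ {k} (ts : Vec (Tape (Γ extra)) k) → V.map (unemb le) (heads (embS ts)) ≡ heads ts
  unemb-heads []       = refl
  unemb-heads (t ∷ ts) = cong₂ _∷_ (unemb-emb le (Tape.hd t)) (unemb-heads ts)

  emb-step : ∀ {k} (ws : Vec (Γ extra) k) ms ts →
    app (V.zip (V.map (emb le) ws) ms) (embS ts) ≡ embS (V.zipWith (moveTape M) ms (V.zipWith (writeTape M) ws ts))
  emb-step []       []       []       = refl
  emb-step (s ∷ ws) (m ∷ ms) (t ∷ ts) = cong₂ _∷_
    (trans (sym (mv-emb le s m (normT t))) (cong (embT le) (sym (norm-mv M m s t)))) (emb-step ws ms ts)

  outS-embS : ∀ (s : Vec (Tape (Γ extra)) (suc work)) q → output M (q , s) ≡ outS (embS s)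
  outS-embS (t ∷ s) q = trans (output-outT M (q , t ∷ s)) (sym (outT-emb le (normT t)))

  ofTM-run : ∀ t q ts {o} → runFor M (suc t) (q , ts) ≡ just o →
             ∃ λ s′ → Run ofTM q (embS ts) (suc t) s′ × outS s′ ≡ o
  ofTM-run t q ts eq with δ q (heads ts) in δeq
  ofTM-run t q ts refl | nothing = _ , leave t (cong (ofδ (heads (embS ts))) (trans (cong (δ q) (unemb-heads ts)) δeq)) ,
    trans (cong outS (app-stay (embS ts))) (sym (outS-embS ts q))
  ofTM-run zero q ts () | just _
  ofTM-run (suc t) q ts eq | just (q′ , ws , ms)
    with ofTM-run t q′ _ eq
  ... | s′ , r , oeq = s′ , next (cong (ofδ (heads (embS ts))) (trans (cong (δ q) (unemb-heads ts)) δeq))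
                             (subst (λ z → Run ofTM q′ z (suc t) s′) (sym (emb-step ws ms ts)) r) , oeq

  ofTM-halts : ∀ {w t o} → HaltsWithin M w t o → ∃ λ s′ → Exec ofTM (initS work w) (suc t) s′ × outS s′ ≡ o
  ofTM-halts {w} {t} h with ofTM-run t start _ h
  ... | s′ , r , eq = s′ , subst (λ z → Run ofTM start z (suc t) s′) init-eq r , eq
    where
      init-eq : embS (proj₂ (initConfig M w)) ≡ initS work w
      init-eq = cong₂ _∷_ (trans (cong (embT le) (initTape-norm M w)) (embT-inT le w)) (map-replicate (embT le ∘ normT) work _)

-- The universal queue machine

-- Tape symbols: 1F, 2F are the bits, 3F ends a table row, 4F separates the two parts of a row,
-- 5F and 6F are answers.  Control states: 0F skips rows, 1F runs to the end of the queue,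
-- 2F appends, 3F runs back, 4F prepends, 5F rewinds the table, 6F and 7F have answered.
-- The queue is a sequence of letters 1ⁱ0; the front letter selects row i of the table, is removed,
-- the first part of the row is appended to the queue and the second part (a unary number, which
-- plays the role of the control state) is prepended to it.
dU : Γ 4 → Γ 4 → Γ 4 → Γ 4 × Op 4 × Op 4
dU 0F 2F 3F = 0F , (0F , mR) , (3F , mR)
dU 0F 2F 0F = 0F , (2F , mS) , (0F , mS)
dU 0F 2F t  = 0F , (2F , mS) , (t , mR)
dU 0F 1F 5F = 6F , (1F , mS) , (5F , mS)
dU 0F 1F 6F = 7F , (1F , mS) , (6F , mS)
dU 0F 1F 0F = 0F , (1F , mS) , (0F , mS)
dU 0F 1F 3F = 0F , (1F , mS) , (3F , mS)
dU 0F 1F t  = 1F , (0F , mR) , (t , mS)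
dU 1F 0F t  = 2F , (0F , mS) , (t , mS)
dU 1F x  t  = 1F , (x , mR) , (t , mS)
dU 2F x  1F = 2F , (1F , mR) , (1F , mR)
dU 2F x  2F = 2F , (2F , mR) , (2F , mR)
dU 2F x  4F = 3F , (x , mL) , (4F , mR)
dU 3F 0F t  = 4F , (0F , mS) , (t , mS)
dU 3F x  t  = 3F , (x , mL) , (t , mS)
dU 4F x  2F = 4F , (2F , mL) , (2F , mR)
dU 4F x  3F = 5F , (x , mR) , (3F , mL)
dU 5F x  0F = 0F , (x , mS) , (0F , mR)
dU 5F x  t  = 5F , (x , mS) , (t , mL)
dU s  x  t  = s , (x , mS) , (t , mS)

UCfg : Set
UCfg = Γ 4 × Tape (Γ 4) × Tape (Γ 4)

ustep : UCfg → UCfg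
ustep (s , x , t) = let (s′ , o , o′) = dU s (Tape.hd x) (Tape.hd t) in s′ , mv o x , mv o′ t

usteps : ℕ → UCfg → UCfg
usteps zero    u = u
usteps (suc n) u = usteps n (ustep u)

usteps-+ : ∀ m n u → usteps (m + n) u ≡ usteps n (usteps m u)
usteps-+ zero    n u = refl
usteps-+ (suc m) n u = usteps-+ m n (ustep u)

usteps-fix : ∀ {u} → ustep u ≡ u → ∀ n → usteps n u ≡ u
usteps-fix eq zero    = refl
usteps-fix eq (suc n) = trans (cong (usteps n) eq) (usteps-fix eq n)

uanswer : UCfg → Maybe Bool
uanswer (6F , _) = just false
uanswer (7F , _) = just true
uanswer _        = nothing

infix 4 _⇝⟨_⟩_
_⇝⟨_⟩_ : UCfg → ℕ → UCfg → Set
u ⇝⟨ b ⟩ u′ = ∃ λ t → t ≤ b × usteps t u ≡ u′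

⇝-refl : ∀ {u} → u ⇝⟨ 0 ⟩ u
⇝-refl = 0 , z≤n , refl

⇝-trans : ∀ {u b u′ b′ u″} → u ⇝⟨ b ⟩ u′ → u′ ⇝⟨ b′ ⟩ u″ → u ⇝⟨ b + b′ ⟩ u″
⇝-trans {u} (t , le , refl) (t′ , le′ , refl) = t + t′ , +-mono-≤ le le′ , usteps-+ t t′ u

⇝-step : ∀ {u b u′} → ustep u ⇝⟨ b ⟩ u′ → u ⇝⟨ suc b ⟩ u′
⇝-step (t , le , eq) = suc t , s≤s le , eq

⇝-weaken : ∀ {u b b′ u′} → b ≤ b′ → u ⇝⟨ b ⟩ u′ → u ⇝⟨ b′ ⟩ u′
⇝-weaken le (t , le′ , eq) = t , ≤-trans le′ le , eq

⇝-target : ∀ {u b u′ u″} → u ⇝⟨ b ⟩ u′ → u′ ≡ u″ → u ⇝⟨ b ⟩ u″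
⇝-target r refl = r

bs : Bool → Fin 7
bs false = 0F
bs true  = 1F

data Cell : Set where
  bitC : Bool → Cell
  sepC : Cell
  ansC : Bool → Cell

cs : Cell → Fin 7
cs (bitC b)     = bs b
cs sepC         = 3F
cs (ansC false) = 4F
cs (ansC true)  = 5F

data URow : Set where
  go   : List Bool → ℕ → URow
  ans  : Bool → URow
  dead : URow

cells : URow → List Cell
cells (go w k) = L.map bitC w ++ sepC ∷ L.map bitC (replicate k true)
cells (ans b)  = ansC b ∷ []
cells dead     = []

cellsStr : List Cell → List (Fin 7)
cellsStr = L.map cs

rowStr : URow → List (Fin 7)
rowStr r = cellsStr (cells r) ++ 2F ∷ []

table : List URow → List (Fin 7)
table = L.concatMap rowStr

bitsX : List Bool → List (Γ 4)
bitsX x = L.map suc (L.map bs x)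

nz : ∀ {n} → List (Fin n) → List (Fin (suc n))
nz = L.map suc

skip-row : ∀ c d r x → (0F , posR [] (2F ∷ bitsX x) , posR (nz d) (nz (cellsStr c) ++ 3F ∷ r))
  ⇝⟨ suc (length c) ⟩ (0F , posR [] (bitsX x) , posR (nz (2F ∷ (cellsStr c L.ʳ++ d))) r)
skip-row []               d r x = ⇝-step ⇝-refl
skip-row (bitC false ∷ c) d r x = ⇝-step (skip-row c (0F ∷ d) r x)
skip-row (bitC true  ∷ c) d r x = ⇝-step (skip-row c (1F ∷ d) r x)
skip-row (sepC       ∷ c) d r x = ⇝-step (skip-row c (3F ∷ d) r x)
skip-row (ansC false ∷ c) d r x = ⇝-step (skip-row c (4F ∷ d) r x)
skip-row (ansC true  ∷ c) d r x = ⇝-step (skip-row c (5F ∷ d) r x)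

table-cons : ∀ r rs s → nz (table (r ∷ rs)) ++ s ≡ nz (cellsStr (cells r)) ++ 3F ∷ (nz (table rs) ++ s)
table-cons r rs s = begin
  nz (rowStr r ++ table rs) ++ s              ≡⟨ cong (_++ s) (Lₚ.map-++ suc (rowStr r) (table rs)) ⟩
  (nz (rowStr r) ++ nz (table rs)) ++ s       ≡⟨ Lₚ.++-assoc (nz (rowStr r)) _ s ⟩
  nz (rowStr r) ++ (nz (table rs) ++ s)       ≡⟨ cong (_++ (nz (table rs) ++ s)) (Lₚ.map-++ suc (cellsStr (cells r)) (2F ∷ [])) ⟩
  (nz (cellsStr (cells r)) ++ 3F ∷ []) ++ (nz (table rs) ++ s) ≡⟨ Lₚ.++-assoc (nz (cellsStr (cells r))) _ _ ⟩
  nz (cellsStr (cells r)) ++ 3F ∷ (nz (table rs) ++ s) ∎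
  where open ≡-Reasoning

table-length-cons : ∀ r rs → length (table (r ∷ rs)) ≡ suc (length (cells r)) + length (table rs)
table-length-cons r rs = begin
  length (rowStr r ++ table rs)          ≡⟨ Lₚ.length-++ (rowStr r) ⟩
  length (rowStr r) + length (table rs)  ≡⟨ cong (_+ length (table rs)) (trans (Lₚ.length-++ (cellsStr (cells r)))
                                              (trans (+-comm _ 1) (cong suc (Lₚ.length-map cs (cells r))))) ⟩
  suc (length (cells r)) + length (table rs) ∎
  where open ≡-Reasoning

table-ʳ++ : ∀ r rs d → table (r ∷ rs) L.ʳ++ d ≡ table rs L.ʳ++ (2F ∷ (cellsStr (cells r) L.ʳ++ d))
table-ʳ++ r rs d = trans (Lₚ.++-ʳ++ (rowStr r))
  (cong (table rs L.ʳ++_) (Lₚ.++-ʳ++ (cellsStr (cells r))))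

skip-rows : ∀ rs d r x →
  (0F , posR [] (bitsX (replicate (length rs) true ++ x)) , posR (nz d) (nz (table rs) ++ r))
    ⇝⟨ length (table rs) ⟩ (0F , posR [] (bitsX x) , posR (nz (table rs L.ʳ++ d)) r)
skip-rows []       d r x = ⇝-refl
skip-rows (q ∷ rs) d r x
  rewrite table-cons q rs r | table-length-cons q rs | table-ʳ++ q rs d =
  ⇝-trans (skip-row (cells q) d _ _) (skip-rows rs _ r x)

nz-ʳ++ : ∀ {n} (x d : List (Fin n)) → nz (x L.ʳ++ d) ≡ nz x L.ʳ++ nz d
nz-ʳ++ []      d = refl
nz-ʳ++ (a ∷ x) d = nz-ʳ++ x (a ∷ d)

to-end : ∀ (y d : List (Fin 7)) t → (1F , posR (nz d) (nz y) , t) ⇝⟨ suc (length y) ⟩ (2F , posR (nz (y L.ʳ++ d)) [] , t)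
to-end []      d t = ⇝-step ⇝-refl
to-end (a ∷ y) d t = ⇝-step (to-end y (a ∷ d) t)

append : ∀ w k (d e : List (Fin 7)) r → (2F , posR (nz d) [] , posR (nz e) (nz (cellsStr (cells (go w k))) ++ r))
  ⇝⟨ suc (length w) ⟩
  (3F , posL (nz (L.map bs w L.ʳ++ d)) [] , posR (nz (3F ∷ (L.map bs w L.ʳ++ e))) (nz (cellsStr (L.map bitC (replicate k true))) ++ r))
append []          k d e r = ⇝-step ⇝-refl
append (false ∷ w) k d e r = ⇝-step (append w k (0F ∷ d) (0F ∷ e) r)
append (true  ∷ w) k d e r = ⇝-step (append w k (1F ∷ d) (1F ∷ e) r)

to-front : ∀ (d : List (Fin 7)) y t → (3F , posL (nz d) y , t) ⇝⟨ suc (length d) ⟩ (4F , posL [] (nz d L.ʳ++ y) , t)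
to-front []      y t = ⇝-step ⇝-refl
to-front (a ∷ d) y t = ⇝-step (to-front d (suc a ∷ y) t)

ones : ∀ k → List (Fin 7)
ones k = cellsStr (L.map bitC (replicate k true))

ones-snoc : ∀ k (y : List (Γ 4)) → nz (ones k) ++ 2F ∷ y ≡ 2F ∷ (nz (ones k) ++ y)
ones-snoc zero    y = refl
ones-snoc (suc k) y = cong (2F ∷_) (ones-snoc k y)

prepend : ∀ k y e r → (4F , posL [] y , posR (nz e) (nz (ones k) ++ 3F ∷ r))
  ⇝⟨ suc k ⟩ (5F , posR [] (nz (ones k) ++ y) , posL (nz (ones k L.ʳ++ e)) (3F ∷ r))
prepend zero    y e r = ⇝-step ⇝-refl
prepend (suc k) y e r = ⇝-step (subst (λ z → (4F , posL [] (2F ∷ y) , posR (nz (1F ∷ e)) (nz (ones k) ++ 3F ∷ r)) ⇝⟨ suc k ⟩ (5F , posR [] z , posL (nz (ones k L.ʳ++ (1F ∷ e))) (3F ∷ r))) (ones-snoc k y)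
  (prepend k (2F ∷ y) (1F ∷ e) r))

rewind-table : ∀ (e : List (Fin 7)) x r → (5F , x , posL (nz e) r) ⇝⟨ suc (length e) ⟩ (0F , x , posR [] (nz e L.ʳ++ r))
rewind-table []      x r = ⇝-step ⇝-refl
rewind-table (a ∷ e) x r = ⇝-step (rewind-table e x (suc a ∷ r))


ustart : List Bool → List URow → UCfg
ustart x rows = 0F , posR [] (bitsX x) , posR [] (nz (table rows))

table-split : ∀ before r after → nz (table (before ++ r ∷ after)) ≡
              nz (table before) ++ nz (cellsStr (cells r)) ++ 3F ∷ nz (table after)
table-split before r after = begin
  nz (table (before ++ r ∷ after))              ≡⟨ cong nz (Lₚ.concatMap-++ rowStr before (r ∷ after)) ⟩
  nz (table before ++ table (r ∷ after))        ≡⟨ Lₚ.map-++ suc (table before) _ ⟩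
  nz (table before) ++ nz (table (r ∷ after))   ≡⟨ cong (nz (table before) ++_) (sym (Lₚ.++-identityʳ _)) ⟩
  nz (table before) ++ nz (table (r ∷ after)) ++ [] ≡⟨ cong (nz (table before) ++_) (table-cons r after []) ⟩
  nz (table before) ++ nz (cellsStr (cells r)) ++ 3F ∷ nz (table after) ++ []
    ≡⟨ cong (λ z → nz (table before) ++ nz (cellsStr (cells r)) ++ 3F ∷ z) (Lₚ.++-identityʳ _) ⟩
  nz (table before) ++ nz (cellsStr (cells r)) ++ 3F ∷ nz (table after) ∎
  where open ≡-Reasoning

table-length-split : ∀ before r after →
  length (table (before ++ r ∷ after)) ≡ length (table before) + (suc (length (cells r)) + length (table after))
table-length-split before r after = begin
  length (table (before ++ r ∷ after))                  ≡⟨ cong length (Lₚ.concatMap-++ rowStr before (r ∷ after)) ⟩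
  length (table before ++ table (r ∷ after))            ≡⟨ Lₚ.length-++ (table before) ⟩
  length (table before) + length (table (r ∷ after))    ≡⟨ cong (length (table before) +_) (table-length-cons r after) ⟩
  length (table before) + (suc (length (cells r)) + length (table after)) ∎
  where open ≡-Reasoning

skip-before : ∀ before r after x →
  ustart (replicate (length before) true ++ x) (before ++ r ∷ after) ⇝⟨ length (table before) ⟩
  (0F , posR [] (bitsX x) , posR (nz (table before L.ʳ++ [])) (nz (cellsStr (cells r)) ++ 3F ∷ nz (table after)))
skip-before before r after x rewrite table-split before r after = skip-rows before [] _ x

dispatch : ∀ w k rest d r →
  (0F , posR [] (bitsX (false ∷ rest)) , posR (nz d) (nz (cellsStr (cells (go w k))) ++ r)) ⇝⟨ 1 ⟩
  (1F , posR [] (bitsX rest) , posR (nz d) (nz (cellsStr (cells (go w k))) ++ r))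
dispatch []          k rest d r = ⇝-step ⇝-refl
dispatch (false ∷ w) k rest d r = ⇝-step ⇝-refl
dispatch (true ∷ w)  k rest d r = ⇝-step ⇝-refl

unwind : ∀ {A : Set} (x y z : List A) → (z L.ʳ++ (y L.ʳ++ (x L.ʳ++ []))) L.ʳ++ [] ≡ x ++ y ++ z
unwind x y z = begin
  (z L.ʳ++ (y L.ʳ++ (x L.ʳ++ []))) L.ʳ++ []   ≡⟨ Lₚ.ʳ++-ʳ++ z ⟩
  (y L.ʳ++ (x L.ʳ++ [])) L.ʳ++ z ++ []        ≡⟨ Lₚ.ʳ++-ʳ++ y ⟩
  (x L.ʳ++ []) L.ʳ++ y ++ z ++ []             ≡⟨ Lₚ.ʳ++-ʳ++ x ⟩
  x ++ y ++ z ++ []                           ≡⟨ cong (λ v → x ++ y ++ v) (Lₚ.++-identityʳ z) ⟩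
  x ++ y ++ z ∎
  where open ≡-Reasoning

queue-restored : ∀ rest w → nz (L.map bs w L.ʳ++ (L.map bs rest L.ʳ++ [])) L.ʳ++ [] ≡ bitsX (rest ++ w)
queue-restored rest w = begin
  nz (L.map bs w L.ʳ++ (L.map bs rest L.ʳ++ [])) L.ʳ++ [] ≡⟨ sym (nz-ʳ++ (L.map bs w L.ʳ++ (L.map bs rest L.ʳ++ [])) []) ⟩
  nz ((L.map bs w L.ʳ++ (L.map bs rest L.ʳ++ [])) L.ʳ++ []) ≡⟨ cong nz (unwind [] (L.map bs rest) (L.map bs w)) ⟩
  nz (L.map bs rest ++ L.map bs w)                        ≡⟨ cong nz (sym (Lₚ.map-++ bs rest w)) ⟩
  bitsX (rest ++ w) ∎
  where open ≡-Reasoning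

ones-bitsX : ∀ k x → nz (ones k) ++ bitsX x ≡ bitsX (replicate k true ++ x)
ones-bitsX zero    x = refl
ones-bitsX (suc k) x = cong (2F ∷_) (ones-bitsX k x)

length-ones : ∀ k → length (ones k) ≡ k
length-ones zero    = refl
length-ones (suc k) = cong suc (length-ones k)

table-restored : ∀ before w k after →
  nz (ones k L.ʳ++ (3F ∷ (L.map bs w L.ʳ++ (table before L.ʳ++ [])))) L.ʳ++ (3F ∷ nz (table after))
  ≡ nz (table (before ++ go w k ∷ after))
table-restored before w k after = begin
  nz (ones k L.ʳ++ e) L.ʳ++ R                  ≡⟨ cong (L._ʳ++ R) (nz-ʳ++ (ones k) e) ⟩
  (nz (ones k) L.ʳ++ nz e) L.ʳ++ R             ≡⟨ Lₚ.ʳ++-ʳ++ (nz (ones k)) ⟩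
  nz e L.ʳ++ nz (ones k) ++ R                  ≡⟨ cong (L._ʳ++ (4F ∷ nz (ones k) ++ R)) (nz-ʳ++ (L.map bs w) _) ⟩
  (bitsX w L.ʳ++ nz (table before L.ʳ++ [])) L.ʳ++ 4F ∷ nz (ones k) ++ R ≡⟨ Lₚ.ʳ++-ʳ++ (bitsX w) ⟩
  nz (table before L.ʳ++ []) L.ʳ++ bitsX w ++ 4F ∷ nz (ones k) ++ R
    ≡⟨ cong (L._ʳ++ (bitsX w ++ 4F ∷ nz (ones k) ++ R)) (nz-ʳ++ (table before) []) ⟩
  (nz (table before) L.ʳ++ []) L.ʳ++ bitsX w ++ 4F ∷ nz (ones k) ++ R ≡⟨ Lₚ.ʳ++-ʳ++ (nz (table before)) ⟩
  nz (table before) ++ bitsX w ++ 4F ∷ nz (ones k) ++ R  ≡⟨ cong (nz (table before) ++_) (sym cells-go) ⟩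
  nz (table before) ++ nz (cellsStr (cells (go w k))) ++ R ≡⟨ sym (table-split before (go w k) after) ⟩
  nz (table (before ++ go w k ∷ after)) ∎
  where
    open ≡-Reasoning
    e = 3F ∷ (L.map bs w L.ʳ++ (table before L.ʳ++ []))
    R = 3F ∷ nz (table after)
    cells-go : nz (cellsStr (cells (go w k))) ++ R ≡ bitsX w ++ 4F ∷ nz (ones k) ++ R
    cells-go = begin
      nz (cellsStr (L.map bitC w ++ sepC ∷ L.map bitC (replicate k true))) ++ R
        ≡⟨ cong (λ z → nz z ++ R) (Lₚ.map-++ cs (L.map bitC w) _) ⟩
      nz (cellsStr (L.map bitC w) ++ 3F ∷ ones k) ++ R
        ≡⟨ cong (λ z → nz (z ++ 3F ∷ ones k) ++ R) (sym (Lₚ.map-∘ w)) ⟩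
      nz (L.map bs w ++ 3F ∷ ones k) ++ R
        ≡⟨ cong (_++ R) (Lₚ.map-++ suc (L.map bs w) _) ⟩
      (bitsX w ++ 4F ∷ nz (ones k)) ++ R
        ≡⟨ Lₚ.++-assoc (bitsX w) _ R ⟩
      bitsX w ++ 4F ∷ nz (ones k) ++ R ∎

length-cells-go : ∀ w k → length (cells (go w k)) ≡ length w + suc k
length-cells-go w k = trans (Lₚ.length-++ (L.map bitC w))
  (cong₂ (λ a b → a + suc b) (Lₚ.length-map bitC w) (trans (Lₚ.length-map bitC (replicate k true)) (Lₚ.length-replicate k)))

go-bound : ∀ b q w k a → b + (1 + (suc q + (suc w + (suc (w + (q + 0)) + (suc k + suc (k + suc (w + (b + 0)))))))) ≤
           4 * (b + (suc (w + suc k) + a)) + 2 * q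
go-bound b q w k a = subst (lhs ≤_) eq (m≤m+n lhs (2 * b + w + 2 * k + 1 + 4 * a))
  where
    open +-*-Solver
    lhs = b + (1 + (suc q + (suc w + (suc (w + (q + 0)) + (suc k + suc (k + suc (w + (b + 0))))))))
    eq : lhs + (2 * b + w + 2 * k + 1 + 4 * a) ≡ 4 * (b + (suc (w + suc k) + a)) + 2 * q
    eq = solve 5 (λ b q w k a →
      b :+ (con 1 :+ ((con 1 :+ q) :+ ((con 1 :+ w) :+ ((con 1 :+ (w :+ (q :+ con 0))) :+
        ((con 1 :+ k) :+ (con 1 :+ (k :+ (con 1 :+ (w :+ (b :+ con 0)))))))))) :+
        (con 2 :* b :+ w :+ con 2 :* k :+ con 1 :+ con 4 :* a)
      := con 4 :* (b :+ ((con 1 :+ (w :+ (con 1 :+ k))) :+ a)) :+ con 2 :* q) refl b q w k a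

-- The queue is crossed twice, to append at its end and to come back. The table is crossed twice as
-- well, and the factor 4 also pays for writing the two parts of the row, which are no longer than
-- the table.
row-go : ∀ before w k after rest → let rows = before ++ go w k ∷ after in
  ustart (replicate (length before) true ++ false ∷ rest) rows
    ⇝⟨ 4 * length (table rows) + 2 * length rest ⟩
  ustart (replicate k true ++ rest ++ w) rows
row-go before w k after rest = subst (λ B → ustart _ rows ⇝⟨ 4 * B + 2 * length rest ⟩ ustart _ rows) (sym B-eq)
  (⇝-weaken (≤-trans (≤-reflexive lens) (go-bound (length (table before)) (length rest) (length w) k (length (table after))))
    (⇝-trans (skip-before before (go w k) after (false ∷ rest))
    (⇝-trans (dispatch w k rest d₀ (3F ∷ nz (table after)))
    (⇝-trans (to-end (L.map bs rest) [] _)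
    (⇝-trans (append w k (L.map bs rest L.ʳ++ []) d₀ (3F ∷ nz (table after)))
    (⇝-trans (to-front d₁ [] _)
    (⇝-trans (prepend k (nz d₁ L.ʳ++ []) (3F ∷ (L.map bs w L.ʳ++ d₀)) (nz (table after)))
    (⇝-target (rewind-table (ones k L.ʳ++ (3F ∷ (L.map bs w L.ʳ++ d₀))) _ (3F ∷ nz (table after))) fin))))))))
  where
    rows = before ++ go w k ∷ after
    d₀ = table before L.ʳ++ []
    d₁ = L.map bs w L.ʳ++ (L.map bs rest L.ʳ++ [])
    B-eq : length (table rows) ≡ length (table before) + (suc (length w + suc k) + length (table after))
    B-eq = trans (table-length-split before (go w k) after)
      (cong (λ z → length (table before) + (suc z + length (table after))) (length-cells-go w k))
    len-rest : length (L.map bs rest) ≡ length rest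
    len-rest = Lₚ.length-map bs rest
    len₁ : length d₁ ≡ length w + (length rest + 0)
    len₁ = trans (Lₚ.length-ʳ++ (L.map bs w)) (cong₂ _+_ (Lₚ.length-map bs w)
             (trans (Lₚ.length-ʳ++ (L.map bs rest)) (cong (_+ 0) len-rest)))
    len₂ : length (ones k L.ʳ++ (3F ∷ (L.map bs w L.ʳ++ d₀))) ≡ k + suc (length w + (length (table before) + 0))
    len₂ = trans (Lₚ.length-ʳ++ (ones k)) (cong₂ (λ a b → a + suc b) (length-ones k)
             (trans (Lₚ.length-ʳ++ (L.map bs w)) (cong₂ _+_ (Lₚ.length-map bs w) (Lₚ.length-ʳ++ (table before)))))
    lens : length (table before) + (1 + (suc (length (L.map bs rest)) + (suc (length w) + (suc (length d₁) +
             (suc k + suc (length (ones k L.ʳ++ (3F ∷ (L.map bs w L.ʳ++ d₀)))))))))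
           ≡ _
    lens = cong₂ (λ a b → length (table before) + (1 + (suc a + (suc (length w) + b)))) len-rest
             (cong₂ (λ a b → suc a + (suc k + suc b)) len₁ len₂)
    fin : (0F , posR [] (nz (ones k) ++ (nz d₁ L.ʳ++ [])) ,
            posR [] (nz (ones k L.ʳ++ (3F ∷ (L.map bs w L.ʳ++ d₀))) L.ʳ++ (3F ∷ nz (table after))))
          ≡ ustart (replicate k true ++ rest ++ w) rows
    fin = cong₂ (λ a b → 0F , posR [] a , posR [] b)
      (trans (cong (nz (ones k) ++_) (queue-restored rest w)) (ones-bitsX k (rest ++ w)))
      (table-restored before w k after)

-- Halting is being a fixed point, with or without an answer. So running on until a clock expires
-- does no harm.
Halted : UCfg → Maybe Bool → Set
Halted u a = ustep u ≡ u × uanswer u ≡ a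

row-ans : ∀ before b after rest → let rows = before ++ ans b ∷ after in
  ∃ λ u → (ustart (replicate (length before) true ++ false ∷ rest) rows ⇝⟨ suc (length (table rows)) ⟩ u) × Halted u (just b)
row-ans before b after rest = _ , ⇝-weaken le (⇝-trans (skip-before before (ans b) after (false ∷ rest)) (last b)) , halted b
  where
    d₀ = table before L.ʳ++ []
    fin : Bool → UCfg
    fin false = 6F , posR [] (bitsX (false ∷ rest)) , posR (nz d₀) (nz (cellsStr (cells (ans false))) ++ 3F ∷ nz (table after))
    fin true  = 7F , posR [] (bitsX (false ∷ rest)) , posR (nz d₀) (nz (cellsStr (cells (ans true))) ++ 3F ∷ nz (table after))
    last : ∀ b → (0F , posR [] (bitsX (false ∷ rest)) , posR (nz d₀) (nz (cellsStr (cells (ans b))) ++ 3F ∷ nz (table after)))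
           ⇝⟨ 1 ⟩ fin b
    last false = ⇝-step ⇝-refl
    last true  = ⇝-step ⇝-refl
    halted : ∀ b → Halted (fin b) (just b)
    halted false = refl , refl
    halted true  = refl , refl
    le : length (table before) + 1 ≤ suc (length (table (before ++ ans b ∷ after)))
    le = ≤-trans (≤-reflexive (+-comm _ 1)) (s≤s (≤-trans (m≤m+n _ _) (≤-reflexive (sym (table-length-split before (ans b) after)))))

row-dead : ∀ before after rest → let rows = before ++ dead ∷ after in
  ∃ λ u → (ustart (replicate (length before) true ++ false ∷ rest) rows ⇝⟨ suc (length (table rows)) ⟩ u) × Halted u nothing
row-dead before after rest = _ , ⇝-weaken le (skip-before before dead after (false ∷ rest)) , refl , refl
  where
    le : length (table before) ≤ suc (length (table (before ++ dead ∷ after)))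
    le = m≤n⇒m≤1+n (≤-trans (m≤m+n _ _) (≤-reflexive (sym (table-length-split before dead after))))

-- Queue machines and their tables

data QRow (S L : Set) : Set where
  qgo   : List L → S → QRow S L
  qans  : Bool → QRow S L
  qdead : QRow S L

answerRow : ∀ {S L} → Maybe Bool → QRow S L
answerRow (just b) = qans b
answerRow nothing  = qdead

-- In every step the front letter is removed, and the word given by δ is appended at the back.
record QM : Set₁ where
  field
    State Letter : Set
    states   : List State
    states∈  : ∀ s → s ∈ states
    letters  : List Letter
    letters∈ : ∀ l → l ∈ letters
    δ        : State → Letter → QRow State Letter

position : {A : Set} {x : A} {xs : List A} → x ∈ xs → ℕ
position (here _)  = 0
position (there p) = suc (position p)

split-position : {A : Set} {x : A} {xs : List A} (p : x ∈ xs) →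
                 ∃₂ λ before after → xs ≡ before ++ x ∷ after × length before ≡ position p
split-position (here refl) = [] , _ , refl , refl
split-position {xs = y ∷ _} (there p) with split-position p
... | before , after , eq , len-eq = y ∷ before , after , cong (y ∷_) eq , cong suc len-eq

position< : {A : Set} {x : A} {xs : List A} (p : x ∈ xs) → position p < length xs
position< (here _)  = s≤s z≤n
position< (there p) = s≤s (position< p)

module Encoding (Q : QM) where
  open QM Q

  Λ : ℕ
  Λ = length letters

  lcode : Letter → ℕ
  lcode l = position (letters∈ l)

  -- The rows are grouped by states, with Λ rows in each group. The unary state in front of the
  -- unary part of the front letter therefore adds up to the index of the row for this pair, and the
  -- universal machine never has to separate the two.
  scode : State → ℕ
  scode s = position (states∈ s) * Λ

  enc : Letter → List Bool
  enc l = replicate (lcode l) true ++ false ∷ []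

  encode : List Letter → List Bool
  encode = L.concatMap enc

  encRow : QRow State Letter → URow
  encRow (qgo w s) = go (encode w) (scode s)
  encRow (qans b)  = ans b
  encRow qdead     = dead

  rowsOf : State → List URow
  rowsOf s = L.map (λ l → encRow (δ s l)) letters

  rows : List URow
  rows = L.concatMap rowsOf states

  B : ℕ
  B = length (table rows)

  length-rowsOf : ∀ ss → length (L.concatMap rowsOf ss) ≡ length ss * Λ
  length-rowsOf []       = refl
  length-rowsOf (s ∷ ss) = trans (Lₚ.length-++ (rowsOf s))
    (cong₂ _+_ (Lₚ.length-map (λ l → encRow (δ s l)) letters) (length-rowsOf ss))

  row-position : ∀ s l → ∃₂ λ before after →
                 rows ≡ before ++ encRow (δ s l) ∷ after × length before ≡ scode s + lcode l
  row-position s l with split-position (states∈ s) | split-position (letters∈ l)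
  ... | ss , ss′ , seq , slen | ls , ls′ , leq , llen =
    L.concatMap rowsOf ss ++ L.map f ls , L.map f ls′ ++ L.concatMap rowsOf ss′ , eq , len-eq
    where
      f : Letter → URow
      f = λ l → encRow (δ s l)
      open ≡-Reasoning
      eq : rows ≡ (L.concatMap rowsOf ss ++ L.map f ls) ++ f l ∷ (L.map f ls′ ++ L.concatMap rowsOf ss′)
      eq = begin
        rows                                                 ≡⟨ cong (L.concatMap rowsOf) seq ⟩
        L.concatMap rowsOf (ss ++ s ∷ ss′)                   ≡⟨ Lₚ.concatMap-++ rowsOf ss (s ∷ ss′) ⟩
        L.concatMap rowsOf ss ++ (L.map f letters ++ L.concatMap rowsOf ss′)
          ≡⟨ cong (λ z → L.concatMap rowsOf ss ++ (z ++ L.concatMap rowsOf ss′)) (trans (cong (L.map f) leq) (Lₚ.map-++ f ls (l ∷ ls′))) ⟩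
        L.concatMap rowsOf ss ++ ((L.map f ls ++ f l ∷ L.map f ls′) ++ L.concatMap rowsOf ss′)
          ≡⟨ cong (L.concatMap rowsOf ss ++_) (Lₚ.++-assoc (L.map f ls) _ _) ⟩
        L.concatMap rowsOf ss ++ (L.map f ls ++ f l ∷ (L.map f ls′ ++ L.concatMap rowsOf ss′))
          ≡⟨ sym (Lₚ.++-assoc (L.concatMap rowsOf ss) _ _) ⟩
        (L.concatMap rowsOf ss ++ L.map f ls) ++ f l ∷ (L.map f ls′ ++ L.concatMap rowsOf ss′) ∎
      len-eq : length (L.concatMap rowsOf ss ++ L.map f ls) ≡ scode s + lcode l
      len-eq = trans (Lₚ.length-++ (L.concatMap rowsOf ss))
        (cong₂ _+_ (trans (length-rowsOf ss) (cong (_* Λ) slen)) (trans (Lₚ.length-map f ls) llen))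

  queue : State → List Letter → UCfg
  queue s ρ = ustart (replicate (scode s) true ++ encode ρ) rows

  replicate-+ : ∀ {A : Set} m n (x : A) → replicate (m + n) x ≡ replicate m x ++ replicate n x
  replicate-+ zero    n x = refl
  replicate-+ (suc m) n x = cong (x ∷_) (replicate-+ m n x)

  queue-front : ∀ s l ρ → replicate (scode s) true ++ encode (l ∷ ρ) ≡ replicate (scode s + lcode l) true ++ false ∷ encode ρ
  queue-front s l ρ = begin
    replicate (scode s) true ++ ((replicate (lcode l) true ++ false ∷ []) ++ encode ρ)
      ≡⟨ cong (replicate (scode s) true ++_) (Lₚ.++-assoc (replicate (lcode l) true) _ _) ⟩
    replicate (scode s) true ++ (replicate (lcode l) true ++ false ∷ encode ρ)
      ≡⟨ sym (Lₚ.++-assoc (replicate (scode s) true) _ _) ⟩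
    (replicate (scode s) true ++ replicate (lcode l) true) ++ false ∷ encode ρ
      ≡⟨ cong (_++ false ∷ encode ρ) (sym (replicate-+ (scode s) (lcode l) true)) ⟩
    replicate (scode s + lcode l) true ++ false ∷ encode ρ ∎
    where open ≡-Reasoning

  length-enc : ∀ l → length (enc l) ≤ Λ
  length-enc l = ≤-trans (≤-reflexive (trans (Lₚ.length-++ (replicate (lcode l) true))
    (trans (+-comm _ 1) (cong suc (Lₚ.length-replicate (lcode l)))))) (position< (letters∈ l))

  length-encode : ∀ ρ → length (encode ρ) ≤ length ρ * Λ
  length-encode []      = z≤n
  length-encode (l ∷ ρ) = ≤-trans (≤-reflexive (Lₚ.length-++ (enc l))) (+-mono-≤ (length-enc l) (length-encode ρ))

  module _ (s : State) (l : Letter) (ρ : List Letter) where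

    step-go : ∀ {w s′} → δ s l ≡ qgo w s′ → queue s (l ∷ ρ) ⇝⟨ 4 * B + 2 * (length ρ * Λ) ⟩ queue s′ (ρ ++ w)
    step-go {w} {s′} δeq with row-position s l
    ... | before , after , eq , len-eq rewrite δeq = ⇝-weaken (+-monoʳ-≤ (4 * B) (*-monoʳ-≤ 2 (length-encode ρ)))
      (subst (λ r → ustart (replicate (scode s) true ++ encode (l ∷ ρ)) r ⇝⟨ 4 * length (table r) + 2 * length (encode ρ) ⟩
                    ustart (replicate (scode s′) true ++ encode (ρ ++ w)) r) (sym eq)
        (subst (λ x → ustart x rs ⇝⟨ 4 * length (table rs) + 2 * length (encode ρ) ⟩
                      ustart (replicate (scode s′) true ++ encode (ρ ++ w)) rs)
               (sym (trans (queue-front s l ρ) (cong (λ z → replicate z true ++ false ∷ encode ρ) (sym len-eq))))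
          (subst (λ x → ustart (replicate (length before) true ++ false ∷ encode ρ) rs
                        ⇝⟨ 4 * length (table rs) + 2 * length (encode ρ) ⟩ ustart (replicate (scode s′) true ++ x) rs)
                 (sym (Lₚ.concatMap-++ enc ρ w))
            (row-go before (encode w) (scode s′) after (encode ρ)))))
      where rs = before ++ go (encode w) (scode s′) ∷ after

    step-ans : ∀ {b} → δ s l ≡ qans b → ∃ λ u → (queue s (l ∷ ρ) ⇝⟨ suc B ⟩ u) × Halted u (just b)
    step-ans {b} δeq with row-position s l
    ... | before , after , eq , len-eq rewrite δeq | queue-front s l ρ | sym len-eq =
      subst (λ r → ∃ λ u → (ustart (replicate (length before) true ++ false ∷ encode ρ) r ⇝⟨ suc (length (table r)) ⟩ u) × Halted u (just b))
        (sym eq) (row-ans before b after (encode ρ))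

    step-dead : δ s l ≡ qdead → ∃ λ u → (queue s (l ∷ ρ) ⇝⟨ suc B ⟩ u) × Halted u nothing
    step-dead δeq with row-position s l
    ... | before , after , eq , len-eq rewrite δeq | queue-front s l ρ | sym len-eq =
      subst (λ r → ∃ λ u → (ustart (replicate (length before) true ++ false ∷ encode ρ) r ⇝⟨ suc (length (table r)) ⟩ u) × Halted u nothing)
        (sym eq) (row-dead before after (encode ρ))

  data QRun (W : ℕ) : State → List Letter → ℕ → State → List Letter → Set where
    qdone : ∀ {s ρ} → QRun W s ρ 0 s ρ
    qmore : ∀ {s l ρ w s′ n s″ ρ″} → δ s l ≡ qgo w s′ → length ρ ≤ W →
            QRun W s′ (ρ ++ w) n s″ ρ″ → QRun W s (l ∷ ρ) (suc n) s″ ρ″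

  qrun-trans : ∀ {W s ρ n s′ ρ′ n′ s″ ρ″} → QRun W s ρ n s′ ρ′ → QRun W s′ ρ′ n′ s″ ρ″ → QRun W s ρ (n + n′) s″ ρ″
  qrun-trans qdone            r′ = r′
  qrun-trans (qmore eq le r)  r′ = qmore eq le (qrun-trans r r′)

  qrun-sound : ∀ {W s ρ n s′ ρ′} → QRun W s ρ n s′ ρ′ → queue s ρ ⇝⟨ n * (4 * B + 2 * (W * Λ)) ⟩ queue s′ ρ′
  qrun-sound qdone = ⇝-refl
  qrun-sound (qmore {s} {l} {ρ} eq le r) = ⇝-trans
    (⇝-weaken (+-monoʳ-≤ (4 * B) (*-monoʳ-≤ 2 (*-monoˡ-≤ Λ le))) (step-go s l ρ eq)) (qrun-sound r)

  qrun-answer : ∀ {W s ρ n m s′ l ρ′} a → QRun W s ρ n s′ (l ∷ ρ′) → n ≤ m → δ s′ l ≡ answerRow a →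
    ∃ λ u → (queue s ρ ⇝⟨ m * (4 * B + 2 * (W * Λ)) + suc B ⟩ u) × Halted u a
  qrun-answer {W} {s} {ρ} {n} {m} {s′} {l} {ρ′} (just b) r le δeq with step-ans s′ l ρ′ δeq
  ... | u , r′ , H = u , ⇝-trans (⇝-weaken (*-monoˡ-≤ (4 * B + 2 * (W * Λ)) le) (qrun-sound r)) r′ , H
  qrun-answer {W} {s} {ρ} {n} {m} {s′} {l} {ρ′} nothing r le δeq with step-dead s′ l ρ′ δeq
  ... | u , r′ , H = u , ⇝-trans (⇝-weaken (*-monoˡ-≤ (4 * B + 2 * (W * Λ)) le) (qrun-sound r)) r′ , H

  queue-start : ∀ {s ρ x b a} → scode s ≡ 0 → encode ρ ≡ x →
    (∃ λ u → (queue s ρ ⇝⟨ b ⟩ u) × Halted u a) → ∃ λ u → (ustart x rows ⇝⟨ b ⟩ u) × Halted u a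
  queue-start {s} {ρ} {x} {b} {a} eq refl h =
    subst (λ k → ∃ λ u → (ustart (replicate k true ++ encode ρ) rows ⇝⟨ b ⟩ u) × Halted u a) eq h

  table-answers : ∃ λ rows → ∃₂ λ B Λ → ∀ {W s ρ n m s′ l ρ′ x} a → scode s ≡ 0 → encode ρ ≡ x →
    QRun W s ρ n s′ (l ∷ ρ′) → n ≤ m → δ s′ l ≡ answerRow a →
    ∃ λ u → (ustart x rows ⇝⟨ m * (4 * B + 2 * (W * Λ)) + suc B ⟩ u) × Halted u a
  table-answers = rows , B , Λ , λ {W} {s} {ρ} a s≡ ρ≡ r n≤ δeq → queue-start {s} {ρ} s≡ ρ≡ (qrun-answer a r n≤ δeq)

-- Simulating a multi-tape machine by a queue machine

-- The tapes are folded at the heads: column j holds, for every tape, the j-th cell to the left of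
-- the head and the j-th cell from the head on.  A transition of the machine is one sweep over the
-- queue of columns, the new column j being a function of the old columns j - 1, j and j + 1.

vecs : {A : Set} → List A → ∀ k → List (Vec A k)
vecs as zero    = [] ∷ []
vecs as (suc k) = L.cartesianProductWith _∷_ as (vecs as k)

vecs∈ : {A : Set} {as : List A} → (∀ a → a ∈ as) → ∀ {k} (v : Vec A k) → v ∈ vecs as k
vecs∈ as∈ []      = here refl
vecs∈ as∈ (a ∷ v) = ∈-cartesianProductWith⁺ _∷_ (as∈ a) (vecs∈ as∈ v)

at : ∀ {n} → List (Fin (suc n)) → ℕ → Fin (suc n)
at []      _       = zero
at (a ∷ l) zero    = a
at (a ∷ l) (suc j) = at l j

at-beyond : ∀ {n} (l : List (Fin (suc n))) {j} → length l ≤ j → at l j ≡ zero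
at-beyond []      _        = refl
at-beyond (a ∷ l) (s≤s le) = at-beyond l le

Cell² : ℕ → Set
Cell² e = Γ e × Γ e

Column : ℕ → ℕ → Set
Column e k = Vec (Cell² e) k

cellAt : ∀ {e} → ℕ → Tape (Γ e) → Cell² e
cellAt j (tape l h r) = at l j , at (h ∷ r) j

colAt : ∀ {e k} → Vec (Tape (Γ e)) k → ℕ → Column e k
colAt ts j = V.map (cellAt j) ts

blankCol : ∀ {e k} → Column e k
blankCol {k = k} = V.replicate k (zero , zero)

newCell : ∀ {e} → Move → Cell² e → Cell² e → Cell² e → Cell² e
newCell mL (pl , pr) c (nl , nr) = nl , pr
newCell mR (pl , pr) c (nl , nr) = pl , nr
newCell mS p         c n         = c

newCol : ∀ {e k} → Vec Move k → Column e k → Column e k → Column e k → Column e k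
newCol []       []       []       []       = []
newCol (m ∷ ms) (p ∷ ps) (c ∷ cs) (n ∷ ns) = newCell m p c n ∷ newCol ms ps cs ns

-- The column "-1": what enters column 0 when a head moves.
fakeCol : ∀ {e k} → Vec (Γ e) k → Column e k → Column e k
fakeCol = V.zipWith (λ s c → s , proj₁ c)

writeCol : ∀ {e k} → Vec (Γ e) k → Column e k → Column e k
writeCol = V.zipWith (λ s c → proj₁ c , s)

shift : ∀ {e k} → Vec Move k → Column e k → Column e k → List (Column e k) → List (Column e k)
shift ms p c []      = newCol ms p c blankCol ∷ newCol ms c blankCol blankCol ∷ []
shift ms p c (n ∷ r) = newCol ms p c n ∷ shift ms c n r

shifted : ∀ {e k} → Vec Move k → Column e k → (ℕ → Column e k) → ℕ → Column e k
shifted ms p f zero    = newCol ms p (f 0) (f 1)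
shifted ms p f (suc j) = newCol ms (f j) (f (suc j)) (f (suc (suc j)))

applyUpTo-cong : {A : Set} {f g : ℕ → A} → (∀ j → f j ≡ g j) → ∀ n → L.applyUpTo f n ≡ L.applyUpTo g n
applyUpTo-cong eq zero    = refl
applyUpTo-cong eq (suc n) = cong₂ _∷_ (eq 0) (applyUpTo-cong (eq ∘ suc) n)

shift-applyUpTo : ∀ {e k} (ms : Vec Move k) (p : Column e k) f n → f (suc n) ≡ blankCol → f (suc (suc n)) ≡ blankCol →
  shift ms p (f 0) (L.applyUpTo (f ∘ suc) n) ≡ L.applyUpTo (shifted ms p f) (suc (suc n))
shift-applyUpTo ms p f zero    b b′ = cong₂ (λ x y → newCol ms p (f 0) x ∷ y ∷ []) (sym b)
  (cong₂ (newCol ms (f 0)) (sym b) (sym b′))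
shift-applyUpTo ms p f (suc n) b b′ = cong (newCol ms p (f 0) (f 1) ∷_)
  (trans (shift-applyUpTo ms (f 0) (f ∘ suc) n b b′)
         (applyUpTo-cong {f = shifted ms (f 0) (f ∘ suc)} {g = shifted ms p f ∘ suc} (λ { zero → refl ; (suc j) → refl }) (suc (suc n))))

module Sweep (M : TM) where
  open TM M

  stepTapes : ∀ {k} → Vec (Sym M) k → Vec Move k → Vec (Tape (Sym M)) k → Vec (Tape (Sym M)) k
  stepTapes ws ms ts = V.zipWith (moveTape M) ms (V.zipWith (writeTape M) ws ts)

  cell-step-zero : ∀ s m t → cellAt 0 (moveTape M m (writeTape M s t)) ≡
    newCell m (s , proj₁ (cellAt 0 t)) (cellAt 0 (writeTape M s t)) (cellAt 1 (writeTape M s t))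
  cell-step-zero s mL (tape [] h r)          = refl
  cell-step-zero s mL (tape (a ∷ []) h r)    = refl
  cell-step-zero s mL (tape (a ∷ b ∷ l) h r) = refl
  cell-step-zero s mR (tape l h [])          = refl
  cell-step-zero s mR (tape l h (a ∷ r))     = refl
  cell-step-zero s mS (tape l h r)           = refl

  cell-step-suc : ∀ s m t j → cellAt (suc j) (moveTape M m (writeTape M s t)) ≡
    newCell m (cellAt j (writeTape M s t)) (cellAt (suc j) (writeTape M s t)) (cellAt (suc (suc j)) (writeTape M s t))
  cell-step-suc s mL (tape [] h r)      j = refl
  cell-step-suc s mL (tape (a ∷ l) h r) j = refl
  cell-step-suc s mR (tape l h [])      j = refl
  cell-step-suc s mR (tape l h (a ∷ r)) j = refl
  cell-step-suc s mS (tape l h r)       j = refl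

  col-step : ∀ {k} (ws : Vec (Sym M) k) ms ts j →
    shifted ms (fakeCol ws (colAt ts 0)) (colAt (V.zipWith (writeTape M) ws ts)) j ≡ colAt (stepTapes ws ms ts) j
  col-step [] [] [] zero          = refl
  col-step [] [] [] (suc j)       = refl
  col-step (s ∷ ws) (m ∷ ms) (t ∷ ts) zero    = cong₂ _∷_ (sym (cell-step-zero s m t)) (col-step ws ms ts 0)
  col-step (s ∷ ws) (m ∷ ms) (t ∷ ts) (suc j) = cong₂ _∷_ (sym (cell-step-suc s m t j)) (col-step ws ms ts (suc j))

  col-write-zero : ∀ {k} (ws : Vec (Sym M) k) ts → writeCol ws (colAt ts 0) ≡ colAt (V.zipWith (writeTape M) ws ts) 0
  col-write-zero []       []       = refl
  col-write-zero (s ∷ ws) (t ∷ ts) = cong (_ ∷_) (col-write-zero ws ts)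

  col-write-suc : ∀ {k} (ws : Vec (Sym M) k) ts j → colAt (V.zipWith (writeTape M) ws ts) (suc j) ≡ colAt ts (suc j)
  col-write-suc []       []       j = refl
  col-write-suc (s ∷ ws) (t ∷ ts) j = cong (_ ∷_) (col-write-suc ws ts j)

  Fits : ∀ {k} → ℕ → Vec (Tape (Sym M)) k → Set
  Fits W []                = ⊤
  Fits W (tape l h r ∷ ts) = length l ≤ W × length r < W × Fits W ts

  fits-blank : ∀ {k} W (ts : Vec (Tape (Sym M)) k) → Fits W ts → ∀ {j} → W ≤ j → colAt ts j ≡ blankCol
  fits-blank W []                _            W≤j = refl
  fits-blank W (tape l h r ∷ ts) (a , b , fs) W≤j = cong₂ _∷_
    (cong₂ _,_ (at-beyond l (≤-trans a W≤j)) (at-beyond (h ∷ r) (≤-trans b W≤j))) (fits-blank W ts fs W≤j)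

  fits-step : ∀ {k} W (ws : Vec (Sym M) k) ms ts → Fits W ts → Fits (suc W) (stepTapes ws ms ts)
  fits-step W []       []        []                      _            = tt
  fits-step W (s ∷ ws) (mL ∷ ms) (tape [] h r ∷ ts)      (a , b , fs) = z≤n , s≤s b , fits-step W ws ms ts fs
  fits-step W (s ∷ ws) (mL ∷ ms) (tape (x ∷ l) h r ∷ ts) (a , b , fs) =
    ≤-trans (n≤1+n _) (m≤n⇒m≤1+n a) , s≤s b , fits-step W ws ms ts fs
  fits-step W (s ∷ ws) (mR ∷ ms) (tape l h [] ∷ ts)      (a , b , fs) = s≤s a , s≤s z≤n , fits-step W ws ms ts fs
  fits-step W (s ∷ ws) (mR ∷ ms) (tape l h (x ∷ r) ∷ ts) (a , b , fs) =
    s≤s a , m≤n⇒m≤1+n (≤-trans (n≤1+n _) b) , fits-step W ws ms ts fs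
  fits-step W (s ∷ ws) (mS ∷ ms) (tape l h r ∷ ts)       (a , b , fs) =
    m≤n⇒m≤1+n a , m≤n⇒m≤1+n b , fits-step W ws ms ts fs

bitOf : List ℕ → Maybe Bool
bitOf (1 ∷ []) = just false
bitOf (2 ∷ []) = just true
bitOf _        = nothing

bitOf-outBit : ∀ b → bitOf (outBit b) ≡ just b
bitOf-outBit false = refl
bitOf-outBit true  = refl

outBit-bitOf : ∀ o {b} → bitOf o ≡ just b → o ≡ outBit b
outBit-bitOf (1 ∷ []) refl = refl
outBit-bitOf (2 ∷ []) refl = refl
outBit-bitOf []             ()
outBit-bitOf (0 ∷ [])       ()
outBit-bitOf (suc (suc (suc _)) ∷ []) ()
outBit-bitOf (0 ∷ _ ∷ _)    ()
outBit-bitOf (1 ∷ _ ∷ _)    ()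
outBit-bitOf (2 ∷ _ ∷ _)    ()
outBit-bitOf (suc (suc (suc _)) ∷ _ ∷ _) ()

module Simulator (M : TM) (w : List InSym) where
  open TM M
  open Sweep M

  Col : Set
  Col = Column extra (suc work)

  data QState : Set where
    init copy : QState
    start′    : Fin (suc nStates) → QState
    sweep     : Fin (suc nStates) → Vec Move (suc work) → Col → Col → QState
    halt      : Sym M → QState

  data QLetter : Set where
    raw  : Bool → QLetter
    endL : QLetter
    col  : Col → QLetter

  bitOp : Bool → InSym
  bitOp b = if b then i1 else i0

  inCol : InSym → Col
  inCol a = (zero , inSym M a) ∷ V.replicate work (zero , zero)

  -- The output is read from the head up to the first blank. It is a single bit exactly if the head
  -- shows a bit and the cell to its right, which is found in the next column, is blank.
  verdict : Sym M → Sym M → QRow QState QLetter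
  verdict 1F 0F = qans false
  verdict 2F 0F = qans true
  verdict _  _  = qdead

  δstart : Col → Maybe (Fin (suc nStates) × Vec (Sym M) (suc work) × Vec Move (suc work)) → QRow QState QLetter
  δstart c nothing               = qgo [] (halt (proj₂ (V.head c)))
  δstart c (just (q , ws , ms))  = qgo [] (sweep q ms (fakeCol ws c) (writeCol ws c))

  δQ : QState → QLetter → QRow QState QLetter
  -- The fixed prefix `w` is built into the very first transition. Thus a machine with a parameter
  -- in front of its input becomes a table that works on `x` alone.
  δQ init             (raw b) = qgo (L.map (col ∘ inCol) w ++ col (inCol (bitOp b)) ∷ []) copy
  δQ init             _       = qdead
  δQ copy             (raw b) = qgo (col (inCol (bitOp b)) ∷ []) copy
  δQ copy             endL    = qgo (endL ∷ []) (start′ start)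
  δQ copy             (col _) = qdead
  δQ (start′ q)       (col c) = δstart c (δ q (V.map proj₂ c))
  δQ (start′ q)       _       = qdead
  δQ (sweep q ms p c) (col n) = qgo (col (newCol ms p c n) ∷ []) (sweep q ms c n)
  δQ (sweep q ms p c) endL    =
    qgo (col (newCol ms p c blankCol) ∷ col (newCol ms c blankCol blankCol) ∷ endL ∷ []) (start′ q)
  δQ (sweep q ms p c) (raw _) = qdead
  δQ (halt s)         (col c) = verdict s (proj₂ (V.head c))
  δQ (halt s)         endL    = verdict s zero
  δQ (halt s)         (raw _) = qdead

  columns : List Col
  columns = vecs (L.cartesianProductWith _,_ (L.allFin _) (L.allFin _)) (suc work)

  columns∈ : ∀ c → c ∈ columns
  columns∈ = vecs∈ (λ { (a , b) → ∈-cartesianProductWith⁺ _,_ (∈-allFin a) (∈-allFin b) })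

  moves : List (Vec Move (suc work))
  moves = vecs (mL ∷ mR ∷ mS ∷ []) (suc work)

  moves∈ : ∀ ms → ms ∈ moves
  moves∈ = vecs∈ λ { mL → here refl ; mR → there (here refl) ; mS → there (there (here refl)) }

  sweeps : List QState
  sweeps = L.cartesianProductWith _$_ (L.cartesianProductWith _$_ (L.cartesianProductWith sweep (L.allFin _) moves) columns) columns

  states′ : List QState
  -- `init` stands first, so its code is 0 and the initial queue carries no unary prefix for the
  -- state.
  states′ = init ∷ copy ∷ L.map start′ (L.allFin _) ++ L.map halt (L.allFin _) ++ sweeps

  states∈′ : ∀ s → s ∈ states′
  states∈′ init             = here refl
  states∈′ copy             = there (here refl)
  states∈′ (start′ q)       = there (there (∈-++⁺ˡ (∈-map⁺ start′ (∈-allFin q))))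
  states∈′ (halt s)         = there (there (∈-++⁺ʳ (L.map start′ (L.allFin _)) (∈-++⁺ˡ (∈-map⁺ halt (∈-allFin s)))))
  states∈′ (sweep q ms p c) = there (there (∈-++⁺ʳ (L.map start′ (L.allFin _)) (∈-++⁺ʳ (L.map halt (L.allFin _))
    (∈-cartesianProductWith⁺ _$_ (∈-cartesianProductWith⁺ _$_ (∈-cartesianProductWith⁺ sweep (∈-allFin q) (moves∈ ms))
      (columns∈ p)) (columns∈ c)))))

  letters∈′ : ∀ l → l ∈ raw false ∷ raw true ∷ endL ∷ L.map col columns
  letters∈′ (raw false) = here refl
  letters∈′ (raw true)  = there (here refl)
  letters∈′ endL        = there (there (here refl))
  letters∈′ (col c)     = there (there (there (∈-map⁺ col (columns∈ c))))

  Q : QM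
  Q = record { State = QState ; Letter = QLetter ; states = states′ ; states∈ = states∈′
             ; letters = raw false ∷ raw true ∷ endL ∷ L.map col columns ; letters∈ = letters∈′ ; δ = δQ }

  open Encoding Q using (QRun; qdone; qmore; qrun-trans; table-answers) public

  config : ℕ → Vec (Tape (Sym M)) (suc work) → List QLetter
  config W ts = L.map col (L.applyUpTo (colAt ts) W) ++ endL ∷ []

  col-heads : ∀ {k} (ts : Vec (Tape (Sym M)) k) → V.map proj₂ (colAt ts 0) ≡ V.map Tape.hd ts
  col-heads []                = refl
  col-heads (tape l h r ∷ ts) = cong (h ∷_) (col-heads ts)

  length-queue : ∀ rest out → length (L.map col rest ++ endL ∷ out) ≡ length rest + suc (length out)
  length-queue rest out = trans (Lₚ.length-++ (L.map col rest)) (cong (_+ suc (length out)) (Lₚ.length-map col rest))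

  run-sweep : ∀ {Wm} q ms p c rest out → length rest + suc (length out) ≤ Wm →
    QRun Wm (sweep q ms p c) (L.map col rest ++ endL ∷ L.map col out) (suc (length rest))
            (start′ q) (L.map col (out ++ shift ms p c rest) ++ endL ∷ [])
  run-sweep {Wm} q ms p c [] out le =
    qmore refl (≤-trans (≤-reflexive (Lₚ.length-map col out)) (≤-trans (n≤1+n _) le))
      (subst (λ z → QRun Wm (start′ q) (L.map col out ++ last) 0 (start′ q) z) eq qdone)
    where
      cols = newCol ms p c blankCol ∷ newCol ms c blankCol blankCol ∷ []
      last = L.map col cols ++ endL ∷ []
      eq : L.map col out ++ last ≡ L.map col (out ++ cols) ++ endL ∷ []
      eq = sym (trans (cong (_++ endL ∷ []) (Lₚ.map-++ col out cols)) (Lₚ.++-assoc (L.map col out) (L.map col cols) _))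
  run-sweep {Wm} q ms p c (n ∷ rest) out le =
    qmore refl (≤-trans (≤-reflexive (trans (length-queue rest (L.map col out)) (cong (λ z → length rest + suc z) (Lₚ.length-map col out))))
                        (≤-trans (n≤1+n _) le))
      (subst (λ z → QRun Wm (sweep q ms c n) z (suc (length rest)) (start′ q) (L.map col (out ++ newCol ms p c n ∷ shift ms c n rest) ++ endL ∷ []))
             (sym (trans (Lₚ.++-assoc (L.map col rest) _ _) (cong (λ z → L.map col rest ++ endL ∷ z) (sym (Lₚ.map-++ col out _)))))
        (subst (λ z → QRun Wm (sweep q ms c n) (L.map col rest ++ endL ∷ L.map col (out ++ newCol ms p c n ∷ [])) (suc (length rest))
                       (start′ q) (L.map col z ++ endL ∷ []))
               (Lₚ.++-assoc out _ _)
          (run-sweep q ms c n rest (out ++ newCol ms p c n ∷ [])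
            (≤-trans (≤-reflexive (trans (cong (λ z → length rest + suc z) (trans (Lₚ.length-++ out) (+-comm (length out) 1)))
                                         (+-suc (length rest) (suc (length out))))) le))))

  -- A sweep rotates the queue once. It adds one column, which makes room for the cells that the
  -- moving heads shift away from the fold.
  run-transition : ∀ {Wm} W q ts {q′ ws ms} → δ q (V.map Tape.hd ts) ≡ just (q′ , ws , ms) → Fits (suc W) ts → suc W ≤ Wm →
    QRun Wm (start′ q) (config (suc W) ts) (suc (suc W)) (start′ q′) (config (suc (suc W)) (stepTapes ws ms ts))
  run-transition {Wm} W q ts {q′} {ws} {ms} δeq fs le =
    qmore (cong (δstart (colAt ts 0)) (trans (cong (δ q) (col-heads ts)) δeq)) len₀
      (subst (λ z → QRun Wm (sweep q′ ms (fakeCol ws (colAt ts 0)) (writeCol ws (colAt ts 0))) z (suc W) (start′ q′) (config (suc (suc W)) ts′))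
        (sym (Lₚ.++-identityʳ _))
        (subst (λ n → QRun Wm (sweep q′ ms (fakeCol ws (colAt ts 0)) (writeCol ws (colAt ts 0))) (config′ rest₀) (suc n) (start′ q′) (config (suc (suc W)) ts′))
          (Lₚ.length-applyUpTo (colAt ts ∘ suc) W)
          (subst (λ z → QRun Wm (sweep q′ ms (fakeCol ws (colAt ts 0)) (writeCol ws (colAt ts 0))) (config′ rest₀) (suc (length rest₀)) (start′ q′) (config′ z))
            shift-eq (run-sweep q′ ms _ _ rest₀ [] len₁))))
    where
      ts′ = stepTapes ws ms ts
      rest₀ = L.applyUpTo (colAt ts ∘ suc) W
      config′ : List Col → List QLetter
      config′ cs = L.map col cs ++ endL ∷ []
      written = V.zipWith (writeTape M) ws ts
      len₁ : length rest₀ + 1 ≤ Wm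
      len₁ = ≤-trans (≤-reflexive (trans (cong (_+ 1) (Lₚ.length-applyUpTo (colAt ts ∘ suc) W)) (+-comm W 1))) le
      len₀ : length (config′ rest₀) ≤ Wm
      len₀ = ≤-trans (≤-reflexive (length-queue rest₀ [])) len₁
      shift-eq : shift ms (fakeCol ws (colAt ts 0)) (writeCol ws (colAt ts 0)) rest₀ ≡ L.applyUpTo (colAt ts′) (suc (suc W))
      shift-eq = trans (cong₂ (shift ms (fakeCol ws (colAt ts 0))) (col-write-zero ws ts)
                         (applyUpTo-cong (λ j → sym (col-write-suc ws ts j)) W))
        (trans (shift-applyUpTo ms (fakeCol ws (colAt ts 0)) (colAt written) W
                 (trans (col-write-suc ws ts W) (fits-blank (suc W) ts fs ≤-refl))
                 (trans (col-write-suc ws ts (suc W)) (fits-blank (suc W) ts fs (n≤1+n _))))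
               (applyUpTo-cong (col-step ws ms ts) (suc (suc W))))

-- In every simulator the letters `raw false`, `raw true` and `endL` come first and have the codes
-- 0, 10 and 110. Hence the initial queue does not depend on the simulated machine, and a code can
-- be run on `x` without being analysed.
xload : List Bool → List Bool
xload []          = true ∷ true ∷ false ∷ []
xload (false ∷ x) = false ∷ xload x
xload (true ∷ x)  = true ∷ false ∷ xload x

module Simulation (M : TM) (w : List InSym) where
  open TM M
  open Sweep M
  open Simulator M w

  verdict-output : ∀ q l h r {k} (ts : Vec (Tape (Sym M)) work) → k ≡ at r 0 → verdict h k ≡ answerRow (bitOf (output M (q , tape l h r ∷ ts)))
  verdict-output q l 0F r           ts refl = refl
  verdict-output q l 1F []          ts refl = refl
  verdict-output q l 1F (zero ∷ r)  ts refl = refl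
  verdict-output q l 1F (suc _ ∷ r) ts refl = refl
  verdict-output q l 2F []          ts refl = refl
  verdict-output q l 2F (zero ∷ r)  ts refl = refl
  verdict-output q l 2F (suc _ ∷ r) ts refl = refl
  verdict-output q l (suc (suc (suc h))) []          ts refl = refl
  verdict-output q l (suc (suc (suc h))) (zero ∷ r)  ts refl = refl
  verdict-output q l (suc (suc (suc h))) (suc _ ∷ r) ts refl = refl

  record Final (Wm n : ℕ) (s : QState) (ρ : List QLetter) (o : List ℕ) : Set where
    constructor final
    field
      {steps}  : ℕ
      {state}  : QState
      {letter} : QLetter
      {rest}   : List QLetter
      steps≤   : steps ≤ n
      qrun     : QRun Wm s ρ steps state (letter ∷ rest)
      row-eq   : δQ state letter ≡ answerRow (bitOf o)

  run-halt : ∀ {Wm} W q ts → δ q (V.map Tape.hd ts) ≡ nothing → Fits (suc W) ts → suc W ≤ Wm →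
             Final Wm 1 (start′ q) (config (suc W) ts) (output M (q , ts))
  run-halt {Wm} zero q (tape l h [] ∷ ts) δeq fs le = final ≤-refl
    (qmore (cong (δstart (colAt (tape l h [] ∷ ts) 0)) (trans (cong (δ q) (col-heads (tape l h [] ∷ ts))) δeq)) le qdone)
    (verdict-output q l h [] ts refl)
  run-halt zero q (tape l h (x ∷ r) ∷ ts) δeq (_ , s≤s () , _) le
  run-halt {Wm} (suc W) q (tape l h r ∷ ts) δeq fs le = final ≤-refl
    (qmore (cong (δstart (colAt (tape l h r ∷ ts) 0)) (trans (cong (δ q) (col-heads (tape l h r ∷ ts))) δeq))
      (≤-trans (≤-reflexive tail-length) le)
      (subst (λ z → QRun Wm (halt h) z 0 (halt h) tail) (sym (Lₚ.++-identityʳ tail)) qdone))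
    (verdict-output q l h r ts refl)
    where
      cols : List Col
      cols = L.applyUpTo (λ j → colAt (tape l h r ∷ ts) (suc j)) (suc W)
      tail : List QLetter
      tail = L.map col cols ++ endL ∷ []
      tail-length : length tail ≡ suc (suc W)
      tail-length = trans (length-queue cols []) (trans (+-comm (length cols) 1)
        (cong suc (Lₚ.length-applyUpTo (λ j → colAt (tape l h r ∷ ts) (suc j)) (suc W))))

  run-machine : ∀ {Wm} t q ts {o} → runFor M (suc t) (q , ts) ≡ just o → ∀ W → Fits (suc W) ts → suc W + suc t ≤ Wm →
                Final Wm (suc t * Wm) (start′ q) (config (suc W) ts) o
  run-machine {Wm} t q ts eq W fs le with δ q (V.map Tape.hd ts) in δeq
  run-machine {Wm} t q ts refl W fs le | nothing with run-halt {Wm} W q ts δeq fs (≤-trans (m≤m+n _ _) le)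
  ... | final n≤ r e = final (≤-trans n≤ (≤-trans (≤-trans (s≤s z≤n) le) (m≤m+n Wm (t * Wm)))) r e
  run-machine zero q ts () W fs le | just _
  run-machine {Wm} (suc t) q ts eq W fs le | just (q′ , ws , ms)
    with run-machine {Wm} t q′ (stepTapes ws ms ts) eq (suc W) (fits-step (suc W) ws ms ts fs)
           (≤-trans (≤-reflexive (cong suc (sym (+-suc W (suc t))))) le)
  ... | final n≤ r e = final
    (+-mono-≤ (≤-trans (≤-reflexive (+-comm 1 (suc W))) (≤-trans (+-monoʳ-≤ (suc W) (s≤s z≤n)) le)) n≤)
    (qrun-trans (run-transition W q ts δeq fs (≤-trans (m≤m+n _ _) le)) r) e

  bitCols : List Bool → List QLetter
  bitCols = L.map (col ∘ inCol ∘ bitOp)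

  run-copy : ∀ {Wm} x out → length x + suc (length out) ≤ Wm →
    QRun Wm copy (L.map raw x ++ endL ∷ out) (suc (length x)) (start′ start) ((out ++ bitCols x) ++ endL ∷ [])
  run-copy {Wm} [] out le = qmore refl (≤-trans (n≤1+n _) le)
    (subst (λ z → QRun Wm (start′ start) z 0 (start′ start) ((out ++ []) ++ endL ∷ [])) (cong (_++ endL ∷ []) (Lₚ.++-identityʳ out)) qdone)
  run-copy {Wm} (b ∷ x) out le = qmore refl
    (≤-trans (≤-reflexive (trans (Lₚ.length-++ (L.map raw x)) (cong (_+ suc (length out)) (Lₚ.length-map raw x)))) (≤-trans (n≤1+n _) le))
    (subst (λ z → QRun Wm copy z (suc (length x)) (start′ start) ((out ++ bitCols (b ∷ x)) ++ endL ∷ [])) (sym (Lₚ.++-assoc (L.map raw x) _ _))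
    (subst (λ z → QRun Wm copy (L.map raw x ++ endL ∷ (out ++ c ∷ [])) (suc (length x)) (start′ start) (z ++ endL ∷ [])) (Lₚ.++-assoc out (c ∷ []) (bitCols x))
      (run-copy x (out ++ c ∷ []) (≤-trans (≤-reflexive (trans (cong (λ z → length x + suc z) (trans (Lₚ.length-++ out) (+-comm (length out) 1)))
                                         (+-suc (length x) (suc (length out))))) le))))
    where c = col (inCol (bitOp b))

  cell-blank : ∀ j → cellAt {extra} j (tape [] zero []) ≡ (zero , zero)
  cell-blank zero    = refl
  cell-blank (suc j) = refl

  blank-cols : ∀ j k → colAt (V.replicate k (tape [] (blank M) [])) j ≡ V.replicate k (zero , zero)
  blank-cols j zero    = refl
  blank-cols j (suc k) = cong₂ _∷_ (cell-blank j) (blank-cols j k)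

  applyUpTo-at : ∀ {A : Set} (f : Sym M → A) l → L.applyUpTo (λ j → f (at l j)) (length l) ≡ L.map f l
  applyUpTo-at f []      = refl
  applyUpTo-at f (a ∷ l) = cong (f a ∷_) (applyUpTo-at f l)

  config-init : ∀ a v → config (suc (length v)) (proj₂ (initConfig M (a ∷ v))) ≡ L.map (col ∘ inCol) (a ∷ v) ++ endL ∷ []
  config-init a v = cong (_++ endL ∷ []) (begin
    L.map col (L.applyUpTo (colAt (proj₂ (initConfig M (a ∷ v)))) (suc (length v)))
      ≡⟨ cong (L.map col) (applyUpTo-cong (λ j → cong ((zero , at (inSym M a ∷ L.map (inSym M) v) j) ∷_) (blank-cols j work)) (suc (length v))) ⟩
    L.map col (L.applyUpTo (λ j → f (at (L.map (inSym M) (a ∷ v)) j)) (suc (length v)))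
      ≡⟨ cong (λ n → L.map col (L.applyUpTo (λ j → f (at (L.map (inSym M) (a ∷ v)) j)) (suc n))) (sym (Lₚ.length-map (inSym M) v)) ⟩
    L.map col (L.applyUpTo (λ j → f (at (L.map (inSym M) (a ∷ v)) j)) (length (L.map (inSym M) (a ∷ v))))
      ≡⟨ cong (L.map col) (applyUpTo-at f (L.map (inSym M) (a ∷ v))) ⟩
    L.map col (L.map f (L.map (inSym M) (a ∷ v)))
      ≡⟨ cong (L.map col) (sym (Lₚ.map-∘ (a ∷ v))) ⟩
    L.map col (L.map inCol (a ∷ v))
      ≡⟨ sym (Lₚ.map-∘ (a ∷ v)) ⟩
    L.map (col ∘ inCol) (a ∷ v) ∎)
    where
      open ≡-Reasoning
      f : Sym M → Col
      f s = (zero , s) ∷ V.replicate work (zero , zero)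

  fits-blanks : ∀ k W → Fits (suc W) (V.replicate k (tape [] (blank M) []))
  fits-blanks zero    W = tt
  fits-blanks (suc k) W = z≤n , s≤s z≤n , fits-blanks k W

  fits-init : ∀ a v → Fits (suc (length v)) (proj₂ (initConfig M (a ∷ v)))
  fits-init a v = z≤n , s≤s (≤-reflexive (Lₚ.length-map (inSym M) v)) , fits-blanks work (length v)

  run-init : ∀ {Wm} b x → length w + suc (suc (length x)) ≤ Wm →
    QRun Wm init (L.map raw (b ∷ x) ++ endL ∷ []) (suc (suc (length x))) (start′ start)
         (L.map (col ∘ inCol) (w ++ bits (b ∷ x)) ++ endL ∷ [])
  run-init {Wm} b x le = qmore refl
    (≤-trans (≤-reflexive (trans (Lₚ.length-++ (L.map raw x)) (trans (+-comm _ 1) (cong suc (Lₚ.length-map raw x)))))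
       (≤-trans (≤-trans (n≤1+n _) (m≤n+m _ (length w))) le))
    (subst (λ z → QRun Wm copy z (suc (length x)) (start′ start) (L.map (col ∘ inCol) (w ++ bits (b ∷ x)) ++ endL ∷ []))
           (sym (Lₚ.++-assoc (L.map raw x) _ _))
      (subst (λ z → QRun Wm copy (L.map raw x ++ endL ∷ out) (suc (length x)) (start′ start) (z ++ endL ∷ [])) eq
        (run-copy x out (≤-trans (≤-reflexive len-out) le))))
    where
      out = L.map (col ∘ inCol) w ++ col (inCol (bitOp b)) ∷ []
      len-out : length x + suc (length out) ≡ length w + suc (suc (length x))
      len-out = begin
        length x + suc (length out)     ≡⟨ cong (λ z → length x + suc z) (trans (Lₚ.length-++ (L.map (col ∘ inCol) w)) (cong (_+ 1) (Lₚ.length-map (col ∘ inCol) w))) ⟩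
        length x + suc (length w + 1)   ≡⟨ solve 2 (λ a b → a :+ (con 1 :+ (b :+ con 1)) := b :+ (con 2 :+ a)) refl (length x) (length w) ⟩
        length w + suc (suc (length x)) ∎
        where
          open ≡-Reasoning
          open +-*-Solver
      eq : out ++ bitCols x ≡ L.map (col ∘ inCol) (w ++ bits (b ∷ x))
      eq = begin
        out ++ bitCols x                                     ≡⟨ Lₚ.++-assoc (L.map (col ∘ inCol) w) _ _ ⟩
        L.map (col ∘ inCol) w ++ bitCols (b ∷ x)             ≡⟨ cong (L.map (col ∘ inCol) w ++_) (Lₚ.map-∘ (b ∷ x)) ⟩
        L.map (col ∘ inCol) w ++ L.map (col ∘ inCol) (bits (b ∷ x)) ≡⟨ sym (Lₚ.map-++ (col ∘ inCol) w _) ⟩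
        L.map (col ∘ inCol) (w ++ bits (b ∷ x)) ∎
        where open ≡-Reasoning

  run-all : ∀ {Wm t o} b x → HaltsWithin M (w ++ bits (b ∷ x)) t o → length w + suc (length x) + suc t ≤ Wm →
    Final Wm (suc (suc (length x)) + suc t * Wm) init (L.map raw (b ∷ x) ++ endL ∷ []) o
  run-all {Wm} {t} {o} b x h le with w ++ bits (b ∷ x) in weq
  ... | [] = contradiction (trans (sym (Lₚ.length-++ w)) (cong length weq)) (m+1+n≢0 (length w))
  ... | a ∷ v with run-machine {Wm} t start (proj₂ (initConfig M (a ∷ v))) h (length v) (fits-init a v)
                    (≤-trans (≤-reflexive (cong (_+ suc t) len-v)) le)
    where
      len-v : length (a ∷ v) ≡ length w + suc (length x)
      len-v = trans (cong length (sym weq)) (trans (Lₚ.length-++ w) (cong (λ z → length w + suc z) (Lₚ.length-map _ x)))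
  ... | final n≤ r e = final (+-monoʳ-≤ (suc (suc (length x))) n≤)
    (qrun-trans (subst (λ z → QRun Wm init (L.map raw (b ∷ x) ++ endL ∷ []) (suc (suc (length x))) (start′ start) z)
                       (trans (cong (λ z → L.map (col ∘ inCol) z ++ endL ∷ []) weq) (sym (config-init a v)))
                   (run-init b x (≤-trans (≤-trans (≤-reflexive (+-suc (length w) _)) (≤-trans (m≤m+n _ t) (≤-reflexive (sym (+-suc _ t))))) le)))
                r) e

  encode-load : ∀ x → Encoding.encode Q (L.map raw x ++ endL ∷ []) ≡ xload x
  encode-load []          = refl
  encode-load (false ∷ x) = cong (false ∷_) (encode-load x)
  encode-load (true ∷ x)  = cong (λ z → true ∷ false ∷ z) (encode-load x)

  simulate : ∃ λ rows → ∃₂ λ B Λ → ∀ {Wm t o} (x : Str) → HaltsWithin M (w ++ strIn x) t o → length w + len x + suc t ≤ Wm →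
    ∃ λ u → (ustart (xload (toList x)) rows ⇝⟨ (suc (len x) + suc t * Wm) * (4 * B + 2 * (Wm * Λ)) + suc B ⟩ u) × Halted u (bitOf o)
  simulate with table-answers
  ... | rows , B , Λ , answers = rows , B , Λ , answered
    where
      answered : ∀ {Wm t o} (x : Str) → HaltsWithin M (w ++ strIn x) t o → length w + len x + suc t ≤ Wm →
        ∃ λ u → (ustart (xload (toList x)) rows ⇝⟨ (suc (len x) + suc t * Wm) * (4 * B + 2 * (Wm * Λ)) + suc B ⟩ u) × Halted u (bitOf o)
      answered {Wm} {o = o} (b ∷ x) h le with run-all {Wm} b x h le
      ... | final n≤ r e = answers (bitOf o) refl (encode-load (b ∷ x)) r n≤ e

-- The polynomial overhead of the simulation

length-toList : ∀ (x : Str) → len x ≡ length (toList x)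
length-toList (_ ∷ _) = refl

len≥1 : ∀ (x : Str) → 1 ≤ len x
len≥1 (_ ∷ _) = s≤s z≤n

^-≥1 : ∀ {n} c → 1 ≤ n → 1 ≤ n ^ c
^-≥1 {suc n} c _ = m^n>0 (suc n) c

scale : ∀ a {N} → 1 ≤ N → a ≤ a * N
scale a le = ≤-trans (≤-reflexive (sym (*-identityʳ a))) (*-monoʳ-≤ a le)

-- The bound is cubic: T transitions are T sweeps over a queue of O(N) letters, and each letter
-- costs the universal machine O(N) steps.
time-bound : ∀ lw n d N T B Λ → 1 ≤ N → n ≤ N → T ≤ d * N → let α = lw + 1 + d + 1 in
  (suc n + suc T * (α * N)) * (4 * B + 2 * (α * N * Λ)) + suc B ≤
  ((2 + suc d * α) * (4 * B + 2 * (α * Λ)) + suc B) * (N * N * N)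
time-bound lw n d N T B Λ N≥1 n≤ T≤ = begin
  (suc n + suc T * (α * N)) * (4 * B + 2 * (α * N * Λ)) + suc B
    ≤⟨ +-mono-≤ (*-mono-≤ (+-mono-≤ {x = suc n} sn (*-monoˡ-≤ (α * N) sT)) (+-mono-≤ (scale (4 * B) N≥1) (≤-refl {2 * (α * N * Λ)}))) (scale (suc B) NN≥1) ⟩
  (2 * N * N + suc d * N * (α * N)) * (4 * B * N + 2 * (α * N * Λ)) + suc B * (N * N * N)
    ≡⟨ solve 5 (λ N D α B Λ → (con 2 :* N :* N :+ D :* N :* (α :* N)) :* (con 4 :* B :* N :+ con 2 :* (α :* N :* Λ)) :+ (con 1 :+ B) :* (N :* N :* N)
         := ((con 2 :+ D :* α) :* (con 4 :* B :+ con 2 :* (α :* Λ)) :+ (con 1 :+ B)) :* (N :* N :* N)) refl N (suc d) α B Λ ⟩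
  ((2 + suc d * α) * (4 * B + 2 * (α * Λ)) + suc B) * (N * N * N) ∎
  where
    open ≤-Reasoning
    open +-*-Solver
    α = lw + 1 + d + 1
    NN≥1 : 1 ≤ N * N * N
    NN≥1 = *-mono-≤ (*-mono-≤ N≥1 N≥1) N≥1
    sn : suc n ≤ 2 * N * N
    sn = ≤-trans (+-mono-≤ N≥1 n≤) (≤-trans (≤-reflexive (cong (N +_) (sym (+-identityʳ N)))) (scale (2 * N) N≥1))
    sT : suc T ≤ suc d * N
    sT = +-mono-≤ N≥1 T≤

-- The power `suc c` instead of `c` makes N an upper bound for the length of the input even if c =
-- 0.
simulation-bound : ∀ M w c d → (∀ x → ∃ λ o → HaltsWithin M (w ++ strIn x) (d * len x ^ c) o) →
  ∃₂ λ rows K → ∀ x o → Halts M (w ++ strIn x) o → let N = len x ^ suc c in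
    ∃ λ u → (ustart (xload (toList x)) rows ⇝⟨ K * (N * N * N) ⟩ u) × Halted u (bitOf o)
simulation-bound M w c d total with Simulation.simulate M w
... | rows , B , Λ , sim = rows , (2 + suc d * α) * (4 * B + 2 * (α * Λ)) + suc B , λ x o h → help x o h (total x)
  where
    α = length w + 1 + d + 1
    help : ∀ x o → Halts M (w ++ strIn x) o → (∃ λ o′ → HaltsWithin M (w ++ strIn x) (d * len x ^ c) o′) → let N = len x ^ suc c in
      ∃ λ u → (ustart (xload (toList x)) rows ⇝⟨ ((2 + suc d * α) * (4 * B + 2 * (α * Λ)) + suc B) * (N * N * N) ⟩ u) × Halted u (bitOf o)
    help x o h (o′ , h′) with halts-unique M {w ++ strIn x} h (_ , h′)
    ... | refl = let (u , r , H) = sim x h′ width≤ in u , ⇝-weaken bound r , H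
      where
        N = len x ^ suc c
        N≥1 : 1 ≤ N
        N≥1 = ^-≥1 (suc c) (len≥1 x)
        n≤N : len x ≤ N
        n≤N = scale (len x) (^-≥1 c (len≥1 x))
        T≤ : d * len x ^ c ≤ d * N
        T≤ = *-monoʳ-≤ d (≤-trans (≤-reflexive (sym (*-identityˡ _))) (*-monoˡ-≤ (len x ^ c) (len≥1 x)))
        bound = time-bound (length w) (len x) d N (d * len x ^ c) B Λ N≥1 n≤N T≤
        width≤ : length w + len x + suc (d * len x ^ c) ≤ α * N
        width≤ = begin
          length w + len x + suc (d * len x ^ c) ≤⟨ +-mono-≤ (+-mono-≤ (scale (length w) N≥1) n≤N) (+-mono-≤ N≥1 T≤) ⟩
          length w * N + N + (N + d * N)         ≡⟨ solve 3 (λ w N d → w :* N :+ N :+ (N :+ d :* N) := (w :+ con 1 :+ d :+ con 1) :* N) refl (length w) N d ⟩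
          α * N ∎
          where
            open ≤-Reasoning
            open +-*-Solver

-- Abstract, because unfolding the table is very slow.
abstract
  table-for : ∀ M w c d → (∀ x → ∃ λ o → HaltsWithin M (w ++ strIn x) (d * len x ^ c) o) →
    ∃₂ λ rows K → ∀ x o → Halts M (w ++ strIn x) o → let N = len x ^ suc c in
      ∃ λ u → (ustart (xload (toList x)) rows ⇝⟨ K * (N * N * N) ⟩ u) × Halted u (bitOf o)
  table-for = simulation-bound

-- Codes and candidates

inc : List (Fin 7) → List (Fin 7)
inc []       = 0F ∷ []
inc (0F ∷ l) = 1F ∷ l
inc (1F ∷ l) = 2F ∷ l
inc (2F ∷ l) = 3F ∷ l
inc (3F ∷ l) = 4F ∷ l
inc (4F ∷ l) = 5F ∷ l
inc (5F ∷ l) = 6F ∷ l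
inc (6F ∷ l) = 0F ∷ inc l

iter : {A : Set} → (A → A) → ℕ → A → A
iter f zero    a = a
iter f (suc n) a = iter f n (f a)

iter-+ : {A : Set} (f : A → A) → ∀ m n a → iter f (m + n) a ≡ iter f n (iter f m a)
iter-+ f zero    n a = refl
iter-+ f (suc m) n a = iter-+ f m n (f a)

iter-suc : {A : Set} (f : A → A) → ∀ n a → iter f (suc n) a ≡ f (iter f n a)
iter-suc f zero    a = refl
iter-suc f (suc n) a = iter-suc f n (f a)

-- Bijective numeration in base 7.
code : ℕ → List (Fin 7)
code j = iter inc j []

number : List (Fin 7) → ℕ
number []      = 0
number (d ∷ l) = suc (toℕ d + 7 * number l)

inc-carry : ∀ n l → iter inc (7 * n) (0F ∷ l) ≡ 0F ∷ iter inc n l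
inc-carry zero    l = refl
inc-carry (suc n) l = trans (cong (λ k → iter inc k (0F ∷ l)) (*-suc 7 n)) (inc-carry n (inc l))

inc-digit : ∀ d l → iter inc (toℕ d) (0F ∷ l) ≡ d ∷ l
inc-digit 0F l = refl
inc-digit 1F l = refl
inc-digit 2F l = refl
inc-digit 3F l = refl
inc-digit 4F l = refl
inc-digit 5F l = refl
inc-digit 6F l = refl

code-number : ∀ l → code (number l) ≡ l
code-number []      = refl
code-number (d ∷ l) = begin
  iter inc (toℕ d + 7 * number l) (0F ∷ [])           ≡⟨ cong (λ k → iter inc k (0F ∷ [])) (+-comm (toℕ d) (7 * number l)) ⟩
  iter inc (7 * number l + toℕ d) (0F ∷ [])           ≡⟨ iter-+ inc (7 * number l) (toℕ d) _ ⟩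
  iter inc (toℕ d) (iter inc (7 * number l) (0F ∷ [])) ≡⟨ cong (iter inc (toℕ d)) (trans (inc-carry (number l) []) (cong (0F ∷_) (code-number l))) ⟩
  iter inc (toℕ d) (0F ∷ l)                           ≡⟨ inc-digit d l ⟩
  d ∷ l ∎
  where open ≡-Reasoning

number-inc : ∀ l → number (inc l) ≡ suc (number l)
number-inc []       = refl
number-inc (0F ∷ l) = refl
number-inc (1F ∷ l) = refl
number-inc (2F ∷ l) = refl
number-inc (3F ∷ l) = refl
number-inc (4F ∷ l) = refl
number-inc (5F ∷ l) = refl
number-inc (6F ∷ l) = cong suc (trans (cong (7 *_) (number-inc l)) (*-suc 7 (number l)))

number-code : ∀ j → number (code j) ≡ j
number-code zero    = refl
number-code (suc j) = trans (cong number (iter-suc inc j [])) (trans (number-inc (code j)) (cong suc (number-code j)))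

length-inc : ∀ l → length (inc l) ≤ suc (length l)
length-inc []       = ≤-refl
length-inc (0F ∷ l) = n≤1+n _
length-inc (1F ∷ l) = n≤1+n _
length-inc (2F ∷ l) = n≤1+n _
length-inc (3F ∷ l) = n≤1+n _
length-inc (4F ∷ l) = n≤1+n _
length-inc (5F ∷ l) = n≤1+n _
length-inc (6F ∷ l) = s≤s (length-inc l)

-- A crude bound, sufficient for the codes that are tested with parameter L to be no longer than the
-- clock.
length-code : ∀ j → length (code j) ≤ j
length-code zero    = z≤n
length-code (suc j) = ≤-trans (≤-reflexive (cong length (iter-suc inc j [])))
  (≤-trans (length-inc (code j)) (s≤s (length-code j)))

-- The candidates of level a with parameter L = m + r are the strings 1ᵃ01ᵐ0ʳ.
candL : ℕ → ℕ → ℕ → List Bool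
candL a m r = replicate a true ++ false ∷ replicate m true ++ replicate r false

ucfg : List Bool → List (Fin 7) → UCfg
ucfg x e = 0F , posR [] (bitsX (xload x)) , posR [] (nz e)

answer : List Bool → List (Fin 7) → ℕ → Maybe Bool
answer x e t = uanswer (usteps t (ucfg x e))

isJust : {A : Set} → Maybe A → Bool
isJust (just _) = true
isJust nothing  = false

-- The clock exponents of the levels.  They grow so fast that the clock of level a + 1 suffices to
-- simulate every machine that is as fast as the decision procedure for the levels up to a.
D : ℕ → ℕ
D zero    = 2
D (suc a) = 6 * D a + 20

-- The base is the common length of all candidates with the given a and L, so all of them are tested
-- with the same clock.
clock : ℕ → ℕ → ℕ
clock a L = (a + suc L) ^ D a

accepts : List (Fin 7) → ℕ → ℕ → ℕ → Bool
accepts e a L m = isJust (answer (candL a m (L ∸ m)) e (clock a L))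

-- Choosing the last accepted candidate suits the tape program, which overwrites its flag at every
-- accepted one.
lastAcc : List (Fin 7) → ℕ → ℕ → ℕ → Maybe ℕ
lastAcc e a L zero    = nothing
lastAcc e a L (suc k) = if accepts e a L k then just k else lastAcc e a L k

eqMaybe : Maybe ℕ → ℕ → Bool
eqMaybe nothing  m = false
eqMaybe (just k) m = k ≡ᵇ m

-- The first j codes are responsible for excluding one candidate each.
killedBy : ℕ → ℕ → ℕ → ℕ → Bool
killedBy a L m zero    = false
killedBy a L m (suc j) = eqMaybe (lastAcc (code j) a L L) m ∨ killedBy a L m j

-- The condition `a≤L` makes the length a + 1 + L at most 2 L + 1. So, for a fixed code, only
-- finitely many candidates of any level have an L too small for the code to be among those that
-- exclude.
record Survivor (i : ℕ) (x : Str) : Set where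
  constructor survivor
  field
    {a m r} : ℕ
    level≤  : a ≤ i
    a≤L     : a ≤ m + suc r
    shape   : toList x ≡ candL a m (suc r)
    alive   : killedBy a (m + suc r) m (m + r) ≡ false

-- Building blocks for programs

infixl 6 _[_]≔_
_[_]≔_ : {A : Set} {k : ℕ} → Vec A k → Fin k → A → Vec A k
v [ i ]≔ a = v V.[ i ]≔ a

nonblank : ∀ {n} → Fin n → Bool
nonblank zero    = false
nonblank (suc _) = true

onTape : ∀ {e k} → Fin k → Frag e 1 → Frag e k
onTape i p = record
  { size = Frag.size p ; entry = Frag.entry p
  ; transition = λ l v → map₂ (λ ops → stay v [ i ]≔ V.head ops) (Frag.transition p l (V.lookup v i ∷ [])) }

app-set : ∀ {e k} (i : Fin k) o (s : Tapes e k) → app (stay (heads s) [ i ]≔ o) s ≡ s [ i ]≔ mv o (V.lookup s i)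
app-set zero    o (t ∷ s)          = cong (mv o t ∷_) (app-stay s)
app-set (suc i) o (tape l h r ∷ s) = cong (tape l h r ∷_) (app-set i o s)

lookup-heads : ∀ {e k} (i : Fin k) (s : Tapes e k) → V.lookup (heads s) i ≡ Tape.hd (V.lookup s i)
lookup-heads i s = Vₚ.lookup-map i Tape.hd s

module _ {e k : ℕ} (i : Fin k) {p : Frag e 1} where

  onTape-eq : ∀ {l t x} (s : Tapes e k) → V.lookup s i ≡ t → Frag.transition p l (Tape.hd t ∷ []) ≡ x →
              Frag.transition (onTape i p) l (heads s) ≡ map₂ (λ ops → stay (heads s) [ i ]≔ V.head ops) x
  onTape-eq {l} s refl refl = cong (λ h → map₂ (λ ops → stay (heads s) [ i ]≔ V.head ops) (Frag.transition p l (h ∷ []))) (lookup-heads i s)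

  run-onTape′ : ∀ {l u τ u′} s → V.lookup s i ≡ V.head u → Run p l u τ u′ → Run (onTape i p) l s τ (s [ i ]≔ V.head u′)
  run-onTape′ {l} {_ ∷ []} s refl (leave {ops = o ∷ []} τ eq) =
    subst (Run (onTape i p) l s (suc τ)) (app-set i o s) (leave τ (onTape-eq s refl eq))
  run-onTape′ {l} {_ ∷ []} {u′ = t′ ∷ []} s refl (next {l′ = l′} {ops = o ∷ []} {t = τ} eq r) =
    next (onTape-eq s refl eq) (subst (λ z → Run (onTape i p) l′ z τ (s [ i ]≔ t′)) (sym (app-set i o s))
      (subst (Run (onTape i p) l′ (s [ i ]≔ mv o (V.lookup s i)) τ) (Vₚ.[]≔-idempotent s i)
        (run-onTape′ (s [ i ]≔ mv o (V.lookup s i)) (Vₚ.lookup∘update i s _) r)))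

  run-onTape : ∀ {l t τ t′} s → V.lookup s i ≡ t → Run p l (t ∷ []) τ (t′ ∷ []) → Run (onTape i p) l s τ (s [ i ]≔ t′)
  run-onTape = run-onTape′

onPair : ∀ {e k} → Fin k → Fin k → Frag e 2 → Frag e k
onPair i j p = record
  { size = Frag.size p ; entry = Frag.entry p
  ; transition = λ l v → map₂ (λ ops → stay v [ i ]≔ V.head ops [ j ]≔ V.head (V.tail ops))
                              (Frag.transition p l (V.lookup v i ∷ V.lookup v j ∷ [])) }

app-set₂ : ∀ {e k} (i j : Fin k) → i ≢ j → ∀ o o′ (s : Tapes e k) →
           app (stay (heads s) [ i ]≔ o [ j ]≔ o′) s ≡ s [ i ]≔ mv o (V.lookup s i) [ j ]≔ mv o′ (V.lookup s j)
app-set₂ zero    zero    ne o o′ s                = contradiction refl ne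
app-set₂ zero    (suc j) ne o o′ (t ∷ s)          = cong (mv o t ∷_) (app-set j o′ s)
app-set₂ (suc i) zero    ne o o′ (t ∷ s)          = cong (mv o′ t ∷_) (app-set i o s)
app-set₂ (suc i) (suc j) ne o o′ (tape l h r ∷ s) = cong (tape l h r ∷_) (app-set₂ i j (ne ∘ cong suc) o o′ s)

module _ {e k : ℕ} (i j : Fin k) (ne : i ≢ j) {p : Frag e 2} where

  onPair-eq : ∀ {l t t′ x} (s : Tapes e k) → V.lookup s i ≡ t → V.lookup s j ≡ t′ →
    Frag.transition p l (Tape.hd t ∷ Tape.hd t′ ∷ []) ≡ x →
    Frag.transition (onPair i j p) l (heads s) ≡ map₂ (λ ops → stay (heads s) [ i ]≔ V.head ops [ j ]≔ V.head (V.tail ops)) x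
  onPair-eq {l} s refl refl refl = cong₂ (λ h h′ → map₂ (λ ops → stay (heads s) [ i ]≔ V.head ops [ j ]≔ V.head (V.tail ops))
    (Frag.transition p l (h ∷ h′ ∷ []))) (lookup-heads i s) (lookup-heads j s)

  overwrite₂ : ∀ (s : Tapes e k) a b a′ b′ → s [ i ]≔ a [ j ]≔ b [ i ]≔ a′ [ j ]≔ b′ ≡ s [ i ]≔ a′ [ j ]≔ b′
  overwrite₂ s a b a′ b′ = begin
    s [ i ]≔ a [ j ]≔ b [ i ]≔ a′ [ j ]≔ b′ ≡⟨ cong (_[ j ]≔ b′) (Vₚ.[]≔-commutes (s [ i ]≔ a) j i (ne ∘ sym)) ⟩
    s [ i ]≔ a [ i ]≔ a′ [ j ]≔ b [ j ]≔ b′ ≡⟨ Vₚ.[]≔-idempotent (s [ i ]≔ a [ i ]≔ a′) j ⟩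
    s [ i ]≔ a [ i ]≔ a′ [ j ]≔ b′          ≡⟨ cong (_[ j ]≔ b′) (Vₚ.[]≔-idempotent s i) ⟩
    s [ i ]≔ a′ [ j ]≔ b′ ∎
    where open ≡-Reasoning

  run-onPair′ : ∀ {l u τ u′} s → V.lookup s i ≡ V.head u → V.lookup s j ≡ V.head (V.tail u) →
    Run p l u τ u′ → Run (onPair i j p) l s τ (s [ i ]≔ V.head u′ [ j ]≔ V.head (V.tail u′))
  run-onPair′ {l} {_ ∷ _ ∷ []} s refl refl (leave {ops = o ∷ o′ ∷ []} τ eq) =
    subst (Run (onPair i j p) l s (suc τ)) (app-set₂ i j ne o o′ s) (leave τ (onPair-eq s refl refl eq))
  run-onPair′ {l} {_ ∷ _ ∷ []} {u′ = t′ ∷ v′ ∷ []} s refl refl (next {l′ = l′} {ops = o ∷ o′ ∷ []} {t = τ} eq r) =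
    next (onPair-eq s refl refl eq) (subst (λ z → Run (onPair i j p) l′ z τ (s [ i ]≔ t′ [ j ]≔ v′)) (sym (app-set₂ i j ne o o′ s))
      (subst (Run (onPair i j p) l′ s₁ τ) (overwrite₂ s _ _ _ _)
        (run-onPair′ s₁ (trans (Vₚ.lookup∘update′ ne (s [ i ]≔ mv o (V.lookup s i)) _) (Vₚ.lookup∘update i s _))
                        (Vₚ.lookup∘update j (s [ i ]≔ mv o (V.lookup s i)) _) r)))
    where s₁ = s [ i ]≔ mv o (V.lookup s i) [ j ]≔ mv o′ (V.lookup s j)

  run-onPair : ∀ {l t v τ t′ v′} s → V.lookup s i ≡ t → V.lookup s j ≡ v →
    Run p l (t ∷ v ∷ []) τ (t′ ∷ v′ ∷ []) → Run (onPair i j p) l s τ (s [ i ]≔ t′ [ j ]≔ v′)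
  run-onPair = run-onPair′

-- Scanning, rewinding and copying

double : ∀ n → suc (suc (2 * n)) ≡ 2 * suc n
double n = sym (*-suc 2 n)

hd₁ : ∀ {e k} → Vec (Γ e) (suc k) → Γ e
hd₁ = V.head

opR opL : ∀ {e} → Vec (Γ e) 1 → Vec (Op e) 1
opR (a ∷ []) = (a , mR) ∷ []
opL (a ∷ []) = (a , mL) ∷ []

goR goL : ∀ {e} → Frag e 1
goR = act opR
goL = act opL

scanR rewind : ∀ {e} → Frag e 1
scanR  = while (nonblank ∘ hd₁) goR
rewind = goL ⨟ (while (nonblank ∘ hd₁) goL ⨟ goR)

exec-scanR : ∀ {e} (y d : List (Fin (3 + e))) →
  Exec scanR (posR (nz d) (nz y) ∷ []) (suc (2 * length y)) (posR (nz (y L.ʳ++ d)) [] ∷ [])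
exec-scanR []      d = exec-done refl
exec-scanR (a ∷ y) d = weakenR (≤-reflexive (cong suc (double (length y))))
  (exec-loop refl (exec-act opR _ {0}) (exec-scanR y (a ∷ d)))

exec-scanL : ∀ {e} (d : List (Fin (3 + e))) r →
  Exec (while (nonblank ∘ hd₁) goL) (posL (nz d) r ∷ []) (suc (2 * length d)) (tape [] zero (nz d L.ʳ++ r) ∷ [])
exec-scanL []      r = exec-done refl
exec-scanL (a ∷ d) r = weakenR (≤-reflexive (cong suc (double (length d))))
  (exec-loop refl (exec-act opL _ {0}) (exec-scanL d (suc a ∷ r)))

nz-unwind : ∀ {n} (y : List (Fin n)) r → nz (y L.ʳ++ []) L.ʳ++ r ≡ nz y ++ r
nz-unwind y r = trans (cong (L._ʳ++ r) (nz-ʳ++ y [])) (Lₚ.ʳ++-ʳ++ (nz y))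

exec-rewind : ∀ {e} (y : List (Fin (3 + e))) →
  Exec rewind (posR (nz (y L.ʳ++ [])) [] ∷ []) (2 * length y + 3) (posR [] (nz y) ∷ [])
exec-rewind y = weakenR (≤-reflexive (trans (cong (λ n → 1 + (suc (2 * n) + 1)) (trans (Lₚ.length-ʳ++ y) (+-identityʳ _)))
                                              (solve 1 (λ n → con 1 :+ ((con 1 :+ n) :+ con 1) := n :+ con 3) refl (2 * length y))))
  (exec-seq (exec-act opL _ {0}) (exec-seq (exec-scanL (y L.ʳ++ []) [])
    (subst (λ r → Exec goR (tape [] zero (nz (y L.ʳ++ []) L.ʳ++ []) ∷ []) 1 (posR [] r ∷ []))
           (trans (nz-unwind y []) (Lₚ.++-identityʳ _)) (exec-act opR _ {0}))))
  where open +-*-Solver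

-- The first tape serves as a clock: `g` is performed on the other tapes once for each of its cells.
forCells : ∀ {e k} → (Vec (Γ e) k → Vec (Op e) k) → Frag e (suc k)
forCells g = while (nonblank ∘ hd₁) (act λ v → (V.head v , mR) ∷ g (V.tail v))

doOps : ∀ {e k} → (Vec (Γ e) k → Vec (Op e) k) → Tapes e k → Tapes e k
doOps g s = app (g (heads s)) s

exec-forCells : ∀ {e k} (g : Vec (Γ e) k → Vec (Op e) k) (y d : List (Fin (3 + e))) s →
  Exec (forCells g) (posR (nz d) (nz y) ∷ s) (suc (2 * length y)) (posR (nz (y L.ʳ++ d)) [] ∷ iter (doOps g) (length y) s)
exec-forCells g []      d s = exec-done refl
exec-forCells g (a ∷ y) d s = weakenR (≤-reflexive (cong suc (double (length y))))
  (exec-loop refl (exec-act (λ v → (V.head v , mR) ∷ g (V.tail v)) (posR (nz d) (nz (a ∷ y)) ∷ s) {0})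
    (exec-forCells g y (a ∷ d) (doOps g s)))

copyWith : ∀ {e} → (Γ e → Γ e) → Frag e 2
copyWith f = while (nonblank ∘ hd₁) (act λ v → (V.head v , mR) ∷ (f (V.head v) , mR) ∷ [])

exec-copyWith : ∀ {e} {f : Γ e → Γ e} {g : Fin (3 + e) → Fin (3 + e)} → (∀ a → f (suc a) ≡ suc (g a)) → ∀ y d d′ →
  Exec (copyWith f) (posR (nz d) (nz y) ∷ posR (nz d′) [] ∷ []) (suc (2 * length y))
                    (posR (nz (y L.ʳ++ d)) [] ∷ posR (nz (L.map g y L.ʳ++ d′)) [] ∷ [])
exec-copyWith fg []      d d′ = exec-done refl
exec-copyWith {f = f} {g} fg (a ∷ y) d d′ = weakenR (≤-reflexive (cong suc (double (length y))))
  (exec-loop refl (exec-act (λ v → (V.head v , mR) ∷ (f (V.head v) , mR) ∷ []) (posR (nz d) (nz (a ∷ y)) ∷ posR (nz d′) [] ∷ []) {0})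
    (subst (λ z → Exec (copyWith f) (posR (suc a ∷ nz d) (nz y) ∷ posR (push z (nz d′)) [] ∷ []) (suc (2 * length y))
       (posR (nz (y L.ʳ++ (a ∷ d))) [] ∷ posR (nz (L.map g y L.ʳ++ (g a ∷ d′))) [] ∷ [])) (sym (fg a))
      (exec-copyWith {f = f} {g} fg y (a ∷ d) (g a ∷ d′))))

-- One clocked simulation

-- Time is measured in multiples of β, the length of the clock. Every pass over a tape costs a
-- constant number of units, and the bounds for composed programs become sums of numerals.
record Cost {e k} (β : ℕ) (p : Frag e k) (s : Tapes e k) (c : ℕ) (s′ : Tapes e k) : Set where
  constructor cost
  field run : Exec p s (c * β) s′

infixr 5 _▸_
_▸_ : ∀ {e k β} {p q : Frag e k} {s c s′ c′ s″} → Cost β p s c s′ → Cost β q s′ c′ s″ → Cost β (p ⨟ q) s (c + c′) s″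
_▸_ {β = β} {c = c} {c′ = c′} (cost x) (cost y) = cost (weakenR (≤-reflexive (sym (*-distribʳ-+ β c c′))) (exec-seq x y))

within : ∀ {e k β τ} {p : Frag e k} {s s′} c → τ ≤ c * β → Exec p s τ s′ → Cost β p s c s′
within c le x = cost (weakenR le x)

units : ∀ a b {n β} → n ≤ β → 1 ≤ β → a * n + b ≤ (a + b) * β
units a b {n} {β} le pos = ≤-trans (+-mono-≤ (*-monoʳ-≤ a le) (scale b pos)) (≤-reflexive (sym (*-distribʳ-+ β a b)))

units₁ : ∀ {n β} → n ≤ β → 1 ≤ β → suc (2 * n) ≤ 3 * β
units₁ {n} le pos = ≤-trans (≤-reflexive (+-comm 1 (2 * n))) (units 2 1 le pos)

strT : List (Fin 7) → Tape (Γ 4)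
strT y = posR [] (nz y)

endT : List (Fin 7) → Tape (Γ 4)
endT y = posR (nz (y L.ʳ++ [])) []

xbits : List Bool → List Bool
xbits []          = []
xbits (false ∷ x) = false ∷ xbits x
xbits (true ∷ x)  = true ∷ false ∷ xbits x

xload-xbits : ∀ x → xload x ≡ xbits x ++ true ∷ true ∷ false ∷ []
xload-xbits []          = refl
xload-xbits (false ∷ x) = cong (false ∷_) (xload-xbits x)
xload-xbits (true ∷ x)  = cong (λ z → true ∷ false ∷ z) (xload-xbits x)

length-xload : ∀ x → length (xload x) ≤ 2 * length x + 3
length-xload []          = ≤-refl
length-xload (false ∷ x) = ≤-trans (s≤s (length-xload x)) (≤-trans (n≤1+n _) (≤-reflexive (cong (_+ 3) (double (length x)))))
length-xload (true ∷ x)  = ≤-trans (s≤s (s≤s (length-xload x))) (≤-reflexive (cong (_+ 3) (double (length x))))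

isOne : ∀ {n} → Fin n → Bool
isOne (suc (suc zero)) = true
isOne _                = false

putOne putZero : Vec (Γ 4) 2 → Vec (Op 4) 2
putOne  (c ∷ x ∷ []) = (c , mS) ∷ (2F , mR) ∷ []
putZero (c ∷ x ∷ []) = (c , mR) ∷ (1F , mR) ∷ []

loadQueue : Frag 4 2
loadQueue = while (nonblank ∘ V.head) (ifte (isOne ∘ V.head) (act putOne ⨟ act putZero) (act putZero))

exec-loadQueue : ∀ x d d′ → Exec loadQueue (posR (nz d) (bitsX x) ∷ posR (nz d′) [] ∷ []) (4 * length x + 1)
  (posR (nz (L.map bs x L.ʳ++ d)) [] ∷ posR (nz (L.map bs (xbits x) L.ʳ++ d′)) [] ∷ [])
exec-loadQueue []          d d′ = exec-done refl
exec-loadQueue (false ∷ x) d d′ = weakenR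
  (≤-trans (n≤1+n _) (≤-reflexive (cong (_+ 1) (sym (*-suc 4 (length x))))))
  (exec-loop refl (exec-else refl (exec-act putZero _ {0})) (exec-loadQueue x (0F ∷ d) (0F ∷ d′)))
exec-loadQueue (true ∷ x)  d d′ = weakenR (≤-reflexive (cong (_+ 1) (sym (*-suc 4 (length x)))))
  (exec-loop refl (exec-then refl (exec-seq (exec-act putOne _ {0}) (exec-act putZero _ {0}))) (exec-loadQueue x (1F ∷ d) (0F ∷ 1F ∷ d′)))

put : ∀ {e} → Γ e → Frag e 1
put s = act λ _ → (s , mR) ∷ []

endQueue : Frag 4 1
endQueue = put 2F ⨟ (put 2F ⨟ put 1F)

-- The control state of the universal machine is kept as a tape symbol, so that one of its steps is
-- one operation on three tapes and can be driven by `forCells`.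
gU : Vec (Γ 4) 3 → Vec (Op 4) 3
gU (s ∷ x ∷ t ∷ []) = let (s′ , o , o′) = dU s x t in (s′ , mS) ∷ o ∷ o′ ∷ []

toS : UCfg → Tapes 4 3
toS (s , x , t) = tape [] s [] ∷ x ∷ t ∷ []

iter-gU : ∀ n u → iter (doOps gU) n (toS u) ≡ toS (usteps n u)
iter-gU zero    u           = refl
iter-gU (suc n) (s , x , t) = iter-gU n (ustep (s , x , t))

-- Tapes: candidate, code, clock, control state, queue, table.
simulateP : Frag 4 6
simulateP = onPair 1F 5F (copyWith id) ⨟ onTape 1F rewind ⨟ onTape 5F rewind ⨟ onPair 0F 4F loadQueue ⨟ onTape 4F endQueue ⨟
            onTape 0F rewind ⨟ onTape 4F rewind ⨟ onRight 2 (forCells gU) ⨟ onTape 2F rewind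

exec-simulate : ∀ x e y → let β = length y in length x ≤ β → length e ≤ β → 1 ≤ β →
  Cost β simulateP (posR [] (bitsX x) ∷ strT e ∷ strT y ∷ toS (0F , blankT , blankT)) 47
                   (posR [] (bitsX x) ∷ strT e ∷ strT y ∷ toS (usteps β (ucfg x e)))
exec-simulate x e y x≤ e≤ pos =
    within 3 (units₁ e≤ pos) (run-onPair 1F 5F (λ ()) _ refl refl (exec-copyWith {f = id} {id} (λ _ → refl) e [] []))
  ▸ within 5 (units 2 3 e≤ pos) (run-onTape 1F _ refl (exec-rewind e))
  ▸ within 5 (units 2 3 e≤ pos) (run-onTape 5F _ (cong (λ z → posR (nz (z L.ʳ++ [])) []) (Lₚ.map-id e)) (exec-rewind e))
  ▸ within 5 (units 4 1 x≤ pos) (run-onPair 0F 4F (λ ()) _ refl refl (exec-loadQueue x [] []))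
  ▸ within 3 (scale 3 pos) (run-onTape 4F _ refl
      (exec-seq (exec-act (λ _ → (2F , mR) ∷ []) (posR q [] ∷ []) {0})
      (exec-seq (exec-act (λ _ → (2F , mR) ∷ []) (posR (2F ∷ q) [] ∷ []) {0}) (exec-act (λ _ → (1F , mR) ∷ []) (posR (2F ∷ 2F ∷ q) [] ∷ []) {0}))))
  ▸ within 5 (≤-trans (≤-reflexive (cong (λ n → 2 * n + 3) (Lₚ.length-map bs x))) (units 2 3 x≤ pos))
      (run-onTape 0F _ refl (exec-rewind (L.map bs x)))
  ▸ within 13 queue≤ (run-onTape 4F _ queue-eq (exec-rewind (L.map bs (xload x))))
  ▸ within 3 (units₁ ≤-refl pos) (run-right {j = 2} (posR [] (bitsX x) ∷ strT e ∷ []) (exec-forCells gU y [] (toS (ucfg x e))))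
  ▸ subst (λ s → Cost (length y) (onTape 2F rewind) (posR [] (bitsX x) ∷ strT e ∷ endT y ∷ iter (doOps gU) (length y) (toS (ucfg x e))) 5
                   (posR [] (bitsX x) ∷ strT e ∷ strT y ∷ s)) (iter-gU (length y) (ucfg x e))
      (within 5 (units 2 3 ≤-refl pos) (run-onTape 2F _ refl (exec-rewind y)))
  where
    q = nz (L.map bs (xbits x) L.ʳ++ [])
    queue-eq : posR (nz (0F ∷ 1F ∷ 1F ∷ (L.map bs (xbits x) L.ʳ++ []))) [] ≡ endT (L.map bs (xload x))
    queue-eq = cong (λ z → posR (nz z) []) (sym (trans (cong (λ z → L.map bs z L.ʳ++ []) (xload-xbits x))
      (trans (cong (L._ʳ++ []) (Lₚ.map-++ bs (xbits x) _)) (Lₚ.++-ʳ++ (L.map bs (xbits x))))))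
    queue≤ : 2 * length (L.map bs (xload x)) + 3 ≤ 13 * length y
    queue≤ = ≤-trans (+-monoˡ-≤ 3 (*-monoʳ-≤ 2 (≤-trans (≤-reflexive (Lₚ.length-map bs (xload x))) (length-xload x))))
      (≤-trans (≤-reflexive (solve 1 (λ n → con 2 :* (con 2 :* n :+ con 3) :+ con 3 := con 4 :* n :+ con 9) refl (length x))) (units 4 9 x≤ pos))
      where open +-*-Solver

-- Erasing the tapes of the universal machine

extent : ∀ {n} → Tape (Fin n) → ℕ
extent (tape l _ r) = length l + length r

length-push : ∀ {n} (s : Fin (suc n)) l → length (push s l) ≤ suc (length l)
length-push zero    []      = z≤n
length-push zero    (_ ∷ _) = ≤-refl
length-push (suc s) l       = ≤-refl

extent-mv : ∀ {n} (o : Fin (suc n) × Move) t → extent (mv o t) ≤ suc (extent t)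
extent-mv (s , mL) (tape [] h r)      = length-push s r
extent-mv (s , mL) (tape (a ∷ l) h r) = ≤-trans (+-monoʳ-≤ (length l) (length-push s r))
  (≤-trans (≤-reflexive (+-suc (length l) (length r))) (n≤1+n _))
extent-mv (s , mR) (tape l h [])      = +-monoˡ-≤ 0 (length-push s l)
extent-mv (s , mR) (tape l h (a ∷ r)) = ≤-trans (+-monoˡ-≤ (length r) (length-push s l))
  (s≤s (+-monoʳ-≤ (length l) (n≤1+n _)))
extent-mv (s , mS) (tape l h r)       = n≤1+n _

queueTape tableTape : UCfg → Tape (Γ 4)
queueTape u = proj₁ (proj₂ u)
tableTape u = proj₂ (proj₂ u)

extent-usteps : ∀ n u → extent (queueTape (usteps n u)) ≤ n + extent (queueTape u)
                      × extent (tableTape (usteps n u)) ≤ n + extent (tableTape u)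
extent-usteps zero    u           = ≤-refl , ≤-refl
extent-usteps (suc n) (s , x , t) with dU s (Tape.hd x) (Tape.hd t)
... | s′ , o , o′ = let (a , b) = extent-usteps n (s′ , mv o x , mv o′ t) in
  ≤-trans a (≤-trans (+-monoʳ-≤ n (extent-mv o x)) (≤-reflexive (+-suc n _))) ,
  ≤-trans b (≤-trans (+-monoʳ-≤ n (extent-mv o′ t)) (≤-reflexive (+-suc n _)))

extent-posR : ∀ {n} (y : List (Fin (suc n))) → extent (posR [] y) ≤ length y
extent-posR []      = z≤n
extent-posR (a ∷ y) = n≤1+n _

eraseL eraseR : ∀ {e} → Tape (Γ e) → Tape (Γ e)
eraseL = mv (zero , mL)
eraseR = mv (zero , mR)

eraseL-done : ∀ {e} n r → ∃ λ r′ → iter (eraseL {e}) n (tape [] zero r) ≡ tape [] zero r′ × length r′ ≤ n + length r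
eraseL-done zero    r = r , refl , ≤-refl
eraseL-done (suc n) r with eraseL-done n (push zero r)
... | r′ , eq , le = r′ , eq , ≤-trans le (≤-trans (+-monoʳ-≤ n (length-push zero r)) (≤-reflexive (+-suc n _)))

eraseL-all : ∀ {e} n (l : List (Γ e)) h r → length l < n →
  ∃ λ r′ → iter eraseL n (tape l h r) ≡ tape [] zero r′ × length r′ ≤ n + length r
eraseL-all (suc n) []      h r _        with eraseL-done n (push zero r)
... | r′ , eq , le = r′ , eq , ≤-trans le (≤-trans (+-monoʳ-≤ n (length-push zero r)) (≤-reflexive (+-suc n _)))
eraseL-all (suc n) (a ∷ l) h r (s≤s lt) with eraseL-all n l a (push zero r) lt
... | r′ , eq , le = r′ , eq , ≤-trans le (≤-trans (+-monoʳ-≤ n (length-push zero r)) (≤-reflexive (+-suc n _)))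

eraseR-all : ∀ {e} n h r → length r < n → iter (eraseR {e}) n (tape [] h r) ≡ blankT
eraseR-all (suc n) h []      _        = fixed n
  where
    fixed : ∀ {e} n → iter (eraseR {e}) n blankT ≡ blankT
    fixed zero    = refl
    fixed (suc n) = fixed n
eraseR-all (suc n) h (a ∷ r) (s≤s lt) = eraseR-all n a r lt

erase-all : ∀ {e} n m (t : Tape (Γ e)) → extent t < n → n + extent t < m → iter eraseR m (iter eraseL n t) ≡ blankT
erase-all n m (tape l h r) lt lt′ with eraseL-all n l h r (≤-<-trans (m≤m+n _ _) lt)
... | r′ , eq , le = trans (cong (iter eraseR m) eq)
  (eraseR-all m zero r′ (≤-<-trans le (≤-<-trans (+-monoʳ-≤ n (m≤n+m (length r) (length l))) lt′)))

gClear : Move → Vec (Γ 4) 3 → Vec (Op 4) 3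
gClear m _ = (0F , mS) ∷ (0F , m) ∷ (0F , m) ∷ []

iter-gClear : ∀ m n (a b c : Tape (Γ 4)) →
  iter (doOps (gClear m)) n (a ∷ b ∷ c ∷ []) ≡ iter (mv (0F , mS)) n a ∷ iter (mv (0F , m)) n b ∷ iter (mv (0F , m)) n c ∷ []
iter-gClear m zero    a b c = refl
iter-gClear m (suc n) a b c = iter-gClear m n _ _ _

iter-blank : ∀ {e} n → iter (mv {suc (suc (suc e))} (0F , mS)) n (tape [] 0F []) ≡ blankT
iter-blank zero    = refl
iter-blank (suc n) = iter-blank n

iter-* : {A : Set} (f : A → A) → ∀ k n a → iter (iter f n) k a ≡ iter f (k * n) a
iter-* f zero    n a = refl
iter-* f (suc k) n a = trans (iter-* f k n (iter f n a)) (sym (iter-+ f n (k * n) a))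

repeat : ∀ {e k} → ℕ → Frag e k → Frag e k
repeat zero    p = p
repeat (suc n) p = p ⨟ repeat n p

passes : ℕ → (Vec (Γ 4) 3 → Vec (Op 4) 3) → Frag 4 4
passes n g = repeat n (forCells g ⨟ onTape 0F rewind)

exec-pass : ∀ (g : Vec (Γ 4) 3 → Vec (Op 4) 3) y s → Exec (forCells g ⨟ onTape 0F rewind) (strT y ∷ s) (suc (2 * length y) + (2 * length y + 3)) (strT y ∷ iter (doOps g) (length y) s)
exec-pass g y s = exec-seq (exec-forCells {k = 3} g y [] s) (run-onTape 0F (endT y ∷ iter (doOps g) (length y) s) refl (exec-rewind y))

exec-passes : ∀ n g y s → 1 ≤ length y → Cost (length y) (passes n g) (strT y ∷ s) (suc n * 8) (strT y ∷ iter (doOps g) (suc n * length y) s)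
exec-passes n g y s pos = subst (λ z → Cost (length y) (passes n g) (strT y ∷ s) (suc n * 8) (strT y ∷ z)) (iter-* (doOps g) (suc n) (length y) s) (loop n s)
  where
    one : ∀ s → Cost (length y) (forCells g ⨟ onTape 0F rewind) (strT y ∷ s) 8 (strT y ∷ iter (doOps g) (length y) s)
    one s = within 8 (≤-trans (+-mono-≤ (units₁ {length y} ≤-refl pos) (units 2 3 {length y} ≤-refl pos))
      (≤-reflexive (sym (*-distribʳ-+ (length y) 3 5)))) (exec-pass g y s)
    loop : ∀ n s → Cost (length y) (passes n g) (strT y ∷ s) (suc n * 8) (strT y ∷ iter (iter (doOps g) (length y)) (suc n) s)
    loop zero    s = one s
    loop (suc n) s = one s ▸ loop n (iter (doOps g) (length y) s)

-- Where the heads stand after a simulation is unknown, so the erasing is blind. On a tape of extent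
-- below 8β, the first 8β moves pass the left end; everything to the right then lies within 16β
-- cells. The numbers are 7 and 15 because `passes n` makes n + 1 passes.
clearP : Frag 4 4
clearP = passes 7 (gClear mL) ⨟ passes 15 (gClear mR)

exec-clear : ∀ y u → 1 ≤ length y → extent (queueTape u) < 8 * length y → extent (tableTape u) < 8 * length y →
  Cost (length y) clearP (strT y ∷ toS u) 192 (strT y ∷ toS (0F , blankT , blankT))
exec-clear y@(_ ∷ y′) (s , x , t) pos x< t< =
  subst (λ z → Cost β clearP (strT y ∷ toS (s , x , t)) 192 (strT y ∷ z)) eq
    (exec-passes 7 (gClear mL) y (toS (s , x , t)) pos ▸ exec-passes 15 (gClear mR) y _ pos)
  where
    β = length y
    n = 8 * β
    m = 16 * β
    grow : ∀ {k} → k < n → n + k < m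
    grow lt = <-≤-trans (+-monoʳ-< n lt) (≤-reflexive (sym (*-distribʳ-+ β 8 8)))
    state-blank : ∀ k → iter (mv (0F , mS)) (suc k) (tape [] s []) ≡ blankT
    state-blank k = iter-blank k
    eq : iter (doOps (gClear mR)) m (iter (doOps (gClear mL)) n (toS (s , x , t))) ≡ toS (0F , blankT , blankT)
    eq = begin
      iter (doOps (gClear mR)) m (iter (doOps (gClear mL)) n (toS (s , x , t)))
        ≡⟨ cong (iter (doOps (gClear mR)) m) (iter-gClear mL n (tape [] s []) x t) ⟩
      iter (doOps (gClear mR)) m (iter (mv (0F , mS)) n (tape [] s []) ∷ iter eraseL n x ∷ iter eraseL n t ∷ [])
        ≡⟨ iter-gClear mR m (iter (mv (0F , mS)) n (tape [] s [])) (iter eraseL n x) (iter eraseL n t) ⟩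
      iter (mv (0F , mS)) m (iter (mv (0F , mS)) n (tape [] s [])) ∷ iter eraseR m (iter eraseL n x) ∷ iter eraseR m (iter eraseL n t) ∷ []
        ≡⟨ cong₂ _∷_ (trans (cong (iter (mv (0F , mS)) m) (state-blank (length y′ + 7 * β))) (iter-blank m))
             (cong₂ (λ a b → a ∷ b ∷ []) (erase-all n m x x< (grow x<)) (erase-all n m t t< (grow t<))) ⟩
      toS (0F , blankT , blankT) ∎
      where open ≡-Reasoning

-- The bounds hold because the two tapes grow by at most one cell per step.
clear-after : ∀ x e y → let β = length y in length x ≤ β → length e ≤ β → 1 ≤ β →
  Cost β clearP (strT y ∷ toS (usteps β (ucfg x e))) 192 (strT y ∷ toS (0F , blankT , blankT))
clear-after x e y x≤ e≤ pos with extent-usteps (length y) (ucfg x e)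
... | ex , et = exec-clear y (usteps β (ucfg x e)) pos
    (≤-<-trans ex (<-≤-trans (+-monoʳ-< β (≤-<-trans qx (≤-<-trans (units 2 3 x≤ pos) (*-monoˡ-< β {{>-nonZero pos}} {5} {7} (s≤s (s≤s (s≤s (s≤s (s≤s (s≤s z≤n))))))))))
      ≤-refl))
    (≤-<-trans et (<-≤-trans (+-monoʳ-< β (≤-<-trans tx (≤-<-trans e≤ (≤-<-trans (≤-reflexive (sym (*-identityˡ β))) (*-monoˡ-< β {{>-nonZero pos}} {1} {7} (s≤s (s≤s z≤n)))))))
      ≤-refl))
  where
    β = length y
    qx : extent (posR [] (bitsX (xload x))) ≤ 2 * length x + 3
    qx = ≤-trans (extent-posR (bitsX (xload x))) (≤-trans (≤-reflexive (trans (Lₚ.length-map suc (L.map bs (xload x))) (Lₚ.length-map bs (xload x)))) (length-xload x))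
    tx : extent (posR [] (nz e)) ≤ length e
    tx = ≤-trans (extent-posR (nz e)) (≤-reflexive (Lₚ.length-map suc e))

cost-loop : ∀ {e k β} {c : Vec (Γ e) k → Bool} {p : Frag e k} {s a s′ b s″} → 1 ≤ β → c (heads s) ≡ true →
  Cost β p s a s′ → Cost β (while c p) s′ b s″ → Cost β (while c p) s (suc (a + b)) s″
cost-loop {β = β} {a = a} {b = b} pos eq (cost x) (cost y) = cost (weakenR
  (+-mono-≤ pos (≤-reflexive (sym (*-distribʳ-+ β a b)))) (exec-loop eq x y))

cost-done : ∀ {e k β} {c : Vec (Γ e) k → Bool} {p : Frag e k} {s} → 1 ≤ β → c (heads s) ≡ false → Cost β (while c p) s 1 s
cost-done pos eq = within 1 (scale 1 pos) (exec-done eq)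

-- Running through the candidates

candF : ℕ → ℕ → ℕ → List (Fin 7)
candF a m r = replicate a 1F ++ 0F ∷ replicate m 1F ++ replicate r 0F

cand-bits : ∀ a m r → L.map bs (candL a m r) ≡ candF a m r
cand-bits a m r = begin
  L.map bs (replicate a true ++ false ∷ replicate m true ++ replicate r false)
    ≡⟨ Lₚ.map-++ bs (replicate a true) _ ⟩
  L.map bs (replicate a true) ++ 0F ∷ L.map bs (replicate m true ++ replicate r false)
    ≡⟨ cong₂ (λ x y → x ++ 0F ∷ y) (Lₚ.map-replicate bs a true) (trans (Lₚ.map-++ bs (replicate m true) _)
         (cong₂ _++_ (Lₚ.map-replicate bs m true) (Lₚ.map-replicate bs r false))) ⟩
  candF a m r ∎
  where open ≡-Reasoning

length-candL : ∀ a m r → length (candL a m r) ≡ a + suc (m + r)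
length-candL a m r = trans (Lₚ.length-++ (replicate a true)) (cong₂ (λ x y → x + suc y) (Lₚ.length-replicate a)
  (trans (Lₚ.length-++ (replicate m true)) (cong₂ _+_ (Lₚ.length-replicate m) (Lₚ.length-replicate r))))

length-candF : ∀ a m r → length (candF a m r) ≡ a + suc (m + r)
length-candF a m r = trans (cong length (sym (cand-bits a m r))) (trans (Lₚ.length-map bs (candL a m r)) (length-candL a m r))

replicate-snoc : ∀ {A : Set} n (x : A) (y : List A) → replicate n x ++ x ∷ y ≡ x ∷ (replicate n x ++ y)
replicate-snoc zero    x y = refl
replicate-snoc (suc n) x y = cong (x ∷_) (replicate-snoc n x y)

skipOnes clearOnes : Frag 4 1
skipOnes  = while (isOne ∘ hd₁) goR
clearOnes = while (isOne ∘ hd₁) (put 1F)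

exec-skipOnes : ∀ n d s → isOne (Tape.hd (posR (nz d) s)) ≡ false →
  Exec skipOnes (posR (nz d) (nz (replicate n 1F) ++ s) ∷ []) (suc (2 * n)) (posR (nz (replicate n 1F ++ d)) s ∷ [])
exec-skipOnes zero    d s eq = exec-done eq
exec-skipOnes (suc n) d s eq = weakenR (≤-reflexive (cong suc (double n)))
  (exec-loop refl (exec-act opR (posR (nz d) (nz (replicate (suc n) 1F) ++ s) ∷ []) {0})
    (subst (λ z → Exec skipOnes (posR (nz (1F ∷ d)) (nz (replicate n 1F) ++ s) ∷ []) (suc (2 * n)) (posR (nz z) s ∷ []))
       (replicate-snoc n 1F d) (exec-skipOnes n (1F ∷ d) s (trans (head-only s) eq))))
  where
    head-only : ∀ s → isOne (Tape.hd (posR (nz (1F ∷ d)) s)) ≡ isOne (Tape.hd (posR (nz d) s))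
    head-only []      = refl
    head-only (_ ∷ _) = refl

exec-clearOnes : ∀ n d → Exec clearOnes (posR (nz d) (nz (replicate n 1F)) ∷ []) (suc (2 * n)) (posR (nz (replicate n 0F ++ d)) [] ∷ [])
exec-clearOnes zero    d = exec-done refl
exec-clearOnes (suc n) d = weakenR (≤-reflexive (cong suc (double n)))
  (exec-loop refl (exec-act (λ _ → (1F , mR) ∷ []) (posR (nz d) (nz (replicate (suc n) 1F)) ∷ []) {0})
    (subst (λ z → Exec clearOnes (posR (nz (0F ∷ d)) (nz (replicate n 1F)) ∷ []) (suc (2 * n)) (posR (nz z) [] ∷ []))
       (replicate-snoc n 0F d) (exec-clearOnes n (0F ∷ d))))

rev-replicate : ∀ {A : Set} n (x : A) d → replicate n x L.ʳ++ d ≡ replicate n x ++ d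
rev-replicate zero    x d = refl
rev-replicate (suc n) x d = trans (rev-replicate n x (x ∷ d)) (replicate-snoc n x d)

passed : ∀ a (y z : List (Fin 7)) → (replicate a 1F ++ 0F ∷ y) L.ʳ++ z ≡ y L.ʳ++ (0F ∷ (replicate a 1F ++ z))
passed a y z = trans (Lₚ.++-ʳ++ (replicate a 1F)) (cong (λ w → y L.ʳ++ (0F ∷ w)) (rev-replicate a 1F z))

candF-nz : ∀ a m (y : List (Fin 7)) → nz (replicate a 1F ++ 0F ∷ replicate m 1F ++ y) ≡ nz (replicate a 1F) ++ 1F ∷ (nz (replicate m 1F) ++ nz y)
candF-nz a m y = trans (Lₚ.map-++ suc (replicate a 1F) _) (cong (λ z → nz (replicate a 1F) ++ 1F ∷ z) (Lₚ.map-++ suc (replicate m 1F) y))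

-- The candidates with given a and L are traversed in place, in the order of m: turning the first 0
-- after the second block of ones into a 1 gives the next one.
flipP resetP : Frag 4 1
flipP  = skipOnes ⨟ (goR ⨟ (skipOnes ⨟ (put 2F ⨟ (scanR ⨟ rewind))))
resetP = skipOnes ⨟ (goR ⨟ (clearOnes ⨟ rewind))

exec-flip : ∀ a k r → Exec flipP (strT (candF a k (suc r)) ∷ []) (4 * (a + suc (suc k + r)) + 8) (strT (candF a (suc k) r) ∷ [])
exec-flip a k r = weakenR le
  (exec-seq (subst (λ z → Exec skipOnes (posR [] z ∷ []) (suc (2 * a)) (posR (nz (replicate a 1F ++ [])) (1F ∷ rest) ∷ []))
       (sym (candF-nz a k (replicate (suc r) 0F))) (exec-skipOnes a [] (1F ∷ rest) refl))
  (exec-seq (exec-act opR _ {0})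
  (exec-seq (exec-skipOnes k d₀ (1F ∷ nz (replicate r 0F)) refl)
  (exec-seq (exec-act (λ _ → (2F , mR) ∷ []) (posR (nz (replicate k 1F ++ d₀)) (1F ∷ nz (replicate r 0F)) ∷ []) {0})
  (exec-seq (exec-scanR (replicate r 0F) d₁)
            (subst (λ z → Exec rewind (posR (nz z) [] ∷ []) (2 * length (candF a (suc k) r) + 3) (strT (candF a (suc k) r) ∷ []))
               (sym end-eq) (exec-rewind (candF a (suc k) r))))))))
  where
    rest = nz (replicate k 1F) ++ nz (replicate (suc r) 0F)
    d₀ = 0F ∷ (replicate a 1F ++ [])
    d₁ = 1F ∷ (replicate k 1F ++ d₀)
    end-eq : replicate r 0F L.ʳ++ d₁ ≡ candF a (suc k) r L.ʳ++ []
    end-eq = sym (trans (passed a (replicate (suc k) 1F ++ replicate r 0F) []) (trans (Lₚ.++-ʳ++ (replicate (suc k) 1F))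
      (cong (replicate r 0F L.ʳ++_) (rev-replicate (suc k) 1F d₀))))
    le : suc (2 * a) + (1 + (suc (2 * k) + (1 + (suc (2 * length (replicate r 0F)) + (2 * length (candF a (suc k) r) + 3))))) ≤ 4 * (a + suc (suc k + r)) + 8
    le = ≤-trans (≤-reflexive (cong₂ (λ x y → suc (2 * a) + (1 + (suc (2 * k) + (1 + (suc (2 * x) + (2 * y + 3)))))) (Lₚ.length-replicate r) (length-candF a (suc k) r)))
      (≤-trans (m≤m+n _ 4) (≤-reflexive (solve 3 (λ a k r → (con 1 :+ con 2 :* a) :+ (con 1 :+ ((con 1 :+ con 2 :* k) :+ (con 1 :+ ((con 1 :+ con 2 :* r) :+
        (con 2 :* (a :+ (con 1 :+ (con 1 :+ k :+ r))) :+ con 3))))) :+ con 4 := con 4 :* (a :+ (con 1 :+ (con 1 :+ k :+ r))) :+ con 8) refl a k r)))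
      where open +-*-Solver

exec-reset : ∀ a L → Exec resetP (strT (candF a L 0) ∷ []) (4 * (a + suc (0 + L)) + 8) (strT (candF a 0 L) ∷ [])
exec-reset a L = weakenR le
  (exec-seq (subst (λ z → Exec skipOnes (posR [] z ∷ []) (suc (2 * a)) (posR (nz (replicate a 1F ++ [])) (1F ∷ nz (replicate L 1F)) ∷ []))
       (sym (trans (candF-nz a L []) (cong (λ z → nz (replicate a 1F) ++ 1F ∷ z) (Lₚ.++-identityʳ _))))
       (exec-skipOnes a [] (1F ∷ nz (replicate L 1F)) refl))
  (exec-seq (exec-act opR _ {0})
  (exec-seq (exec-clearOnes L (0F ∷ (replicate a 1F ++ [])))
            (subst (λ z → Exec rewind (posR (nz z) [] ∷ []) (2 * length (candF a 0 L) + 3) (strT (candF a 0 L) ∷ []))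
               (trans (passed a (replicate L 0F) []) (rev-replicate L 0F _)) (exec-rewind (candF a 0 L))))))
  where
    le : suc (2 * a) + (1 + (suc (2 * L) + (2 * length (candF a 0 L) + 3))) ≤ 4 * (a + suc (0 + L)) + 8
    le = ≤-trans (≤-reflexive (cong (λ y → suc (2 * a) + (1 + (suc (2 * L) + (2 * y + 3)))) (length-candF a 0 L)))
      (≤-trans (m≤m+n _ 4) (≤-reflexive (solve 2 (λ a l → (con 1 :+ con 2 :* a) :+ (con 1 :+ ((con 1 :+ con 2 :* l) :+
        (con 2 :* (a :+ (con 1 :+ l)) :+ con 3))) :+ con 4 := con 4 :* (a :+ (con 1 :+ l)) :+ con 8) refl a L)))
      where open +-*-Solver

-- Incrementing the code

isMax : Γ 4 → Bool
isMax 7F = true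
isMax _  = false

succSym : Γ 4 → Γ 4
-- On the blank behind the last digit a new digit is appended, as in `inc []`.
succSym 0F = 1F
succSym 1F = 2F
succSym 2F = 3F
succSym 3F = 4F
succSym 4F = 5F
succSym 5F = 6F
succSym _  = 7F

opSucc : Vec (Γ 4) 1 → Vec (Op 4) 1
opSucc (a ∷ []) = (succSym a , mR) ∷ []

carryP incP : Frag 4 1
carryP = while (isMax ∘ hd₁) (put 1F)
incP   = carryP ⨟ (act opSucc ⨟ (scanR ⨟ rewind))

-- The cell at which the carry stops depends on the digits. The contents at that moment are
-- therefore kept abstract, and `whole` records only what remains true after scanning to the end.
record Carried (d e : List (Fin 7)) : Set where
  constructor carried
  field
    {mid rest₀ done rest} : List (Fin 7)
    carry : Exec carryP (posR (nz d) (nz e) ∷ []) (suc (2 * length e)) (posR (nz mid) (nz rest₀) ∷ [])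
    digit : Exec (act opSucc) (posR (nz mid) (nz rest₀) ∷ []) 1 (posR (nz done) (nz rest) ∷ [])
    whole : rest L.ʳ++ done ≡ inc e L.ʳ++ d
    short : length rest ≤ length e

exec-carry : ∀ d e → Carried d e
exec-carry d []       = carried {rest₀ = []} {rest = []} (exec-done refl) (exec-act opSucc (posR (nz d) [] ∷ [])) refl z≤n
exec-carry d (0F ∷ e) = carried {rest₀ = 0F ∷ e} (exec-done refl) (exec-act opSucc (posR (nz d) (nz (0F ∷ e)) ∷ [])) refl (n≤1+n _)
exec-carry d (1F ∷ e) = carried {rest₀ = 1F ∷ e} (exec-done refl) (exec-act opSucc (posR (nz d) (nz (1F ∷ e)) ∷ [])) refl (n≤1+n _)
exec-carry d (2F ∷ e) = carried {rest₀ = 2F ∷ e} (exec-done refl) (exec-act opSucc (posR (nz d) (nz (2F ∷ e)) ∷ [])) refl (n≤1+n _)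
exec-carry d (3F ∷ e) = carried {rest₀ = 3F ∷ e} (exec-done refl) (exec-act opSucc (posR (nz d) (nz (3F ∷ e)) ∷ [])) refl (n≤1+n _)
exec-carry d (4F ∷ e) = carried {rest₀ = 4F ∷ e} (exec-done refl) (exec-act opSucc (posR (nz d) (nz (4F ∷ e)) ∷ [])) refl (n≤1+n _)
exec-carry d (5F ∷ e) = carried {rest₀ = 5F ∷ e} (exec-done refl) (exec-act opSucc (posR (nz d) (nz (5F ∷ e)) ∷ [])) refl (n≤1+n _)
exec-carry d (6F ∷ e) with exec-carry (0F ∷ d) e
... | carried carry digit whole short = carried
  (weakenR (≤-reflexive (cong suc (double (length e)))) (exec-loop refl (exec-act (λ _ → (1F , mR) ∷ []) (posR (nz d) (nz (6F ∷ e)) ∷ []) {0}) carry))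
  digit whole (m≤n⇒m≤1+n short)

exec-inc : ∀ e → Exec incP (strT e ∷ []) (6 * length e + 8) (strT (inc e) ∷ [])
exec-inc e with exec-carry [] e
... | carried {done = done} {rest} carry digit whole short = weakenR le
  (exec-seq carry (exec-seq digit (exec-seq (exec-scanR rest done)
    (subst (λ z → Exec rewind (posR (nz z) [] ∷ []) (2 * length (inc e) + 3) (strT (inc e) ∷ [])) (sym whole) (exec-rewind (inc e))))))
  where
    le : suc (2 * length e) + (1 + (suc (2 * length rest) + (2 * length (inc e) + 3))) ≤ 6 * length e + 8
    le = ≤-trans (+-monoʳ-≤ (suc (2 * length e)) (s≤s (+-mono-≤ (s≤s (*-monoʳ-≤ 2 short)) (+-monoˡ-≤ 3 (*-monoʳ-≤ 2 (length-inc e))))))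
      (≤-reflexive (solve 1 (λ n → (con 1 :+ con 2 :* n) :+ (con 1 :+ ((con 1 :+ con 2 :* n) :+ (con 2 :* (con 1 :+ n) :+ con 3))) := con 6 :* n :+ con 8) refl (length e)))
      where open +-*-Solver

-- The cell at the position of the candidate under test is marked.
ysym : ℕ → ℕ → Fin 7
ysym m k = if k ≡ᵇ m then 1F else 0F

ycells : ℕ → ℕ → ℕ → List (Fin 7)
ycells m k zero    = []
ycells m k (suc n) = ysym m k ∷ ycells m (suc k) n

length-ycells : ∀ m k n → length (ycells m k n) ≡ n
length-ycells m k zero    = refl
length-ycells m k (suc n) = cong suc (length-ycells m (suc k) n)

flag : Bool → Γ 4
flag false = 0F
flag true  = 1F

flagT : Bool → Tape (Γ 4)
flagT b = tape [] (flag b) []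

answered : Γ 4 → Bool
answered 6F = true
answered 7F = true
answered _  = false

answered-uanswer : ∀ u → answered (proj₁ u) ≡ isJust (uanswer u)
answered-uanswer (0F , _) = refl
answered-uanswer (1F , _) = refl
answered-uanswer (2F , _) = refl
answered-uanswer (3F , _) = refl
answered-uanswer (4F , _) = refl
answered-uanswer (5F , _) = refl
answered-uanswer (6F , _) = refl
answered-uanswer (7F , _) = refl

opRecord : Vec (Γ 4) 8 → Vec (Op 4) 8
opRecord v@(y ∷ w ∷ c ∷ e ∷ b ∷ s ∷ _) = stay v [ 1F ]≔ ((if answered s then flag (isOne y) else w) , mS)

recorded : ∀ y w c e b (u : UCfg) → app (opRecord (heads (y ∷ flagT w ∷ c ∷ e ∷ b ∷ toS u))) (y ∷ flagT w ∷ c ∷ e ∷ b ∷ toS u)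
  ≡ y ∷ flagT (if answered (proj₁ u) then isOne (Tape.hd y) else w) ∷ c ∷ e ∷ b ∷ toS u
recorded y w c e b (s , x , t) = cong₂ _∷_ (stayed y) (cong₂ _∷_ (pick (answered s)) (cong₂ _∷_ (stayed c) (cong₂ _∷_ (stayed e) (cong₂ _∷_ (stayed b)
  (cong (tape [] s [] ∷_) (cong₂ (λ p q → p ∷ q ∷ []) (stayed x) (stayed t)))))))
  where
    stayed : (t : Tape (Γ 4)) → mv (Tape.hd t , mS) t ≡ t
    stayed (tape l h r) = refl
    pick : ∀ a → mv ((if a then flag (isOne (Tape.hd y)) else flag w) , mS) (flagT w) ≡ flagT (if a then isOne (Tape.hd y) else w)
    pick false = refl
    pick true  = refl

-- Tapes: position of the candidate, flag, and those of simulateP.  In the end, the flag says whether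
-- the last candidate on which the code answers is the input.
tryP : Frag 4 8
tryP = onRight 2 simulateP ⨟ act opRecord ⨟ onRight 4 clearP ⨟ onTape 2F flipP ⨟ onTape 0F goR

candidatesP : Frag 4 8
candidatesP = while (nonblank ∘ V.head) tryP

isOne-ysym : ∀ m k → isOne (suc (ysym m k)) ≡ (k ≡ᵇ m)
isOne-ysym m k with k ≡ᵇ m
... | false = refl
... | true  = refl

idle : Tapes 4 3
idle = toS (0F , blankT , blankT)

module _ (a L m : ℕ) (e y : List (Fin 7)) (y≡ : length y ≡ clock a L) (e≤ : length e ≤ length y)
         (n≤ : a + suc L ≤ length y) (pos : 1 ≤ length y) where

  β = length y

  last? : ℕ → Bool
  last? k = eqMaybe (lastAcc e a L k) m

  last?-suc : ∀ k b → (if b then k ≡ᵇ m else last? k) ≡ eqMaybe (if b then just k else lastAcc e a L k) m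
  last?-suc k false = refl
  last?-suc k true  = refl

  cost-try : ∀ k r d → k + suc r ≡ L →
    Cost β tryP (posR (nz d) (nz (ycells m k (suc r))) ∷ flagT (last? k) ∷ strT (candF a k (suc r)) ∷ strT e ∷ strT y ∷ idle) 253
                (posR (nz (ysym m k ∷ d)) (nz (ycells m (suc k) r)) ∷ flagT (last? (suc k)) ∷ strT (candF a (suc k) r) ∷ strT e ∷ strT y ∷ idle)
  cost-try k r d kr =
      within 47 ≤-refl (run-right {j = 2} (Y ∷ flagT (last? k) ∷ []) (subst (λ z → Exec simulateP (strT z ∷ strT e ∷ strT y ∷ idle) (47 * β)
        (strT z ∷ strT e ∷ strT y ∷ toS u)) (cand-bits a k (suc r)) (Cost.run (exec-simulate x e y x≤ e≤ pos))))
    ▸ within 1 (scale 1 pos) (subst (Exec (act opRecord) (Y ∷ flagT (last? k) ∷ C ∷ strT e ∷ strT y ∷ toS u) 1)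
        (trans (recorded Y (last? k) C (strT e) (strT y) u) (cong (λ w → Y ∷ flagT w ∷ C ∷ strT e ∷ strT y ∷ toS u) flag-eq))
        (exec-act opRecord (Y ∷ flagT (last? k) ∷ C ∷ strT e ∷ strT y ∷ toS u) {0}))
    ▸ within 192 ≤-refl (run-right {j = 4} (Y ∷ flagT (last? (suc k)) ∷ C ∷ strT e ∷ []) (Cost.run (clear-after x e y x≤ e≤ pos)))
    ▸ within 12 (units 4 8 (subst (λ z → a + suc z ≤ β) (trans (sym kr) (+-suc k r)) n≤) pos) (run-onTape 2F _ refl (exec-flip a k r))
    ▸ within 1 (scale 1 pos) (run-onTape 0F _ refl (exec-act opR _ {0}))
    where
      x = candL a k (suc r)
      u = usteps β (ucfg x e)
      Y = posR (nz d) (nz (ycells m k (suc r)))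
      C = strT (candF a k (suc r))
      x≤ : length x ≤ β
      x≤ = ≤-trans (≤-reflexive (trans (length-candL a k (suc r)) (cong (λ z → a + suc z) kr))) n≤
      acc-eq : answered (proj₁ u) ≡ accepts e a L k
      acc-eq = trans (answered-uanswer u) (cong₂ (λ r′ t → isJust (uanswer (usteps t (ucfg (candL a k r′) e))))
        (sym (trans (cong (_∸ k) (sym kr)) (m+n∸m≡n k (suc r)))) y≡)
      flag-eq : (if answered (proj₁ u) then isOne (Tape.hd Y) else last? k) ≡ last? (suc k)
      flag-eq = trans (cong₂ (λ p q → if p then q else last? k) acc-eq (isOne-ysym m k)) (last?-suc k (accepts e a L k))

  cost-candidates : ∀ k r d → k + r ≡ L →
    Cost β candidatesP (posR (nz d) (nz (ycells m k r)) ∷ flagT (last? k) ∷ strT (candF a k r) ∷ strT e ∷ strT y ∷ idle) (r * 254 + 1)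
                       (posR (nz (ycells m k r L.ʳ++ d)) [] ∷ flagT (last? L) ∷ strT (candF a L 0) ∷ strT e ∷ strT y ∷ idle)
  cost-candidates k zero    d kr rewrite trans (sym (+-identityʳ k)) kr = cost-done pos refl
  cost-candidates k (suc r) d kr = cost-loop pos refl (cost-try k r d kr) (cost-candidates (suc k) r (ysym m k ∷ d) (trans (sym (+-suc k r)) kr))

-- Running through the codes

opKill : Vec (Γ 4) 11 → Vec (Op 4) 11
opKill v@(_ ∷ _ ∷ κ ∷ _ ∷ w ∷ _) = stay v [ 2F ]≔ ((if nonblank w then 1F else κ) , mS) [ 4F ]≔ (0F , mS)

popL : Frag 4 1
popL = act λ _ → (0F , mL) ∷ []

-- Tapes: input, number of codes to be treated, flag (the input is excluded), and those of tryP.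
codeP codesP : Frag 4 11
codeP  = onRight 3 candidatesP ⨟ onTape 3F rewind ⨟ onTape 5F resetP ⨟ act opKill ⨟ onTape 6F incP ⨟ onTape 1F popL
codesP = while (λ v → nonblank (V.lookup v 1F)) codeP

killed-state : ∀ i j κ y w c e b (s : UCfg) → let st = i ∷ j ∷ flagT κ ∷ y ∷ flagT w ∷ c ∷ e ∷ b ∷ toS s in
  app (opKill (heads st)) st ≡ i ∷ j ∷ flagT (w ∨ κ) ∷ y ∷ flagT false ∷ c ∷ e ∷ b ∷ toS s
killed-state (tape _ _ _) (tape _ _ _) κ (tape _ _ _) true (tape _ _ _) (tape _ _ _) (tape _ _ _) (s , tape _ _ _ , tape _ _ _)  = refl
killed-state (tape _ _ _) (tape _ _ _) κ (tape _ _ _) false (tape _ _ _) (tape _ _ _) (tape _ _ _) (s , tape _ _ _ , tape _ _ _) = refl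

tally : ℕ → List (Fin 7)
tally n = replicate n 0F

module _ (a L m : ℕ) (y : List (Fin 7)) (y≡ : length y ≡ clock a L) (n≤ : a + suc L ≤ length y) where

  private
    β′ = length y

  pos-clock : 1 ≤ β′
  pos-clock = ≤-trans (≤-trans (s≤s z≤n) (m≤n+m (suc L) a)) n≤

  L≤ : L ≤ β′
  L≤ = ≤-trans (≤-trans (n≤1+n L) (m≤n+m (suc L) a)) n≤

  work-state : Tape (Γ 4) → List (Fin 7) → ℕ → Bool → Tapes 4 11
  work-state i e j κ = i ∷ posL (nz (tally j)) [] ∷ flagT κ ∷ strT (ycells m 0 L) ∷ flagT false ∷ strT (candF a 0 L) ∷ strT e ∷ strT y ∷ idle

  cost-code : ∀ i e j κ → length e ≤ β′ →
    Cost β′ codeP (work-state i e (suc j) κ) (L * 254 + 1 + 33) (work-state i (inc e) j (eqMaybe (lastAcc e a L L) m ∨ κ))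
  cost-code i e j κ e≤ =
      within (L * 254 + 1) ≤-refl (run-right {j = 3} (i ∷ jt ∷ flagT κ ∷ []) (Cost.run (cost-candidates a L m e y y≡ e≤ n≤ pos-clock 0 L [] refl)))
    ▸ within 5 (≤-trans (≤-reflexive (cong (λ n → 2 * n + 3) (length-ycells m 0 L))) (units 2 3 L≤ pos-clock)) (run-onTape 3F _ refl (exec-rewind (ycells m 0 L)))
    ▸ within 12 (units 4 8 n≤ pos-clock) (run-onTape 5F _ refl (exec-reset a L))
    ▸ within 1 (scale 1 pos-clock) (subst (Exec (act opKill) st 1) (killed-state i jt κ (strT (ycells m 0 L)) w (strT (candF a 0 L)) (strT e) (strT y) (0F , blankT , blankT))
        (exec-act opKill st {0}))
    ▸ within 14 (units 6 8 e≤ pos-clock) (run-onTape 6F _ refl (exec-inc e))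
    ▸ within 1 (scale 1 pos-clock) (run-onTape 1F _ refl (exec-act (λ _ → (0F , mL) ∷ []) _ {0}))
    where
      w = eqMaybe (lastAcc e a L L) m
      jt = posL (nz (tally (suc j))) []
      st = i ∷ jt ∷ flagT κ ∷ strT (ycells m 0 L) ∷ flagT w ∷ strT (candF a 0 L) ∷ strT e ∷ strT y ∷ idle

  cost-codes : ∀ i k j → k + j ≤ L → Cost β′ codesP (work-state i (code k) j (killedBy a L m k)) (j * suc (L * 254 + 1 + 33) + 1)
                                               (work-state i (code (j + k)) 0 (killedBy a L m (j + k)))
  cost-codes i k zero    le = cost-done pos-clock refl
  cost-codes i k (suc j) le = subst (λ c → Cost β′ codesP (work-state i (code k) (suc j) (killedBy a L m k)) c (work-state i (code (suc j + k)) 0 (killedBy a L m (suc j + k))))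
    (cong suc (sym (+-assoc (L * 254 + 1 + 33) (j * suc (L * 254 + 1 + 33)) 1)))
    (cost-loop pos-clock refl (cost-code i (code k) j (killedBy a L m k) (≤-trans (length-code k) (≤-trans (≤-trans (m≤m+n k (suc j)) le) L≤)))
      (subst (λ e → Cost β′ codesP (work-state i e j (killedBy a L m (suc k))) (j * suc (L * 254 + 1 + 33) + 1) (work-state i (code (suc j + k)) 0 (killedBy a L m (suc j + k))))
        (iter-suc inc k [])
        (subst (λ z → Cost β′ codesP (work-state i (code (suc k)) j (killedBy a L m (suc k))) (j * suc (L * 254 + 1 + 33) + 1) (work-state i (code z) 0 (killedBy a L m z)))
          (+-suc j k) (cost-codes i (suc k) j (≤-trans (≤-reflexive (sym (+-suc k j))) le)))))

-- Computing the clock: powers in unary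

moveP : Frag 4 2
moveP = while (nonblank ∘ V.head) (act λ _ → (0F , mR) ∷ (1F , mR) ∷ [])

exec-move : ∀ n k → Exec moveP (strT (tally n) ∷ posR (nz (tally k)) [] ∷ []) (suc (2 * n)) (blankT ∷ posR (nz (tally (n + k))) [] ∷ [])
exec-move zero    k = exec-done refl
exec-move (suc n) k = weakenR (≤-reflexive (cong suc (double n)))
  (exec-loop refl (exec-act (λ _ → (0F , mR) ∷ (1F , mR) ∷ []) (strT (tally (suc n)) ∷ posR (nz (tally k)) [] ∷ []) {0})
    (subst (λ z → Exec moveP (strT (tally n) ∷ posR (nz (tally (suc k))) [] ∷ []) (suc (2 * n)) (blankT ∷ posR (nz (tally z)) [] ∷ []))
      (+-suc n k) (exec-move n (suc k))))

-- Multiplication in unary: each cell of tape `7F` is erased in exchange for one copy of the length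
-- of the candidate on tape `9F`, and the product is moved back. As the candidate has the length of
-- the input, iterating this yields the clock.
addP multP : Frag 4 11
addP  = while (λ v → nonblank (V.lookup v 7F)) (onTape 7F (put 0F) ⨟ (onPair 5F 9F (copyWith (λ _ → 1F)) ⨟ onTape 5F rewind))
multP = addP ⨟ (onTape 9F rewind ⨟ (onPair 9F 7F moveP ⨟ onTape 7F rewind))

module _ (i j κ y w e s t : Tape (Γ 4)) (c : List (Fin 7)) where

  private
    n = length c

  pow-state : Tape (Γ 4) → Tape (Γ 4) → Tapes 4 11
  pow-state b x = i ∷ j ∷ κ ∷ y ∷ w ∷ strT c ∷ e ∷ b ∷ s ∷ x ∷ t ∷ []

  copied : ∀ (c : List (Fin 7)) k → L.map (λ _ → 0F) c L.ʳ++ tally k ≡ tally (length c + k)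
  copied []      k = refl
  copied (_ ∷ c) k = trans (copied c (suc k)) (cong tally (+-suc (length c) k))

  tally-end : ∀ k → posR (nz (tally k)) [] ≡ endT (tally k)
  tally-end k = cong (λ z → posR (nz z) []) (sym (trans (rev-replicate k 0F []) (Lₚ.++-identityʳ _)))

  exec-add : ∀ b k → Exec addP (pow-state (strT (tally b)) (posR (nz (tally k)) [])) (b * (4 * n + 6) + 1)
                               (pow-state blankT (posR (nz (tally (b * n + k))) []))
  exec-add zero    k = exec-done refl
  exec-add (suc b) k = weakenR (≤-reflexive eq)
    (exec-loop refl (exec-seq (run-onTape 7F _ refl (exec-act (λ _ → (0F , mR) ∷ []) _ {0}))
                    (exec-seq (run-onPair 5F 9F (λ ()) _ refl refl (exec-copyWith {f = λ _ → 1F} {λ _ → 0F} (λ _ → refl) c [] (tally k)))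
                              (run-onTape 5F _ refl (exec-rewind c))))
      (subst (λ z → Exec addP (pow-state (strT (tally b)) (posR (nz z) [])) (b * (4 * n + 6) + 1) (pow-state blankT (posR (nz (tally (n + b * n + k))) [])))
        (sym (copied c k))
        (subst (λ z → Exec addP (pow-state (strT (tally b)) (posR (nz (tally (n + k))) [])) (b * (4 * n + 6) + 1) (pow-state blankT (posR (nz (tally z)) [])))
          (trans (sym (+-assoc (b * n) n k)) (cong (_+ k) (+-comm (b * n) n))) (exec-add b (n + k)))))
    where
      eq : suc (1 + (suc (2 * n) + (2 * n + 3)) + (b * (4 * n + 6) + 1)) ≡ suc b * (4 * n + 6) + 1
      eq = solve 2 (λ n b → con 1 :+ (con 1 :+ ((con 1 :+ con 2 :* n) :+ (con 2 :* n :+ con 3)) :+ (b :* (con 4 :* n :+ con 6) :+ con 1))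
                         := (con 1 :+ b) :* (con 4 :* n :+ con 6) :+ con 1) refl n b
        where open +-*-Solver

  cost-mult : ∀ {β} b → 1 ≤ n → b * n ≤ β → 1 ≤ β → Cost β multP (pow-state (strT (tally b)) blankT) 24 (pow-state (strT (tally (b * n))) blankT)
  cost-mult {β} b n≥1 le pos =
      within 11 add≤ (subst (λ z → Exec addP (pow-state (strT (tally b)) blankT) (b * (4 * n + 6) + 1) (pow-state blankT z)) X-eq (exec-add b 0))
    ▸ within 5 (≤-trans (≤-reflexive (cong (λ z → 2 * z + 3) (Lₚ.length-replicate (b * n)))) (units 2 3 le pos)) (run-onTape 9F _ refl (exec-rewind (tally (b * n))))
    ▸ within 3 (units₁ le pos) (run-onPair 9F 7F (λ ()) _ refl refl (exec-move (b * n) 0))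
    ▸ within 5 (≤-trans (≤-reflexive (cong (λ z → 2 * z + 3) (Lₚ.length-replicate (b * n)))) (units 2 3 le pos))
        (run-onTape 7F (pow-state (posR (nz (tally (b * n + 0))) []) blankT) X-eq (exec-rewind (tally (b * n))))
    where
      X-eq : posR (nz (tally (b * n + 0))) [] ≡ endT (tally (b * n))
      X-eq = trans (cong (λ z → posR (nz (tally z)) []) (+-identityʳ (b * n))) (tally-end (b * n))
      add≤ : b * (4 * n + 6) + 1 ≤ 11 * β
      add≤ = ≤-trans (+-monoˡ-≤ 1 (≤-trans (*-monoʳ-≤ b (+-monoʳ-≤ (4 * n) (scale 6 n≥1)))
        (≤-reflexive (solve 2 (λ b n → b :* (con 4 :* n :+ con 6 :* n) := con 10 :* (b :* n)) refl b n)))) (units 10 1 le pos)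
        where open +-*-Solver

powP : ℕ → Frag 4 11
powP zero    = onTape 7F (act λ _ → (1F , mS) ∷ [])
powP (suc d) = powP d ⨟ multP

powCost : ℕ → ℕ
powCost zero    = 1
powCost (suc d) = powCost d + 24

cost-pow : ∀ i j κ y w c e s t {β} → 1 ≤ length c → ∀ d → length c ^ d ≤ β →
  Cost β (powP d) (pow-state i j κ y w e s t c blankT blankT) (powCost d) (pow-state i j κ y w e s t c (strT (tally (length c ^ d))) blankT)
cost-pow i j κ y w c e s t n≥1 zero    le = within 1 (scale 1 le) (run-onTape 7F _ refl (exec-act (λ _ → (1F , mS) ∷ []) _ {0}))
cost-pow i j κ y w c e s t {β} n≥1 (suc d) le =
  cost-pow i j κ y w c e s t n≥1 d (≤-trans (≤-trans (≤-reflexive (sym (*-identityˡ _))) (*-monoˡ-≤ (length c ^ d) n≥1)) le) ▸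
  subst (λ z → Cost β multP (pow-state i j κ y w e s t c (strT (tally (length c ^ d))) blankT) 24 (pow-state i j κ y w e s t c (strT (tally z)) blankT))
    (*-comm (length c ^ d) (length c))
    (cost-mult i j κ y w e s t c (length c ^ d) n≥1 (≤-trans (≤-reflexive (*-comm (length c ^ d) (length c))) le) (≤-trans (^-≥1 (suc d) n≥1) le))

-- Parsing the input

span : ∀ b x → (∃ λ a → x ≡ replicate a b) ⊎ (∃₂ λ a y → x ≡ replicate a b ++ not b ∷ y)
span b [] = inj₁ (0 , refl)
span true (false ∷ x) = inj₂ (0 , x , refl)
span false (true ∷ x) = inj₂ (0 , x , refl)
span true (true ∷ x) with span true x
... | inj₁ (a , refl)     = inj₁ (suc a , refl)
... | inj₂ (a , y , refl) = inj₂ (suc a , y , refl)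
span false (false ∷ x) with span false x
... | inj₁ (a , refl)     = inj₁ (suc a , refl)
... | inj₂ (a , y , refl) = inj₂ (suc a , y , refl)

data Form : List Bool → Set where
  good : ∀ a m r → Form (candL a m (suc r))
  bad₁ : ∀ a → Form (replicate a true)
  bad₂ : ∀ a m → Form (replicate a true ++ false ∷ replicate m true)
  bad₃ : ∀ a m r x → Form (replicate a true ++ false ∷ replicate m true ++ replicate (suc r) false ++ true ∷ x)

form : ∀ x → Form x
form x with span true x
... | inj₁ (a , refl) = bad₁ a
... | inj₂ (a , y , refl) with span true y
... | inj₁ (m , refl) = bad₂ a m
... | inj₂ (m , z , refl) with span false z
... | inj₁ (r , refl)     = good a m r
... | inj₂ (r , w , refl) = bad₃ a m r w

-- The automaton of the language 1*01*00*.
ok₀ ok₁ ok₂ : List Bool → Bool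
ok₀ []          = false
ok₀ (true ∷ x)  = ok₀ x
ok₀ (false ∷ x) = ok₁ x
ok₁ []          = false
ok₁ (true ∷ x)  = ok₁ x
ok₁ (false ∷ x) = ok₂ x
ok₂ []          = true
ok₂ (true ∷ x)  = false
ok₂ (false ∷ x) = ok₂ x

ok₀-ones : ∀ a x → ok₀ (replicate a true ++ x) ≡ ok₀ x
ok₀-ones zero    x = refl
ok₀-ones (suc a) x = ok₀-ones a x

ok₁-ones : ∀ a x → ok₁ (replicate a true ++ x) ≡ ok₁ x
ok₁-ones zero    x = refl
ok₁-ones (suc a) x = ok₁-ones a x

ok₂-zeros : ∀ a x → ok₂ (replicate a false ++ x) ≡ ok₂ x
ok₂-zeros zero    x = refl
ok₂-zeros (suc a) x = ok₂-zeros a x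

ok-cand : ∀ a m r → ok₀ (candL a m (suc r)) ≡ true
ok-cand a m r = trans (ok₀-ones a _) (trans (ok₁-ones m _) (trans (cong ok₂ (sym (Lₚ.++-identityʳ (replicate r false)))) (ok₂-zeros r [])))

not-ok : ∀ {x} i → ok₀ (toList x) ≡ false → ¬ Survivor i x
not-ok i n s = contradiction (trans (sym n) (trans (cong ok₀ shape) (ok-cand a m r))) λ ()
  where open Survivor s

ok-bad₁ : ∀ a → ok₀ (replicate a true) ≡ false
ok-bad₁ a = trans (cong ok₀ (sym (Lₚ.++-identityʳ (replicate a true)))) (ok₀-ones a [])

ok-bad₂ : ∀ a m → ok₀ (replicate a true ++ false ∷ replicate m true) ≡ false
ok-bad₂ a m = trans (ok₀-ones a _) (trans (cong ok₁ (sym (Lₚ.++-identityʳ (replicate m true)))) (ok₁-ones m []))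

ok-bad₃ : ∀ a m r x → ok₀ (replicate a true ++ false ∷ replicate m true ++ replicate (suc r) false ++ true ∷ x) ≡ false
ok-bad₃ a m r x = trans (ok₀-ones a _) (trans (ok₁-ones m _) (ok₂-zeros r _))

replicate-injective : ∀ {A : Set} r r′ (x : A) → replicate r x ≡ replicate r′ x → r ≡ r′
replicate-injective r r′ x eq = trans (sym (Lₚ.length-replicate r)) (trans (cong length eq) (Lₚ.length-replicate r′))

ones-injective : ∀ m m′ {y y′} → replicate m true ++ false ∷ y ≡ replicate m′ true ++ false ∷ y′ → m ≡ m′ × y ≡ y′
ones-injective zero    zero     refl = refl , refl
ones-injective zero    (suc m′) ()
ones-injective (suc m) zero     ()
ones-injective (suc m) (suc m′) eq with ones-injective m m′ (Lₚ.∷-injectiveʳ eq)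
... | refl , refl = refl , refl

cand-injective : ∀ a m r a′ m′ r′ → candL a m (suc r) ≡ candL a′ m′ (suc r′) → a ≡ a′ × m ≡ m′ × r ≡ r′
cand-injective a m r a′ m′ r′ eq with ones-injective a a′ eq
... | refl , eq′ with ones-injective m m′ eq′
... | refl , eq″ = refl , refl , replicate-injective r r′ false eq″

-- A single pass over the input prepares all tapes. Tape `5F` receives 1ᵃ0 followed by L zeros, from
-- which the candidates are generated. Tape `3F` receives L cells, the one at m being marked by
-- `opD`. The step `opD` is not counted on tape `1F`, which leaves L - 1, the number of codes. Tape
-- `9F` is first a tally of a and then loses a cell for each of the last L symbols; it ends nonblank
-- exactly if a > L.
opA opB opC opD : Vec (Γ 4) 11 → Vec (Op 4) 11
opA v = stay v [ 0F ]≔ (V.head v , mR) [ 5F ]≔ (2F , mR) [ 9F ]≔ (1F , mR)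
opB v = stay v [ 0F ]≔ (V.head v , mR) [ 5F ]≔ (1F , mR) [ 9F ]≔ (V.lookup v 9F , mL)
opC v = stay v [ 0F ]≔ (V.head v , mR) [ 1F ]≔ (1F , mR) [ 3F ]≔ (1F , mR) [ 5F ]≔ (1F , mR) [ 9F ]≔ (0F , mL)
opD v = stay v [ 0F ]≔ (V.head v , mR) [ 3F ]≔ (2F , mR) [ 5F ]≔ (1F , mR) [ 9F ]≔ (0F , mL)

isZero : ∀ {n} → Fin n → Bool
isZero (suc zero) = true
isZero _          = false

-- Before the simulations start, the queue tape holds a tally of the level a, to be compared with L.
parse-state : Tape (Γ 4) → List (Fin 7) → List (Fin 7) → List (Fin 7) → Tape (Γ 4) → Tapes 4 11
parse-state i j y c x = i ∷ posR (nz j) [] ∷ blankT ∷ posR (nz y) [] ∷ blankT ∷ posR (nz c) [] ∷ blankT ∷ blankT ∷ blankT ∷ x ∷ blankT ∷ []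

parseOnes : Frag 4 11
parseOnes = while (isOne ∘ V.head) (act opA)

parseP : (Γ 4 → Bool) → Frag 4 11
parseP test = while (test ∘ V.head) (act opC)

levT : ℕ → Tape (Γ 4)
levT q = posL (nz (tally q)) []

exec-parseOnes : ∀ n d s c x → isOne (Tape.hd (posR [] s)) ≡ false →
  Exec parseOnes (parse-state (posR (nz d) (nz (replicate n 1F) ++ s)) [] [] c (posR (nz x) [])) (suc (2 * n))
                 (parse-state (posR (nz (replicate n 1F L.ʳ++ d)) s) [] [] (replicate n 1F L.ʳ++ c) (posR (nz (tally n L.ʳ++ x)) []))
exec-parseOnes zero    d []      c x eq = exec-done refl
exec-parseOnes zero    d (_ ∷ _) c x eq = exec-done eq
exec-parseOnes (suc n) d s       c x eq = weakenR (≤-reflexive (cong suc (double n)))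
  (exec-loop refl (exec-act opA (parse-state (posR (nz d) (nz (replicate (suc n) 1F) ++ s)) [] [] c (posR (nz x) [])) {0})
    (exec-parseOnes n (1F ∷ d) s (1F ∷ c) (0F ∷ x) eq))

module _ (test : Γ 4 → Bool) (v : Fin 7) (yes : test (suc v) ≡ true) where

  exec-parse : ∀ n d s j y c q → test (Tape.hd (posR [] s)) ≡ false →
    Exec (parseP test) (parse-state (posR (nz d) (nz (replicate n v) ++ s)) j y c (levT q)) (suc (2 * n))
                (parse-state (posR (nz (replicate n v L.ʳ++ d)) s) (tally n L.ʳ++ j) (tally n L.ʳ++ y) (tally n L.ʳ++ c) (levT (q ∸ n)))
  exec-parse zero    d []      j y c q       eq = exec-done eq
  exec-parse zero    d (_ ∷ _) j y c q       eq = exec-done eq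
  exec-parse (suc n) d s       j y c (suc q) eq = weakenR (≤-reflexive (cong suc (double n)))
    (exec-loop yes (exec-act opC (parse-state (posR (nz d) (nz (replicate (suc n) v) ++ s)) j y c (levT (suc q))) {0})
      (exec-parse n (v ∷ d) s (0F ∷ j) (0F ∷ y) (0F ∷ c) q eq))
  exec-parse (suc n) d s       j y c zero    eq = weakenR (≤-reflexive (cong suc (double n)))
    (exec-loop yes (exec-act opC (parse-state (posR (nz d) (nz (replicate (suc n) v) ++ s)) j y c (levT zero)) {0})
      (subst (λ z → Exec (parseP test) (parse-state (posR (nz (v ∷ d)) (nz (replicate n v) ++ s)) (0F ∷ j) (0F ∷ y) (0F ∷ c) (levT zero)) (suc (2 * n))
          (parse-state (posR (nz (replicate n v L.ʳ++ (v ∷ d))) s) (tally n L.ʳ++ (0F ∷ j)) (tally n L.ʳ++ (0F ∷ y)) (tally n L.ʳ++ (0F ∷ c)) (levT z)))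
        (0∸n≡0 n) (exec-parse n (v ∷ d) s (0F ∷ j) (0F ∷ y) (0F ∷ c) zero eq)))

-- A blank at the head makes the output empty, whatever follows. The bit 1 is written only when the
-- head is past the end of the input, and then it is the whole output.
rejectP acceptP : Frag 4 11
rejectP = onTape 0F (act λ _ → (0F , mS) ∷ [])
acceptP = onTape 0F (act λ _ → (2F , mS) ∷ [])

parsed : Frag 4 11 → Frag 4 11
parsed main = parseOnes ⨟ ifte (isZero ∘ V.head)
  (act opB ⨟ (parseP isOne ⨟ ifte (isZero ∘ V.head)
    (act opD ⨟ (parseP isZero ⨟ ifte (λ v → nonblank (V.head v) ∨ nonblank (V.lookup v 9F)) rejectP main))
    rejectP))
  rejectP

ys-after : ∀ m k n → m < k → ycells m k n ≡ tally n
ys-after m k zero    lt = refl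
ys-after m k (suc n) lt = cong₂ _∷_ (unmarked (k ≡ᵇ m) refl) (ys-after m (suc k) n (m≤n⇒m≤1+n lt))
  where
    unmarked : ∀ b → (k ≡ᵇ m) ≡ b → ysym m k ≡ 0F
    unmarked false eq rewrite eq = refl
    unmarked true  eq = contradiction (≡ᵇ⇒≡ k m (subst T (sym eq) tt)) (>⇒≢ lt)

ysym-self : ∀ m → ysym m m ≡ 1F
ysym-self zero    = refl
ysym-self (suc m) = ysym-self m

ysym-before : ∀ k m → ysym (k + suc m) k ≡ 0F
ysym-before zero    m = refl
ysym-before (suc k) m = ysym-before k m

ycells-tally : ∀ k m r → ycells (k + m) k (m + suc r) ≡ tally m ++ 1F ∷ tally r
ycells-tally k zero    r rewrite +-identityʳ k = cong₂ _∷_ (ysym-self k) (ys-after k (suc k) r ≤-refl)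
ycells-tally k (suc m) r = cong₂ _∷_ (ysym-before k m)
  (trans (cong (λ z → ycells z (suc k) (m + suc r)) (+-suc k m)) (ycells-tally (suc k) m r))

ycells-parsed : ∀ m r → tally r L.ʳ++ (1F ∷ (tally m L.ʳ++ [])) ≡ ycells m 0 (m + suc r) L.ʳ++ []
ycells-parsed m r = sym (trans (cong (L._ʳ++ []) (ycells-tally 0 m r)) (Lₚ.++-ʳ++ (tally m)))

tally-++ : ∀ m n → tally (m + n) ≡ tally m ++ tally n
tally-++ zero    n = refl
tally-++ (suc m) n = cong (0F ∷_) (tally-++ m n)

rev-tally : ∀ m n → tally m L.ʳ++ tally n ≡ tally (m + n)
rev-tally m n = trans (rev-replicate m 0F (tally n)) (sym (tally-++ m n))

cand-parsed : ∀ a m r → tally r L.ʳ++ (0F ∷ (tally m L.ʳ++ (0F ∷ (replicate a 1F L.ʳ++ [])))) ≡ candF a 0 (m + suc r) L.ʳ++ []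
cand-parsed a m r = sym (begin
  (replicate a 1F ++ 0F ∷ tally (m + suc r)) L.ʳ++ []          ≡⟨ Lₚ.++-ʳ++ (replicate a 1F) ⟩
  tally (m + suc r) L.ʳ++ (0F ∷ (replicate a 1F L.ʳ++ []))     ≡⟨ cong (L._ʳ++ (0F ∷ (replicate a 1F L.ʳ++ []))) (tally-++ m (suc r)) ⟩
  (tally m ++ tally (suc r)) L.ʳ++ (0F ∷ (replicate a 1F L.ʳ++ [])) ≡⟨ Lₚ.++-ʳ++ (tally m) ⟩
  tally (suc r) L.ʳ++ (tally m L.ʳ++ (0F ∷ (replicate a 1F L.ʳ++ []))) ∎)
  where open ≡-Reasoning

loop-parsed : ∀ m r → tally r L.ʳ++ (tally m L.ʳ++ []) ≡ tally (m + r)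
loop-parsed m r = trans (cong (tally r L.ʳ++_) (trans (rev-tally m 0) (cong tally (+-identityʳ m)))) (trans (rev-tally r m) (cong tally (+-comm r m)))

module _ (a m r : ℕ) where

  private
    L₁ L₂ L₃ J₂ J₃ Y₃ C₂ C₃ : List (Fin 7)
    L₁ = replicate a 1F L.ʳ++ []
    L₂ = replicate m 1F L.ʳ++ (0F ∷ L₁)
    L₃ = replicate r 0F L.ʳ++ (0F ∷ L₂)
    J₂ = tally m L.ʳ++ []
    J₃ = tally r L.ʳ++ J₂
    Y₃ = tally r L.ʳ++ (1F ∷ J₂)
    C₂ = tally m L.ʳ++ (0F ∷ L₁)
    C₃ = tally r L.ʳ++ (0F ∷ C₂)

  state₁ state₂ state₃ : List (Γ 4) → Tapes 4 11
  state₁ s = parse-state (posR (nz L₁) s) [] [] L₁ (posR (nz (tally a L.ʳ++ [])) [])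
  state₂ s = parse-state (posR (nz L₂) s) J₂ J₂ C₂ (levT (a ∸ m))
  state₃ s = parse-state (posR (nz L₃) s) J₃ Y₃ C₃ (levT (a ∸ m ∸ 1 ∸ r))

  string₁ string₂ : List (Γ 4) → List (Γ 4)
  string₁ s = nz (replicate a 1F) ++ s
  string₂ s = 1F ∷ (nz (replicate m 1F) ++ s)

  module _ (main : Frag 4 11) where

    third second first : Frag 4 11
    third  = ifte (λ v → nonblank (V.head v) ∨ nonblank (V.lookup v 9F)) rejectP main
    second = ifte (isZero ∘ V.head) (act opD ⨟ (parseP isZero ⨟ third)) rejectP
    first  = ifte (isZero ∘ V.head) (act opB ⨟ (parseP isOne ⨟ second)) rejectP

    -- The run is composed from the outside in, with an arbitrary unread part `s`, so that
    -- well-formed and malformed inputs share the runs on their common beginnings.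
    through₁ : ∀ {s τ s′} → isOne (Tape.hd (posR [] s)) ≡ false → Exec first (state₁ s) τ s′ →
      Exec (parsed main) (parse-state (posR [] (string₁ s)) [] [] [] blankT) (suc (2 * a) + τ) s′
    through₁ {s} eq x = exec-seq (exec-parseOnes a [] s [] [] eq) x

    through₂ : ∀ {s τ s′} → isOne (Tape.hd (posR [] s)) ≡ false → Exec second (state₂ s) τ s′ →
      Exec first (state₁ (string₂ s)) (suc (1 + (suc (2 * m) + τ))) s′
    through₂ {s} eq x = exec-then refl (exec-seq
      (subst (λ t → Exec (act opB) (state₁ (string₂ s)) 1 (parse-state (posR (nz (0F ∷ L₁)) (nz (replicate m 1F) ++ s)) [] [] (0F ∷ L₁) t)) lev
        (exec-act opB (state₁ (string₂ s)) {0}))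
      (exec-seq (exec-parse isOne 1F refl m (0F ∷ L₁) s [] [] (0F ∷ L₁) a eq) x))
      where
        lev : posL (nz (tally a L.ʳ++ [])) [] ≡ levT a
        lev = cong (λ z → posL (nz z) []) (trans (rev-replicate a 0F []) (Lₚ.++-identityʳ _))

    pop-lev : ∀ q → mv (0F , mL) (levT q) ≡ levT (q ∸ 1)
    pop-lev zero    = refl
    pop-lev (suc q) = refl

    through₃ : ∀ {s τ s′} → isZero (Tape.hd (posR [] s)) ≡ false → Exec third (state₃ s) τ s′ →
      Exec second (state₂ (1F ∷ (nz (replicate r 0F) ++ s))) (suc (1 + (suc (2 * r) + τ))) s′
    through₃ {s} eq x = exec-then refl (exec-seq
      (subst (λ t → Exec (act opD) (state₂ (1F ∷ (nz (replicate r 0F) ++ s))) 1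
                      (parse-state (posR (nz (0F ∷ L₂)) (nz (replicate r 0F) ++ s)) J₂ (1F ∷ J₂) (0F ∷ C₂) t)) (pop-lev (a ∸ m))
        (exec-act opD (state₂ (1F ∷ (nz (replicate r 0F) ++ s))) {0}))
      (exec-seq (exec-parse isZero 0F refl r (0F ∷ L₂) s J₂ (1F ∷ J₂) (0F ∷ C₂) (a ∸ m ∸ 1) eq) x))

    rejected : ∀ s → Exec rejectP s 1 (s [ 0F ]≔ mv (0F , mS) (V.head s))
    rejected (t ∷ s) = run-onTape 0F (t ∷ s) refl (exec-act (λ _ → (0F , mS) ∷ []) (t ∷ []) {0})

    reject₁ : Exec first (state₁ []) 2 (state₁ [] [ 0F ]≔ mv (0F , mS) (posR (nz L₁) []))
    reject₁ = exec-else refl (rejected (state₁ []))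

    reject₂ : Exec second (state₂ []) 2 (state₂ [] [ 0F ]≔ mv (0F , mS) (posR (nz L₂) []))
    reject₂ = exec-else refl (rejected (state₂ []))

    reject₃ : ∀ s → Exec third (state₃ (2F ∷ s)) 2 (state₃ (2F ∷ s) [ 0F ]≔ mv (0F , mS) (posR (nz L₃) (2F ∷ s)))
    reject₃ s = exec-then refl (rejected (state₃ (2F ∷ s)))

    reject-level : m + suc r < a → Exec third (state₃ []) 2 (state₃ [] [ 0F ]≔ mv (0F , mS) (posR (nz L₃) []))
    reject-level lt with a ∸ m ∸ 1 ∸ r in eq
    ... | suc q = exec-then refl (rejected (parse-state (posR (nz L₃) []) J₃ Y₃ C₃ (levT (suc q))))
    ... | zero  = contradiction lt (≤⇒≯ (m∸n≡0⇒m≤n (trans (trans (cong (a ∸_) (sym (+-assoc m 1 r)))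
                    (sym (trans (cong (_∸ r) (∸-+-assoc a m 1)) (∸-+-assoc a (m + 1) r)))) eq)))

    accept-level : a ≤ m + suc r → state₃ [] ≡
      posR (nz L₃) [] ∷ posR (nz (tally (m + r))) [] ∷ blankT ∷ endT (ycells m 0 (m + suc r)) ∷ blankT ∷ endT (candF a 0 (m + suc r)) ∷
      blankT ∷ blankT ∷ blankT ∷ blankT ∷ blankT ∷ []
    accept-level le = cong₂ (λ j rest → posR (nz L₃) [] ∷ posR (nz j) [] ∷ blankT ∷ rest) (loop-parsed m r)
      (cong₂ (λ y rest → posR (nz y) [] ∷ blankT ∷ rest) (ycells-parsed m r)
        (cong₂ (λ c x → posR (nz c) [] ∷ blankT ∷ blankT ∷ blankT ∷ x ∷ blankT ∷ []) (cand-parsed a m r) (cong levT level)))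
      where
        level : a ∸ m ∸ 1 ∸ r ≡ 0
        level = trans (trans (cong (_∸ r) (∸-+-assoc a m 1)) (∸-+-assoc a (m + 1) r)) (m≤n⇒m∸n≡0 (≤-trans le (≤-reflexive (sym (+-assoc m 1 r)))))

-- The decision procedure for the survivors

mainP : ℕ → Frag 4 11
mainP lev = onTape 5F scanR ⨟ onTape 5F rewind ⨟ powP (D lev) ⨟ codesP ⨟ ifte (λ v → nonblank (V.lookup v 2F)) rejectP acceptP

-- The level is determined by the finite control, because the exponent `D lev` of the clock is part
-- of the program. Only levels up to i are provided for.
dispP : ℕ → ℕ → Frag 4 11
dispP zero    lev = ifte (λ v → isOne (V.lookup v 5F)) rejectP (mainP lev)
dispP (suc i) lev = ifte (λ v → isOne (V.lookup v 5F)) (onTape 5F goR ⨟ dispP i (suc lev)) (mainP lev)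

prepareP : Frag 4 11 → Frag 4 11
prepareP p = onTape 3F rewind ⨟ onTape 5F rewind ⨟ onTape 1F goL ⨟ p

decideP : ℕ → Frag 4 11
decideP i = parsed (prepareP (dispP i 0))

D≥1 : ∀ a → 1 ≤ D a
D≥1 zero    = s≤s z≤n
D≥1 (suc a) = ≤-trans (s≤s z≤n) (m≤n+m 20 (6 * D a))

n≤n^d : ∀ {n d} → 1 ≤ n → 1 ≤ d → n ≤ n ^ d
n≤n^d {n} {suc d} n≥1 _ = scale n (^-≥1 d n≥1)

verdictT : Bool → Tape (Γ 4) → Tape (Γ 4)
verdictT true  = mv (0F , mS)
verdictT false = mv (2F , mS)

mainCost : ℕ → ℕ → ℕ → ℕ
mainCost a L J = 3 + (5 + (powCost (D a) + ((J * suc (L * 254 + 1 + 33) + 1) + 2)))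

module _ (i : Tape (Γ 4)) (a m r : ℕ) where

  private
    L = m + suc r
    n = a + suc L
    c = candF a 0 L
    y = tally (length c ^ D a)
    K = killedBy a L m (m + r)

  main-state : Tape (Γ 4) → Tapes 4 11
  main-state cT = i ∷ posL (nz (tally (m + r))) [] ∷ blankT ∷ strT (ycells m 0 L) ∷ blankT ∷ cT ∷ blankT ∷ blankT ∷ blankT ∷ blankT ∷ blankT ∷ []

  cost-main : ∀ d s → s L.ʳ++ d ≡ c L.ʳ++ [] → length s ≤ n → ∃ λ rest →
    Cost (clock a L) (mainP a) (main-state (posR (nz d) (nz s))) (mainCost a L (m + r)) (verdictT K i ∷ rest)
  cost-main d s eq s≤ = _ ,
      within 3 (units₁ (≤-trans s≤ n≤β) β≥1) (run-onTape 5F _ refl (exec-scanR s d))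
    ▸ within 5 (≤-trans (≤-reflexive (cong (λ z → 2 * z + 3) (length-candF a 0 L))) (units 2 3 n≤β β≥1))
        (run-onTape 5F (main-state (posR (nz (s L.ʳ++ d)) [])) (cong (λ z → posR (nz z) []) eq) (exec-rewind c))
    ▸ cost-pow i (posL (nz (tally (m + r))) []) blankT (strT (ycells m 0 L)) blankT c blankT blankT blankT
        (≤-trans n≥1 (≤-reflexive (sym len-c))) (D a) (≤-reflexive (cong (_^ D a) len-c))
    ▸ subst (λ β → Cost β codesP (work-state a L m y y≡ n≤y i (code 0) (m + r) false) ((m + r) * suc (L * 254 + 1 + 33) + 1)
                                 (work-state a L m y y≡ n≤y i (code (m + r + 0)) 0 K)) y≡
        (subst (λ z → Cost (length y) codesP (work-state a L m y y≡ n≤y i (code 0) (m + r) false) ((m + r) * suc (L * 254 + 1 + 33) + 1)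
                                 (work-state a L m y y≡ n≤y i (code (m + r + 0)) 0 (killedBy a L m z))) (+-identityʳ (m + r))
          (cost-codes a L m y y≡ n≤y i 0 (m + r) (+-monoʳ-≤ m (n≤1+n r))))
    ▸ within 2 (scale 2 β≥1) (final K)
    where
      n≥1 : 1 ≤ n
      n≥1 = ≤-trans (s≤s z≤n) (m≤n+m (suc L) a)
      n≤β : n ≤ clock a L
      n≤β = n≤n^d n≥1 (D≥1 a)
      β≥1 : 1 ≤ clock a L
      β≥1 = ≤-trans n≥1 n≤β
      len-c : length c ≡ n
      len-c = length-candF a 0 L
      y≡ : length y ≡ clock a L
      y≡ = trans (Lₚ.length-replicate (length c ^ D a)) (cong (_^ D a) len-c)
      n≤y : n ≤ length y
      n≤y = ≤-trans n≤β (≤-reflexive (sym y≡))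
      final : ∀ κ → Exec (ifte (λ v → nonblank (V.lookup v 2F)) rejectP acceptP) (work-state a L m y y≡ n≤y i (code (m + r + 0)) 0 κ) 2
                         (verdictT κ i ∷ V.tail (work-state a L m y y≡ n≤y i (code (m + r + 0)) 0 κ))
      final true  = exec-then refl (run-onTape 0F _ refl (exec-act (λ _ → (0F , mS) ∷ []) _ {0}))
      final false = exec-else refl (run-onTape 0F _ refl (exec-act (λ _ → (2F , mS) ∷ []) _ {0}))

module _ (d₀ : List (Fin 7)) (a m r : ℕ) where

  private
    L = m + suc r
    c = candF a 0 L
    iT = posR (nz d₀) []
    K = killedBy a L m (m + r)

  level-string : ℕ → List (Fin 7)
  level-string k = replicate k 1F ++ 0F ∷ tally L

  dispatch-hit : ∀ i lev k d → lev + k ≡ a → k ≤ i → level-string k L.ʳ++ d ≡ c L.ʳ++ [] → length (level-string k) ≤ a + suc L → ∃ λ rest →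
    Exec (dispP i lev) (main-state iT a m r (posR (nz d) (nz (level-string k)))) (k * 2 + suc (mainCost a L (m + r) * clock a L)) (verdictT K iT ∷ rest)
  dispatch-hit zero lev zero d eq le eq′ len≤ with trans (sym (+-identityʳ lev)) eq
  ... | refl with cost-main iT a m r d (level-string 0) eq′ len≤
  ... | rest , x = rest , exec-else refl (Cost.run x)
  dispatch-hit (suc i) lev zero d eq le eq′ len≤ with trans (sym (+-identityʳ lev)) eq
  ... | refl with cost-main iT a m r d (level-string 0) eq′ len≤
  ... | rest , x = rest , exec-else refl (Cost.run x)
  dispatch-hit (suc i) lev (suc k) d eq (s≤s le) eq′ len≤
    with dispatch-hit i (suc lev) k (1F ∷ d) (trans (sym (+-suc lev k)) eq) le eq′ (≤-trans (n≤1+n _) len≤)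
  ... | rest , x = rest , exec-then refl (exec-seq (run-onTape 5F _ refl (exec-act opR _ {0})) x)

  dispatch-miss : ∀ i lev k d → i < k → ∃ λ s′ →
    Exec (dispP i lev) (main-state iT a m r (posR (nz d) (nz (level-string k)))) (i * 2 + 2) s′ × outS s′ ≡ []
  dispatch-miss zero    lev (suc k) d lt       = _ , exec-then refl (run-onTape 0F _ refl (exec-act (λ _ → (0F , mS) ∷ []) _ {0})) , refl
  dispatch-miss (suc i) lev (suc k) d (s≤s lt) with dispatch-miss i (suc lev) k (1F ∷ d) lt
  ... | s′ , x , out = s′ , exec-then refl (exec-seq (run-onTape 5F _ refl (exec-act opR _ {0})) x) , out

-- Correctness and running time of the decision procedure

inT-bits : ∀ {e} x → inT {4 + e} (bits x) ≡ posR [] (L.map (λ b → if b then 2F else 1F) x)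
inT-bits []      = refl
inT-bits (b ∷ x) = cong₂ (tape []) (sym-bit b) (trans (sym (Lₚ.map-∘ x)) (Lₚ.map-cong sym-bit x))
  where
    sym-bit : ∀ {e} b → sy {4 + e} (if b then i1 else i0) ≡ (if b then 2F else 1F)
    sym-bit false = refl
    sym-bit true  = refl

inT-bitsX : ∀ x → inT (bits x) ≡ posR [] (bitsX x)
inT-bitsX x = trans (inT-bits x) (cong (posR []) (trans (Lₚ.map-cong (λ { false → refl ; true → refl }) x) (Lₚ.map-∘ x)))

-- On other strings the output is empty and not the bit 0, since a string that does not survive may
-- still belong to A.
Decided : ℕ → Str → List ℕ → Set
Decided i x o = (o ≡ outBit true × Survivor i x) ⊎ (o ≡ [] × ¬ Survivor i x)

-- The summand 350 consists of 289 for the loops over codes and candidates, 11 for the rest of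
-- `mainCost`, and 50 for parsing and dispatching in linear time.
decideCost : ℕ → ℕ
decideCost i = powCost (D i) + 350

-- The exponent of the decision procedure: the clock n^(D i), times n for the candidates and once
-- more n for the codes.
E : ℕ → ℕ
E i = D i + 2

D-mono : ∀ {a i} → a ≤ i → D a ≤ D i
D-mono {zero}  {zero}  z≤n     = ≤-refl
D-mono {zero}  {suc i} z≤n     = ≤-trans (s≤s (s≤s z≤n)) (m≤n+m 20 (6 * D i))
D-mono {suc a} {suc i} (s≤s le) = +-monoˡ-≤ 20 (*-monoʳ-≤ 6 (D-mono le))

powCost-mono : ∀ {d d′} → d ≤ d′ → powCost d ≤ powCost d′
powCost-mono {zero}  {zero}   z≤n      = ≤-refl
powCost-mono {zero}  {suc d′} z≤n      = ≤-trans (powCost-mono {zero} {d′} z≤n) (m≤m+n _ 24)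
powCost-mono {suc d} {suc d′} (s≤s le) = +-monoˡ-≤ 24 (powCost-mono le)

^-monoˡ : ∀ {n d d′} → 1 ≤ n → d ≤ d′ → n ^ d ≤ n ^ d′
^-monoˡ {n} {zero} {d′} n≥1 z≤n = ^-≥1 d′ n≥1
^-monoˡ {n} n≥1 (s≤s le) = *-monoʳ-≤ n (^-monoˡ n≥1 le)

linear≤ : ∀ i n → 1 ≤ n → ∀ {τ k} → τ ≤ k * n → k ≤ 50 → τ ≤ decideCost i * n ^ E i
linear≤ i n n≥1 {τ} {k} le k≤ = ≤-trans le (*-mono-≤ (≤-trans k≤ (≤-trans (m≤m+n 50 300) (m≤n+m 350 (powCost (D i)))))
  (n≤n^d n≥1 (≤-trans (s≤s z≤n) (m≤n+m 2 (D i)))))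

main≤ : ∀ i a L J n τ → n ≡ a + suc L → J ≤ n → a ≤ i → τ ≤ 50 * n → τ + mainCost a L J * clock a L ≤ decideCost i * n ^ E i
main≤ i a L J n τ refl J≤ a≤ τ≤ = begin
  τ + mainCost a L J * n ^ D a
    ≤⟨ +-mono-≤ (≤-trans τ≤ (≤-trans (*-monoʳ-≤ 50 (n≤n^d n≥1 (≤-trans (s≤s z≤n) (m≤n+m 2 (D i))))) ≤-refl)) (*-mono-≤ cost≤ (^-monoˡ n≥1 (D-mono a≤))) ⟩
  50 * n ^ E i + (powCost (D i) + 300) * (n * n) * n ^ D i
    ≡⟨ cong (λ z → 50 * z + (powCost (D i) + 300) * (n * n) * n ^ D i) pow-eq ⟩
  50 * (n * n * n ^ D i) + (powCost (D i) + 300) * (n * n) * n ^ D i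
    ≡⟨ solve 3 (λ p q x → con 50 :* (q :* x) :+ (p :+ con 300) :* q :* x := (p :+ con 350) :* (q :* x)) refl (powCost (D i)) (n * n) (n ^ D i) ⟩
  decideCost i * (n * n * n ^ D i)
    ≡⟨ cong (decideCost i *_) (sym pow-eq) ⟩
  decideCost i * n ^ E i ∎
  where
    open ≤-Reasoning
    open +-*-Solver
    n≥1 : 1 ≤ n
    n≥1 = ≤-trans (s≤s z≤n) (m≤n+m (suc L) a)
    nn≥1 : 1 ≤ n * n
    nn≥1 = *-mono-≤ n≥1 n≥1
    pow-eq : n ^ E i ≡ n * n * n ^ D i
    pow-eq = trans (^-distribˡ-+-* n (D i) 2) (trans (*-comm (n ^ D i) (n ^ 2)) (cong (λ z → n * z * n ^ D i) (*-identityʳ n)))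
    inner : suc (L * 254 + 1 + 33) ≤ 289 * n
    inner = ≤-trans (≤-reflexive (solve 1 (λ l → con 1 :+ (l :* con 254 :+ con 1 :+ con 33) := con 254 :* l :+ con 35) refl L))
      (units 254 35 (≤-trans (n≤1+n L) (m≤n+m (suc L) a)) n≥1)
    cost≤ : mainCost a L J ≤ (powCost (D i) + 300) * (n * n)
    cost≤ = begin
      3 + (5 + (powCost (D a) + ((J * suc (L * 254 + 1 + 33) + 1) + 2)))
        ≤⟨ +-monoʳ-≤ 8 (+-mono-≤ (powCost-mono (D-mono a≤)) (+-monoˡ-≤ 2 (+-monoˡ-≤ 1 (*-mono-≤ J≤ inner)))) ⟩
      8 + (powCost (D i) + ((n * (289 * n) + 1) + 2))
        ≡⟨ solve 2 (λ p n → con 8 :+ (p :+ ((n :* (con 289 :* n) :+ con 1) :+ con 2)) := p :+ con 11 :+ con 289 :* (n :* n)) refl (powCost (D i)) n ⟩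
      powCost (D i) + 11 + 289 * (n * n)
        ≤⟨ +-monoˡ-≤ (289 * (n * n)) (scale (powCost (D i) + 11) nn≥1) ⟩
      (powCost (D i) + 11) * (n * n) + 289 * (n * n)
        ≡⟨ solve 2 (λ p q → (p :+ con 11) :* q :+ con 289 :* q := (p :+ con 300) :* q) refl (powCost (D i)) (n * n) ⟩
      (powCost (D i) + 300) * (n * n) ∎

record Outcome (i : ℕ) (x : Str) (s : Tapes 4 11) (τ : ℕ) : Set where
  constructor outcome
  field
    {final} : Tapes 4 11
    run     : Exec (decideP i) s τ final
    decided : Decided i x (outS final)

start-state : List Bool → Tapes 4 11
start-state x = parse-state (posR [] (bitsX x)) [] [] [] blankT

bitsX-++ : ∀ b n x → bitsX (replicate n b ++ x) ≡ nz (replicate n (bs b)) ++ bitsX x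
bitsX-++ b zero    x = refl
bitsX-++ b (suc n) x = cong (suc (bs b) ∷_) (bitsX-++ b n x)

bitsX-replicate : ∀ b n → bitsX (replicate n b) ≡ nz (replicate n (bs b)) ++ []
bitsX-replicate b n = trans (cong bitsX (sym (Lₚ.++-identityʳ (replicate n b)))) (bitsX-++ b n [])

respell : ∀ {p : Frag 4 11} {z z′ τ s′} → z ≡ z′ → Exec p (parse-state (posR [] z) [] [] [] blankT) τ s′ →
          Exec p (parse-state (posR [] z′) [] [] [] blankT) τ s′
respell refl x = x

good-entry : ∀ i a m r {t s′} → Exec (third a m r (prepareP (dispP i 0))) (state₃ a m r []) t s′ →
  Exec (decideP i) (start-state (candL a m (suc r))) (suc (2 * a) + suc (1 + (suc (2 * m) + suc (1 + (suc (2 * r) + t))))) s′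
good-entry i a m r z = respell
  (sym (trans (bitsX-++ true a _) (cong (λ v → nz (replicate a 1F) ++ 1F ∷ v) (trans (bitsX-++ true m _) (cong (λ v → nz (replicate m 1F) ++ 1F ∷ v) (bitsX-replicate false r))))))
  (through₁ a m r _ refl (through₂ a m r _ refl (through₃ a m r _ refl z)))

module GoodCase (i a m r : ℕ) (a≤L : a ≤ m + suc r) where

  private
    L = m + suc r
    c = candF a 0 L

  input : List (Fin 7)
  input = replicate r 0F L.ʳ++ (0F ∷ (replicate m 1F L.ʳ++ (0F ∷ (replicate a 1F L.ʳ++ []))))

  ready : Tape (Γ 4) → Tapes 4 11
  ready = main-state (posR (nz input) []) a m r

  run-third : ∀ {t s′} → Exec (dispP i 0) (ready (strT c)) t s′ →
    Exec (third a m r (prepareP (dispP i 0))) (state₃ a m r []) (1 + ((2 * L + 3) + ((2 * length c + 3) + (1 + t)))) s′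
  run-third {t} {s′} x = subst (λ z → Exec (third a m r (prepareP (dispP i 0))) z (1 + ((2 * L + 3) + ((2 * length c + 3) + (1 + t)))) s′)
    (sym (accept-level a m r (prepareP (dispP i 0)) a≤L))
    (exec-else refl (exec-seq (weakenR (≤-reflexive (cong (λ z → 2 * z + 3) (length-ycells m 0 L))) (run-onTape 3F _ refl (exec-rewind (ycells m 0 L))))
      (exec-seq (run-onTape 5F _ refl (exec-rewind c)) (exec-seq (run-onTape 1F _ refl (exec-act opL _ {0})) x))))

  entryCost : ℕ
  entryCost = suc (2 * a) + suc (1 + (suc (2 * m) + suc (1 + (suc (2 * r) + (1 + ((2 * L + 3) + ((2 * length c + 3) + 1)))))))

  entry≤ : ∀ n → n ≡ a + suc L → ∀ t → t ≤ a * 2 + 2 → entryCost + t ≤ 50 * n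
  entry≤ n refl t t≤ = begin
    entryCost + t           ≤⟨ +-monoʳ-≤ entryCost t≤ ⟩
    entryCost + (a * 2 + 2) ≡⟨ cong (λ z → suc (2 * a) + suc (1 + (suc (2 * m) + suc (1 + (suc (2 * r) + (1 + ((2 * L + 3) + ((2 * z + 3) + 1))))))) + (a * 2 + 2)) (length-candF a 0 L) ⟩
    suc (2 * a) + suc (1 + (suc (2 * m) + suc (1 + (suc (2 * r) + (1 + ((2 * L + 3) + ((2 * (a + suc L) + 3) + 1))))))) + (a * 2 + 2)
      ≤⟨ m≤m+n _ (2 * m + 2 * r) ⟩
    suc (2 * a) + suc (1 + (suc (2 * m) + suc (1 + (suc (2 * r) + (1 + ((2 * L + 3) + ((2 * (a + suc L) + 3) + 1))))))) + (a * 2 + 2) + (2 * m + 2 * r)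
      ≡⟨ solve 3 (λ a m r → (con 1 :+ con 2 :* a) :+ (con 1 :+ (con 1 :+ ((con 1 :+ con 2 :* m) :+ (con 1 :+ (con 1 :+ ((con 1 :+ con 2 :* r) :+ (con 1 :+
             ((con 2 :* (m :+ (con 1 :+ r)) :+ con 3) :+ ((con 2 :* (a :+ (con 1 :+ (m :+ (con 1 :+ r)))) :+ con 3) :+ con 1))))))))) :+ (a :* con 2 :+ con 2) :+ (con 2 :* m :+ con 2 :* r)
           := con 6 :* a :+ con 8 :* m :+ con 8 :* r :+ con 23) refl a m r ⟩
      6 * a + 8 * m + 8 * r + 23
      ≤⟨ m≤m+n _ (2 * a + 11) ⟩
      6 * a + 8 * m + 8 * r + 23 + (2 * a + 11)
      ≡⟨ solve 3 (λ a m r → con 6 :* a :+ con 8 :* m :+ con 8 :* r :+ con 23 :+ (con 2 :* a :+ con 11) := con 8 :* (a :+ (con 1 :+ (m :+ (con 1 :+ r)))) :+ con 18) refl a m r ⟩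
    8 * (a + suc L) + 18    ≤⟨ units 8 18 ≤-refl (≤-trans (s≤s z≤n) (m≤n+m (suc L) a)) ⟩
    26 * (a + suc L)        ≤⟨ *-monoˡ-≤ (a + suc L) (m≤m+n 26 24) ⟩
    50 * (a + suc L) ∎
    where
      open ≤-Reasoning
      open +-*-Solver

  private
    regroup : ∀ t → suc (2 * a) + suc (1 + (suc (2 * m) + suc (1 + (suc (2 * r) + (1 + ((2 * L + 3) + ((2 * length c + 3) + (1 + t)))))))) ≡ entryCost + t
    regroup t = solve 6 (λ A M R X Y t → (con 1 :+ A) :+ (con 1 :+ (con 1 :+ ((con 1 :+ M) :+ (con 1 :+ (con 1 :+ ((con 1 :+ R) :+ (con 1 :+ ((X :+ con 3) :+ ((Y :+ con 3) :+ (con 1 :+ t))))))))))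
        := (con 1 :+ A) :+ (con 1 :+ (con 1 :+ ((con 1 :+ M) :+ (con 1 :+ (con 1 :+ ((con 1 :+ R) :+ (con 1 :+ ((X :+ con 3) :+ ((Y :+ con 3) :+ con 1))))))))) :+ t)
      refl (2 * a) (2 * m) (2 * r) (2 * L) (2 * length c) t
      where open +-*-Solver

  run-good : ∀ {t s′} → Exec (dispP i 0) (ready (strT c)) t s′ → Exec (decideP i) (start-state (candL a m (suc r))) (entryCost + t) s′
  run-good {t} x = weakenR (≤-reflexive (regroup t)) (good-entry i a m r (run-third x))

decide-form : ∀ i x xs → Form xs → toList x ≡ xs → len x ≡ length xs → Outcome i x (start-state xs) (decideCost i * len x ^ E i)
decide-form i x _ (bad₁ a) eq len≡ = outcome
  (weakenR (linear≤ i (len x) (len≥1 x) bound (m≤m+n 5 45)) (respell (sym (bitsX-replicate true a))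
    (through₁ a 0 0 _ refl (reject₁ a 0 0 _))))
  (inj₂ (refl , not-ok i (trans (cong ok₀ eq) (ok-bad₁ a))))
  where
    bound : suc (2 * a) + 2 ≤ 5 * len x
    bound = ≤-trans (≤-reflexive (+-comm 1 (2 * a + 2))) (≤-trans (≤-reflexive (+-assoc (2 * a) 2 1)) (units 2 3 (≤-reflexive (sym (trans len≡ (Lₚ.length-replicate a)))) (len≥1 x)))
decide-form i x _ (bad₂ a m) eq len≡ = outcome
  (weakenR (linear≤ i (len x) (len≥1 x) bound (m≤m+n 10 40)) (respell
      (sym (trans (bitsX-++ true a _) (cong (λ z → nz (replicate a 1F) ++ 1F ∷ z) (bitsX-replicate true m))))
    (through₁ a m 0 _ refl (through₂ a m 0 _ refl (reject₂ a m 0 _)))))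
  (inj₂ (refl , not-ok i (trans (cong ok₀ eq) (ok-bad₂ a m))))
  where
    τ = suc (2 * a) + suc (1 + (suc (2 * m) + 2))
    n≡ : len x ≡ a + suc m
    n≡ = trans len≡ (trans (Lₚ.length-++ (replicate a true)) (cong₂ (λ p q → p + suc q) (Lₚ.length-replicate a) (Lₚ.length-replicate m)))
    bound : τ ≤ 10 * len x
    bound = ≤-trans (≤-trans (m≤m+n τ 2) (≤-reflexive (solve 2 (λ a m → (con 1 :+ con 2 :* a) :+ (con 1 :+ (con 1 :+ ((con 1 :+ con 2 :* m) :+ con 2))) :+ con 2
        := con 2 :* (a :+ (con 1 :+ m)) :+ con 6) refl a m)))
      (≤-trans (units 2 6 (≤-reflexive (sym n≡)) (len≥1 x)) (*-monoˡ-≤ (len x) (m≤m+n 8 2)))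
      where open +-*-Solver
decide-form i x _ (bad₃ a m r w) eq len≡ = outcome
  (weakenR (linear≤ i (len x) (len≥1 x) bound (m≤m+n 14 36)) (respell
      (sym (trans (bitsX-++ true a _) (cong (λ z → nz (replicate a 1F) ++ 1F ∷ z) (trans (bitsX-++ true m _) (cong (λ z → nz (replicate m 1F) ++ 1F ∷ z) (bitsX-++ false r _))))))
    (through₁ a m r _ refl (through₂ a m r _ refl (through₃ a m r _ refl (reject₃ a m r _ (bitsX w)))))))
  (inj₂ (refl , not-ok i (trans (cong ok₀ eq) (ok-bad₃ a m r w))))
  where
    τ = suc (2 * a) + suc (1 + (suc (2 * m) + suc (1 + (suc (2 * r) + 2))))
    n≡ : a + suc (m + suc (r + suc (length w))) ≡ len x
    n≡ = sym (trans len≡ (trans (Lₚ.length-++ (replicate a true)) (cong₂ (λ p q → p + suc q) (Lₚ.length-replicate a)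
          (trans (Lₚ.length-++ (replicate m true)) (cong₂ (λ p q → p + suc q) (Lₚ.length-replicate m)
            (trans (Lₚ.length-++ (replicate r false)) (cong (_+ suc (length w)) (Lₚ.length-replicate r))))))))
    bound : τ ≤ 14 * len x
    bound = ≤-trans (≤-trans (m≤m+n τ (3 + 2 * length w)) (≤-reflexive (solve 4 (λ a m r w →
        (con 1 :+ con 2 :* a) :+ (con 1 :+ (con 1 :+ ((con 1 :+ con 2 :* m) :+ (con 1 :+ (con 1 :+ ((con 1 :+ con 2 :* r) :+ con 2)))))) :+ (con 3 :+ con 2 :* w)
        := con 2 :* (a :+ (con 1 :+ (m :+ (con 1 :+ (r :+ (con 1 :+ w)))))) :+ con 6) refl a m r (length w))))
      (≤-trans (units 2 6 (≤-reflexive n≡) (len≥1 x)) (*-monoˡ-≤ (len x) (m≤m+n 8 6)))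
      where open +-*-Solver
decide-form i x _ (good a m r) eq len≡ with a ≤? m + suc r
... | no a≰L = outcome
  (weakenR (linear≤ i (len x) (len≥1 x) bound (m≤m+n 14 36)) (good-entry i a m r (reject-level a m r _ (≰⇒> a≰L))))
  (inj₂ (refl , λ { (survivor {a′} {m′} {r′} _ a≤L shape _) → case cand-injective a m r a′ m′ r′ (trans (sym eq) shape) of λ { (refl , refl , refl) → a≰L a≤L } }))
  where
    τ = suc (2 * a) + suc (1 + (suc (2 * m) + suc (1 + (suc (2 * r) + 2))))
    bound : τ ≤ 14 * len x
    bound = ≤-trans (≤-trans (m≤m+n τ 1) (≤-reflexive (solve 3 (λ a m r →
        (con 1 :+ con 2 :* a) :+ (con 1 :+ (con 1 :+ ((con 1 :+ con 2 :* m) :+ (con 1 :+ (con 1 :+ ((con 1 :+ con 2 :* r) :+ con 2)))))) :+ con 1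
        := con 2 :* (a :+ (con 1 :+ (m :+ (con 1 :+ r)))) :+ con 6) refl a m r)))
      (≤-trans (units 2 6 (≤-reflexive (sym (trans len≡ (length-candL a m (suc r))))) (len≥1 x)) (*-monoˡ-≤ (len x) (m≤m+n 8 6)))
      where open +-*-Solver
... | yes a≤L with a ≤? i
...   | no a≰i = let (s′ , run , out) = miss in outcome
  (weakenR (linear≤ i n (len≥1 x) {k = 50} bound (m≤m+n 50 0)) (run-good run))
  (inj₂ (out , λ { (survivor {a′} {m′} {r′} a≤i _ shape _) → case cand-injective a m r a′ m′ r′ (trans (sym eq) shape) of λ { (refl , refl , refl) → a≰i a≤i } }))
  where
    open GoodCase i a m r a≤L
    n = len x
    n≡ : n ≡ a + suc (m + suc r)
    n≡ = trans len≡ (length-candL a m (suc r))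
    miss : ∃ λ s′ → Exec (dispP i 0) (ready (strT (candF a 0 (m + suc r)))) (i * 2 + 2) s′ × outS s′ ≡ []
    miss = dispatch-miss _ a m r i 0 a [] (≰⇒> a≰i)
    bound : entryCost + (i * 2 + 2) ≤ 50 * n
    bound = ≤-trans (+-monoʳ-≤ entryCost (+-monoˡ-≤ 2 (*-monoˡ-≤ 2 (<⇒≤ (≰⇒> a≰i))))) (entry≤ n n≡ (a * 2 + 2) ≤-refl)
...   | yes a≤i with dispatch-hit _ a m r i 0 a [] refl a≤i refl (≤-reflexive (length-candF a 0 (m + suc r)))
...     | rest , run = outcome (weakenR bound (run-good run)) (verdict-of (killedBy a (m + suc r) m (m + r)) refl)
  where
    open GoodCase i a m r a≤L
    n = len x
    n≡ : n ≡ a + suc (m + suc r)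
    n≡ = trans len≡ (length-candL a m (suc r))
    bound : entryCost + (a * 2 + suc (mainCost a (m + suc r) (m + r) * clock a (m + suc r))) ≤ decideCost i * n ^ E i
    bound = ≤-trans (≤-reflexive (trans (cong (entryCost +_) (trans (+-suc (a * 2) M) (cong suc refl))) (sym (+-assoc entryCost (suc (a * 2)) M))))
      (main≤ i a (m + suc r) (m + r) n (entryCost + suc (a * 2)) n≡ J≤ a≤i (entry≤ n n≡ (suc (a * 2)) (≤-trans (≤-reflexive (+-comm 1 (a * 2))) (+-monoʳ-≤ (a * 2) (s≤s z≤n)))))
      where
        M = mainCost a (m + suc r) (m + r) * clock a (m + suc r)
        J≤ : m + r ≤ n
        J≤ = ≤-trans (+-monoʳ-≤ m (n≤1+n r)) (≤-trans (≤-trans (n≤1+n _) (m≤n+m (suc (m + suc r)) a)) (≤-reflexive (sym n≡)))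
    verdict-of : ∀ κ → killedBy a (m + suc r) m (m + r) ≡ κ → Decided i x (outT (verdictT κ (posR (nz input) [])))
    verdict-of true  keq = inj₂ (refl , λ { (survivor {a′} {m′} {r′} _ _ shape alive) →
      case cand-injective a m r a′ m′ r′ (trans (sym eq) shape) of λ { (refl , refl , refl) → contradiction (trans (sym keq) alive) λ () } })
    verdict-of false keq = inj₁ (refl , survivor a≤i a≤L eq keq)

decide : ∀ i x → ∃ λ o → HaltsWithin (toTM (decideP i)) (strIn x) (decideCost i * len x ^ E i) o × Decided i x o
decide i x@(b ∷ bs′) with decide-form i x (toList x) (form (toList x)) refl refl
... | outcome {s′} run decided = outS s′ ,
  toTM-halts {p = decideP i} {w = strIn x} (subst (λ t → Exec (decideP i) (t ∷ V.replicate 10 blankT) (decideCost i * len x ^ E i) s′) (sym (inT-bitsX (toList x))) run) , decided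

-- The set

Survives : Str → Set
Survives x = ∃ λ i → Survivor i x

-- A candidate is longer than its level. So the single procedure with i = |x| decides whether `x`
-- survives at any level at all.
level≤len : ∀ {i x} → Survivor i x → Survivor (len x) x
level≤len {x = x@(_ ∷ _)} (survivor {a} {m} {r} _ a≤L shape alive) = survivor
  (≤-trans (m≤m+n a (suc (m + suc r))) (≤-reflexive (sym (trans (cong length shape) (length-candL a m (suc r)))))) a≤L shape alive

-- Unfolding this procedure, which runs a Turing machine, would be very slow.
abstract
  survives? : ∀ x → Dec (Survives x)
  survives? x with decide (len x) x
  ... | _ , _ , inj₁ (_ , s)  = yes (len x , s)
  ... | _ , _ , inj₂ (_ , ¬s) = no λ (i , s) → ¬s (level≤len s)

-- Strings are numbered in the same way as codes. Numbers with digits other than 0 and 1 stand for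
-- no string, and nothing happens at such stages.
stage : Str → ℕ
stage x = number (L.map bs (toList x))

unbits : List (Fin 7) → Maybe (List Bool)
unbits []       = just []
unbits (0F ∷ l) = M.map (false ∷_) (unbits l)
unbits (1F ∷ l) = M.map (true ∷_) (unbits l)
unbits (_ ∷ l)  = nothing

unbits-bits : ∀ x → unbits (L.map bs x) ≡ just x
unbits-bits []          = refl
unbits-bits (false ∷ x) = cong (M.map (false ∷_)) (unbits-bits x)
unbits-bits (true ∷ x)  = cong (M.map (true ∷_)) (unbits-bits x)

bits-unbits : ∀ l {x} → unbits l ≡ just x → L.map bs x ≡ l
bits-unbits [] refl = refl
bits-unbits (0F ∷ l) eq with unbits l in eq′
bits-unbits (0F ∷ l) refl | just x = cong (0F ∷_) (bits-unbits l eq′)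
bits-unbits (1F ∷ l) eq with unbits l in eq′
bits-unbits (1F ∷ l) refl | just x = cong (1F ∷_) (bits-unbits l eq′)

nonempty : List Bool → Maybe Str
nonempty []      = nothing
nonempty (b ∷ x) = just (b ∷ x)

str : ℕ → Maybe Str
str s = M.maybe nonempty nothing (unbits (code s))

str-stage : ∀ x → str (stage x) ≡ just x
str-stage (b ∷ x) = trans (cong (M.maybe nonempty nothing) (trans (cong unbits (code-number (L.map bs (b ∷ x)))) (unbits-bits (b ∷ x)))) refl

stage-str : ∀ s {x} → str s ≡ just x → stage x ≡ s
stage-str s eq with unbits (code s) in eq′
stage-str s refl | just (b ∷ x) = trans (cong number (bits-unbits (code s) eq′)) (number-code s)

-- At stage s only the codes up to s are searched. By this bound every code is among them for all
-- sufficiently long strings.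
len≤stage : ∀ x → len x ≤ stage x
len≤stage (b ∷ x) = go′ (b ∷ x)
  where
    go′ : ∀ x → length x ≤ number (L.map bs x)
    go′ []      = z≤n
    go′ (b ∷ x) = s≤s (≤-trans (go′ x) (≤-trans (m≤m+n _ (6 * number (L.map bs x))) (m≤n+m _ (toℕ (bs b)))))

findLeast : (ℕ → Bool) → ℕ → Maybe ℕ
findLeast P zero    = nothing
findLeast P (suc n) = maybe just (if P n then just n else nothing) (findLeast P n)

findLeast-sound : ∀ P n {e} → findLeast P n ≡ just e → P e ≡ true
findLeast-sound P (suc n) eq with findLeast P n in eq′
findLeast-sound P (suc n) refl | just e = findLeast-sound P n eq′
findLeast-sound P (suc n) eq   | nothing with P n in pn
findLeast-sound P (suc n) refl | nothing | true = pn

findLeast-complete : ∀ P n {e} → e < n → P e ≡ true → ∃ λ e′ → e′ ≤ e × findLeast P n ≡ just e′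
findLeast-complete P (suc n) {e} (s≤s e≤n) pe with findLeast P n in eq
... | just e′ with ≤⇒≤′ e≤n
...   | ≤′-refl = e′ , <⇒≤ (found< n eq) , refl
  where
    found< : ∀ n {e} → findLeast P n ≡ just e → e < n
    found< (suc n) eq with findLeast P n in eq′
    found< (suc n) refl | just e = m≤n⇒m≤1+n (found< n eq′)
    found< (suc n) eq   | nothing with P n
    found< (suc n) refl | nothing | true = ≤-refl
...   | ≤′-step le with findLeast-complete P n (s≤s (≤′⇒≤ le)) pe
...     | e″ , le′ , eq″ with trans (sym eq) eq″
...       | refl = e″ , le′ , refl
findLeast-complete P (suc n) {e} (s≤s e≤n) pe | nothing with ≤⇒≤′ e≤n
... | ≤′-refl rewrite pe = e , ≤-refl , refl
... | ≤′-step le with findLeast-complete P n (s≤s (≤′⇒≤ le)) pe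
...   | e″ , le′ , eq″ = contradiction (trans (sym eq) eq″) λ ()

-- The clock n^n exceeds every polynomial, so a machine with polynomial running time is simulated to
-- its end on all long inputs. There are no guesses on survivors, since their membership in A is
-- already fixed.
guess : ℕ → Str → Maybe Bool
guess e x = if does (survives? x) then nothing else answer (toList x) (code e) (len x ^ len x)

guessAt : ℕ → ℕ → Maybe Bool
guessAt e s = M.maybe (guess e) nothing (str s)

wants : (ℕ → Bool) → ℕ → ℕ → Bool
wants σ s e = not (σ e) ∧ isJust (guessAt e s)

-- The least code which has not acted yet and guesses the string of stage s acts by making its guess wrong.
acted : ℕ → ℕ → Bool
actor : ℕ → Maybe ℕ
acted zero    e = false
acted (suc s) e = acted s e ∨ eqMaybe (actor s) e
actor s = findLeast (wants (acted s) s) (suc s)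

-- A guess 0 is refuted by putting the string into A. A guess 1 is refuted by doing nothing, because
-- a string that does not survive has no other way into A.
A : Str → Set
A x = Survives x ⊎ (∃ λ e → actor (stage x) ≡ just e × guessAt e (stage x) ≡ just false)

guessAt-stage : ∀ e x → guessAt e (stage x) ≡ guess e x
guessAt-stage e x = cong (M.maybe (guess e) nothing) (str-stage x)

isJust-just : ∀ {A : Set} (x : Maybe A) → isJust x ≡ true → ∃ λ a → x ≡ just a
isJust-just (just a) _ = a , refl

∧-true : ∀ {a b} → a ∧ b ≡ true → a ≡ true × b ≡ true
∧-true {true} {true} _ = refl , refl

actor-guess : ∀ s {e} → actor s ≡ just e → acted s e ≡ false × ∃ λ b → guessAt e s ≡ just b
actor-guess s {e} eq with ∧-true {not (acted s e)} (findLeast-sound (wants (acted s) s) (suc s) eq)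
... | na , j = not-true na , isJust-just _ j
  where
    not-true : ∀ {b} → not b ≡ true → b ≡ false
    not-true {false} _ = refl

guessAt-string : ∀ e s {b} → guessAt e s ≡ just b → ∃ λ x → stage x ≡ s × ¬ Survives x × answer (toList x) (code e) (len x ^ len x) ≡ just b
guessAt-string e s eq with str s in str-eq
... | just x with survives? x
...   | no ¬p = x , stage-str s str-eq , ¬p , eq

guess-string : ∀ e x {b} → ¬ Survives x → answer (toList x) (code e) (len x ^ len x) ≡ just b → guess e x ≡ just b
guess-string e x ¬p eq with survives? x
... | yes p = contradiction p ¬p
... | no  _ = eq

acted-mono : ∀ {s s′ e} → s ≤ s′ → acted s e ≡ true → acted s′ e ≡ true
acted-mono {s} {s′} {e} le eq = go′ (≤⇒≤′ le)
  where
    go′ : ∀ {s′} → s ≤′ s′ → acted s′ e ≡ true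
    go′ ≤′-refl      = eq
    go′ (≤′-step le) rewrite go′ le = refl

≡ᵇ-refl : ∀ n → (n ≡ᵇ n) ≡ true
≡ᵇ-refl zero    = refl
≡ᵇ-refl (suc n) = ≡ᵇ-refl n

∨-trueʳ : ∀ a {b} → b ≡ true → a ∨ b ≡ true
∨-trueʳ true  _    = refl
∨-trueʳ false refl = refl

actor-acted : ∀ s {e} → actor s ≡ just e → acted (suc s) e ≡ true
actor-acted s {e} eq = ∨-trueʳ (acted s e) (trans (cong (λ z → eqMaybe z e) eq) (≡ᵇ-refl e))

acts-once : ∀ {s s′ e} → s < s′ → actor s ≡ just e → actor s′ ≢ just e
acts-once {s} {s′} lt eq eq′ = contradiction (trans (sym (acted-mono lt (actor-acted s eq))) (proj₁ (actor-guess s′ eq′))) λ ()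

-- Each code acts at most once, so the finitely many codes below n stop acting. Whether a given code
-- ever acts is a nonconstructive case distinction; this is where the double negation comes from.
eventually-silent : ∀ n → ¬ ¬ (∃ λ s₀ → ∀ s e → s₀ ≤ s → e < n → actor s ≢ just e)
eventually-silent zero    k = k (0 , λ s e _ ())
eventually-silent (suc n) k = eventually-silent n λ (s₀ , silent) →
  let never : ¬ (∃ λ s → actor s ≡ just n)
      never = λ (s₁ , eq) → k (s₀ ⊔ suc s₁ , λ s e le e<
        → [ (λ lt → silent s e (≤-trans (m≤m⊔n s₀ (suc s₁)) le) lt) , (λ { refl → acts-once (≤-trans (m≤n⊔m s₀ (suc s₁)) le) eq }) ]′ (m<1+n⇒m<n∨m≡n e<))
  in k (s₀ , λ s e le e< → [ silent s e le , (λ { refl eq → never (s , eq) }) ]′ (m<1+n⇒m<n∨m≡n e<))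

-- Machines that are correct on A

^-distrib-3 : ∀ n c → n ^ suc c * n ^ suc c * n ^ suc c ≡ n ^ (3 * suc c)
^-distrib-3 n c = begin
  n ^ suc c * n ^ suc c * n ^ suc c       ≡⟨ cong (_* n ^ suc c) (sym (^-distribˡ-+-* n (suc c) (suc c))) ⟩
  n ^ (suc c + suc c) * n ^ suc c         ≡⟨ sym (^-distribˡ-+-* n (suc c + suc c) (suc c)) ⟩
  n ^ (suc c + suc c + suc c)             ≡⟨ cong (n ^_) (solve 1 (λ c → c :+ c :+ c := con 3 :* c) refl (suc c)) ⟩
  n ^ (3 * suc c) ∎
  where
    open ≡-Reasoning
    open +-*-Solver

-- As soon as n is at least K, the constant K is absorbed by one more factor n. This is the outer
-- `suc` in the condition on the exponent.
clock-large : ∀ K n c d → K ≤ n → 1 ≤ n → suc (3 * suc c) ≤ d → let N = n ^ suc c in K * (N * N * N) ≤ n ^ d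
clock-large K n c d K≤ n≥1 le = ≤-trans (*-mono-≤ K≤ (≤-reflexive (^-distrib-3 n c))) (^-monoˡ n≥1 le)

ustep-answered : ∀ u {b} → uanswer u ≡ just b → ustep u ≡ u
ustep-answered (6F , tape _ _ _ , tape _ _ _) _ = refl
ustep-answered (7F , tape _ _ _ , tape _ _ _) _ = refl

usteps-final : ∀ t t′ {u₀ u} → usteps t′ u₀ ≡ u → ustep u ≡ u → t′ ≤ t → usteps t u₀ ≡ u
usteps-final t t′ {u₀} run fix le = trans (cong (λ n → usteps n u₀) (sym (m+[n∸m]≡n le)))
  (trans (usteps-+ t′ (t ∸ t′) u₀) (trans (cong (usteps (t ∸ t′)) run) (usteps-fix fix (t ∸ t′))))

-- A configuration with an answer is a fixed point too. So both runs have arrived at the same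
-- configuration, whichever of t and t′ is larger.
answer-final : ∀ t t′ {u₀ u b} → usteps t′ u₀ ≡ u → ustep u ≡ u → uanswer (usteps t u₀) ≡ just b → uanswer u ≡ just b
answer-final t t′ {u₀} run fix eq with ≤-total t t′
... | inj₁ le = trans (cong uanswer (trans (sym run) (usteps-final t′ t refl (ustep-answered (usteps t u₀) eq) le))) eq
... | inj₂ le = trans (cong uanswer (sym (usteps-final t t′ run fix le))) eq

lastAcc-accepts : ∀ e a L n {k} → lastAcc e a L n ≡ just k → k < n × accepts e a L k ≡ true
lastAcc-accepts e a L (suc n) eq with accepts e a L n in acc
lastAcc-accepts e a L (suc n) refl | true  = ≤-refl , acc
lastAcc-accepts e a L (suc n) eq   | false = map₁ m≤n⇒m≤1+n (lastAcc-accepts e a L n eq)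

lastAcc-exists : ∀ e a L n {k} → k < n → accepts e a L k ≡ true → ∃ λ k′ → lastAcc e a L n ≡ just k′
lastAcc-exists e a L (suc n) {k} (s≤s k≤n) acc with accepts e a L n in acc′
... | true  = n , refl
... | false with m≤n⇒m<n∨m≡n k≤n
...   | inj₁ lt   = lastAcc-exists e a L n lt acc
...   | inj₂ refl = contradiction (trans (sym acc) acc′) λ ()

killedBy-true : ∀ a L m J {j} → j < J → lastAcc (code j) a L L ≡ just m → killedBy a L m J ≡ true
killedBy-true a L m (suc J) {j} (s≤s j≤J) eq with m≤n⇒m<n∨m≡n j≤J
... | inj₁ lt   = ∨-trueʳ _ (killedBy-true a L m J lt eq)
... | inj₂ refl rewrite eq | ≡ᵇ-refl m = refl

killedBy-code : ∀ a L m J → killedBy a L m J ≡ true → ∃ λ j → j < J × lastAcc (code j) a L L ≡ just m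
killedBy-code a L m (suc J) eq with lastAcc (code J) a L L in eq′
... | nothing = let (j , lt , e) = killedBy-code a L m J eq in j , m≤n⇒m≤1+n lt , e
... | just k with k ≡ᵇ m in km
...   | true  = J , ≤-refl , trans eq′ (cong just (≡ᵇ⇒≡ k m (subst T (sym km) tt)))
...   | false = let (j , lt , e) = killedBy-code a L m J eq in j , m≤n⇒m≤1+n lt , e

cand : ℕ → ℕ → ℕ → Str
cand zero    m r = false ∷ (replicate m true ++ replicate r false)
cand (suc a) m r = true ∷ candL a m r

cand-list : ∀ a m r → toList (cand a m r) ≡ candL a m r
cand-list zero    m r = refl
cand-list (suc a) m r = refl

len-cand : ∀ a m r → len (cand a m r) ≡ a + suc (m + r)
len-cand a m r = trans (length-toList (cand a m r)) (trans (cong length (cand-list a m r)) (length-candL a m r))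

module Honest (M : TM) (inp : Str → List InSym) (c K e₀ : ℕ)
              (total : ∀ x → ∃ λ o → Halts M (inp x) o) (correct : PartialDecidesVia A M inp)
              (sim : ∀ x o → Halts M (inp x) o →
                ∃ λ u → (ucfg (toList x) (code e₀) ⇝⟨ K * (len x ^ suc c * len x ^ suc c * len x ^ suc c) ⟩ u) × Halted u (bitOf o)) where

  answer-sound : ∀ x t {b} → answer (toList x) (code e₀) t ≡ just b → Halts M (inp x) (outBit b)
  answer-sound x t {b} eq =
    let (o , h) = total x
        (u , (t′ , _ , run) , fix , out) = sim x o h
    in subst (Halts M (inp x)) (outBit-bitOf o (trans (sym out) (answer-final t t′ run fix eq))) h

  answer-complete : ∀ x t {b} → Halts M (inp x) (outBit b) → (let N = len x ^ suc c in K * (N * N * N) ≤ t) →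
                    answer (toList x) (code e₀) t ≡ just b
  answer-complete x t {b} h le =
    let (u , (t′ , t′≤ , run) , fix , out) = sim x (outBit b) h
    in trans (cong uanswer (usteps-final t t′ run fix (≤-trans t′≤ le))) (trans out (bitOf-outBit b))

  -- If the answer is 0, then `x` is in A because of this very guess. If it is 1, then correctness
  -- puts `x` into A; but without surviving it could be there only by a guess 0 of the actor of its
  -- stage, which is `e₀` itself.
  refuted : ∀ b x → ¬ Survives x → actor (stage x) ≡ just e₀ → guessAt e₀ (stage x) ≡ just b → Halts M (inp x) (outBit b) → ⊥
  refuted false x ¬surv eq geq h = proj₂ (correct x) h (inj₂ (e₀ , eq , geq))
  refuted true  x ¬surv eq geq h with proj₁ (correct x) h
  ... | inj₁ surv             = ¬surv surv
  ... | inj₂ (e , eq′ , geq′) with trans (sym eq) eq′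
  ...   | refl = contradiction (trans (sym geq) geq′) λ ()

  never-acts : ∀ s → actor s ≢ just e₀
  never-acts s eq =
    let (_ , b , geq) = actor-guess s eq
        (x , st , ¬surv , out) = guessAt-string e₀ s geq
    in refuted b x ¬surv (trans (cong actor st) eq) (trans (cong (guessAt e₀) st) geq) (answer-sound x (len x ^ len x) out)

  not-acted : ∀ s → acted s e₀ ≡ false
  not-acted zero    = refl
  not-acted (suc s) rewrite not-acted s = other (actor s) refl
    where
      other : ∀ z → actor s ≡ z → eqMaybe z e₀ ≡ false
      other nothing  _  = refl
      other (just e) eq with e ≡ᵇ e₀ in ee
      ... | false = refl
      ... | true  = contradiction (trans eq (cong just (≡ᵇ⇒≡ e e₀ (subst T (sym ee) tt)))) (never-acts s)

  -- On a long string outside of all slices, an answer of M makes `e₀` want to act, since it has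
  -- never acted before. Hence some code up to `e₀` acts at this stage. Smaller codes have become
  -- silent, and `e₀` cannot act because M is correct.
  outside-bounded : ¬ ¬ (∃ λ n₀ → ∀ x → DomVia M inp x → ¬ Survives x → len x < n₀)
  -- The summands ensure, in turn, that the smaller codes are silent, that `e₀` is searched at the
  -- stage of `x`, that K is at most the length n, and that the clock n^n suffices for the
  -- simulation.
  outside-bounded k = eventually-silent e₀ λ (s₀ , silent) → k (suc (s₀ + e₀ + K + suc (3 * suc c)) , λ x (b , h) ¬surv →
    s≤s (≮⇒≥ λ lt → impossible s₀ silent x b h ¬surv (<⇒≤ lt)))
    where
      impossible : ∀ s₀ → (∀ s e → s₀ ≤ s → e < e₀ → actor s ≢ just e) → ∀ x b → Halts M (inp x) (outBit b) → ¬ Survives x →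
                   s₀ + e₀ + K + suc (3 * suc c) ≤ len x → ⊥
      impossible s₀ silent x b h ¬surv le with findLeast-complete (wants (acted s) s) (suc s) (s≤s e₀≤s) wanted
        where
          s = stage x
          e₀≤s : e₀ ≤ s
          e₀≤s = ≤-trans (≤-trans (≤-trans (≤-trans (m≤n+m e₀ s₀) (m≤m+n _ K)) (m≤m+n _ _)) le) (len≤stage x)
          K≤ : K ≤ len x
          K≤ = ≤-trans (≤-trans (m≤n+m K (s₀ + e₀)) (m≤m+n _ _)) le
          guessed : guessAt e₀ s ≡ just b
          guessed = trans (guessAt-stage e₀ x) (guess-string e₀ x ¬surv
            (answer-complete x (len x ^ len x) h (clock-large K (len x) c (len x) K≤ (len≥1 x) (≤-trans (m≤n+m _ (s₀ + e₀ + K)) le))))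
          wanted : wants (acted s) s e₀ ≡ true
          wanted rewrite not-acted s | guessed = refl
      ... | e′ , e′≤ , eq with m≤n⇒m<n∨m≡n e′≤
      ...   | inj₁ lt   = silent (stage x) e′ (≤-trans (≤-trans (≤-trans (m≤m+n s₀ (e₀ + K)) (≤-reflexive (sym (+-assoc s₀ e₀ K)))) (≤-trans (m≤m+n _ _) le)) (len≤stage x)) lt eq
      ...   | inj₂ refl = never-acts (stage x) eq

  -- The candidate for whose exclusion e₀ is responsible lies outside all slices.
  excluded : ∀ n₀ → (∀ x → DomVia M inp x → ¬ Survives x → len x < n₀) → ∀ a m r → e₀ < m + r →
    lastAcc (code e₀) a (m + suc r) (m + suc r) ≡ just m → n₀ ≤ a + suc (m + suc r) → ⊥
  excluded n₀ out a m r e₀< last n₀≤ = <⇒≱ (out x dom dead′) (≤-trans n₀≤ (≤-reflexive (sym (len-cand a m (suc r)))))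
    where
      x : Str
      x = cand a m (suc r)
      dead′ : ¬ Survives x
      dead′ (_ , survivor {a′} {m′} {r′} _ _ shape alive) = same (cand-injective a m r a′ m′ r′ (trans (sym (cand-list a m (suc r))) shape)) alive
        where
          same : ∀ {a′ m′ r′} → a ≡ a′ × m ≡ m′ × r ≡ r′ → killedBy a′ (m′ + suc r′) m′ (m′ + r′) ≡ false → ⊥
          same (refl , refl , refl) alive = contradiction (trans (sym alive) (killedBy-true a (m + suc r) m (m + r) e₀< last)) λ ()
      dom : DomVia M inp x
      dom = let (b , eq) = isJust-just (answer (candL a m (m + suc r ∸ m)) (code e₀) (clock a (m + suc r)))
                             (proj₂ (lastAcc-accepts (code e₀) a (m + suc r) (m + suc r) last))
            in b , answer-sound x (clock a (m + suc r)) (trans (cong (λ l → answer l (code e₀) (clock a (m + suc r)))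
                     (trans (cand-list a m (suc r)) (cong (candL a m) (sym (m+n∸m≡n m (suc r)))))) eq)

  accepted : ∀ i x b a m r → c ≤ E i → i < a → toList x ≡ candL a m (suc r) → len x ≡ a + suc (m + suc r) → K ≤ len x →
    Halts M (inp x) (outBit b) → accepts (code e₀) a (m + suc r) m ≡ true
  accepted i x b a m r c≤ i<a shape n≡ K≤ h =
    trans (cong₂ (λ l t → isJust (answer l (code e₀) t)) (trans (cong (candL a m) (m+n∸m≡n m (suc r))) (sym shape)) (cong (_^ D a) (sym n≡)))
          (cong isJust (answer-complete x (len x ^ D a) h (clock-large K (len x) c (D a) K≤ (len≥1 x) D≥)))
    where
      D≥ : suc (3 * suc c) ≤ D a
      -- With c at most D i + 2 the simulation needs the exponent 1 + 3 (c + 1), which is at most 3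
      -- D i + 10; this is half of D (i + 1) = 6 D i + 20.
      D≥ = ≤-trans (s≤s (*-monoʳ-≤ 3 (s≤s c≤))) (≤-trans (≤-trans (m≤m+n _ (3 * D i + 10))
        (≤-reflexive (solve 1 (λ q → (con 1 :+ con 3 :* (con 1 :+ (q :+ con 2))) :+ (con 3 :* q :+ con 10) := con 6 :* q :+ con 20) refl (D i)))) (D-mono i<a))
        where open +-*-Solver

  -- Since a is at most L, the length a + 1 + L is at most 2 L + 1. A length of at least 2 (e₀ + 3)
  -- therefore forces L - 1 > e₀, so that `e₀` is among the codes that exclude a candidate.
  many : ∀ n₀ a L → a ≤ L → n₀ + K + 2 * (e₀ + 3) ≤ a + suc L → suc (suc e₀) ≤ L
  many n₀ a L a≤L le = ≮⇒≥ λ lt → <⇒≱ (≤-trans (s≤s (+-mono-≤ (≤-trans a≤L (<⇒≤ lt)) lt))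
      (≤-reflexive (solve 1 (λ e → con 1 :+ ((con 2 :+ e) :+ (con 2 :+ e)) := con 1 :+ (con 2 :* e :+ con 4)) refl e₀)))
    (≤-trans (≤-trans (m≤m+n (suc (2 * e₀ + 4)) 1) (≤-reflexive (solve 1 (λ e → (con 1 :+ (con 2 :* e :+ con 4)) :+ con 1 := con 2 :* (e :+ con 3)) refl e₀)))
      (≤-trans (m≤n+m _ (n₀ + K)) le))
    where open +-*-Solver

  -- The level of `x` exceeds i, so its clock is long enough for `e₀` to accept `x`. Then `e₀`
  -- excludes a candidate with the same a and L, possibly another one than `x`. That candidate is as
  -- long as `x`, lies outside of all slices, and M answers on it, which contradicts `out`.
  bounded : ∀ i n₀ → c ≤ E i → (∀ x → DomVia M inp x → ¬ Survives x → len x < n₀) →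
    ∀ x → DomVia M inp x → ¬ Survivor i x → Survives x → n₀ + K + 2 * (e₀ + 3) ≤ len x → ⊥
  bounded i n₀ c≤ out x (b , h) ¬surv (j , survivor {a} {m} {r} a≤j a≤L shape alive) le =
    let (k , last) = lastAcc-exists (code e₀) a L L (m<m+n m (s≤s z≤n))
                       (accepted i x b a m r c≤ (≰⇒> λ a≤i → ¬surv (survivor a≤i a≤L shape alive)) shape n≡ (≤-trans (≤-trans (m≤n+m K n₀) (m≤m+n _ _)) le) h)
    in at-last k last (proj₁ (lastAcc-accepts (code e₀) a L L last))
    where
      L = m + suc r
      n≡ : len x ≡ a + suc L
      n≡ = trans (length-toList x) (trans (cong length shape) (length-candL a m (suc r)))
      at-last : ∀ k → lastAcc (code e₀) a L L ≡ just k → k < L → ⊥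
      at-last k last k<L = excluded n₀ out a k (L ∸ suc k)
        (≤-pred (≤-trans (many n₀ a L a≤L (≤-trans le (≤-reflexive n≡))) (≤-reflexive (trans (sym L≡) (+-suc k (L ∸ suc k))))))
        (trans (cong (λ z → lastAcc (code e₀) a z z) L≡) last)
        (≤-trans (≤-trans (m≤m+n n₀ K) (m≤m+n _ _)) (≤-trans le (≤-reflexive (trans n≡ (cong (λ z → a + suc z) (sym L≡))))))
        where
          L≡ : k + suc (L ∸ suc k) ≡ L
          L≡ = trans (+-suc k (L ∸ suc k)) (m+[n∸m]≡n k<L)

  -- Strings outside of all slices are bounded by n₀, those which survive only above level i by
  -- `bounded`. In the sum, K serves the clock and 2 (e₀ + 3) serves `many`.
  almost-inside : ∀ i → c ≤ E i → ¬ ¬ (∃ λ n₀ → ∀ x → DomVia M inp x → ¬ Survivor i x → len x < n₀)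
  almost-inside i c≤ k = outside-bounded λ (n₀ , out) → k (n₀ + K + 2 * (e₀ + 3) , λ x dom ¬surv → case survives? x of λ where
      (no ¬s) → ≤-trans (out x dom ¬s) (≤-trans (m≤m+n n₀ K) (m≤m+n _ _))
      (yes s) → ≰⇒> (bounded i n₀ c≤ out x dom ¬surv s))

-- The prefix `w` covers both applications: it is empty for a P-approximation, and it is the encoded
-- parameter with the separator for one slice of a parameterization.
slice-bounded : ∀ M w inp → (∀ x → inp x ≡ w ++ strIn x) → ∀ c d → (∀ x → ∃ λ o → HaltsWithin M (inp x) (d * len x ^ c) o) →
  PartialDecidesVia A M inp → ∀ i → c ≤ E i → ¬ ¬ (∃ λ n₀ → ∀ x → DomVia M inp x → ¬ Survivor i x → len x < n₀)
slice-bounded M w inp inp≡ c d total correct =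
  let (rows , K , sim) = table-for M w c d (λ x → subst (λ v → ∃ λ o → HaltsWithin M v (d * len x ^ c) o) (inp≡ x) (total x))
  in Honest.almost-inside M inp c K (number (table rows)) (λ x → let (o , h) = total x in o , _ , h) correct
       λ x o h → subst (λ e → ∃ λ u → (ucfg (toList x) e ⇝⟨ K * (len x ^ suc c * len x ^ suc c * len x ^ suc c) ⟩ u) × Halted u (bitOf o))
         (sym (code-number (table rows))) (sim x o (subst (λ v → Halts M v o) (inp≡ x) h))

-- Slices

lists≤ : ℕ → List (List Bool)
lists≤ zero    = [] ∷ []
lists≤ (suc n) = [] ∷ L.cartesianProductWith _∷_ (false ∷ true ∷ []) (lists≤ n)

bools∈ : ∀ b → b ∈ false ∷ true ∷ []
bools∈ false = here refl
bools∈ true  = there (here refl)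

lists≤∈ : ∀ n x → length x ≤ n → x ∈ lists≤ n
lists≤∈ zero    []      _        = here refl
lists≤∈ (suc n) []      _        = here refl
lists≤∈ (suc n) (b ∷ x) (s≤s le) = there (∈-cartesianProductWith⁺ _∷_ (bools∈ b) (lists≤∈ n x le))

bounded-finite : ∀ {S : Str → Set} n → (∀ x → S x → len x < n) → Finite S
bounded-finite n bound = L.cartesianProductWith _∷_ (false ∷ true ∷ []) (lists≤ n) , λ where
  (b ∷ x) s → ∈-cartesianProductWith⁺ _∷_ (bools∈ b) (lists≤∈ n x (≤-trans (n≤1+n _) (≤-trans (n≤1+n _) (bound (b ∷ x) s))))

finite-bounded : ∀ {S : Str → Set} → Finite S → ∃ λ n → ∀ x → S x → len x ≤ n
finite-bounded (l , mem) = maxLen l , λ x s → below l (mem x s)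
  where
    maxLen : List Str → ℕ
    maxLen []      = 0
    maxLen (x ∷ l) = len x ⊔ maxLen l
    below : ∀ {x} l → x ∈ l → len x ≤ maxLen l
    below (x ∷ l) (here refl) = m≤m⊔n (len x) (maxLen l)
    below (x ∷ l) (there p)   = ≤-trans (below l p) (m≤n⊔m (len x) (maxLen l))

abstract
  Decider : ℕ → TM
  Decider i = toTM (decideP i)

  decider : ∀ i x → ∃ λ o → HaltsWithin (Decider i) (strIn x) (decideCost i * len x ^ E i) o × Decided i x o
  decider = decide

decider-dom : ∀ i x → Survivor i x → Dom (Decider i) x
decider-dom i x s with decider i x
... | o , h , inj₁ (eq , _) = true , _ , subst (HaltsWithin (Decider i) (strIn x) (decideCost i * len x ^ E i)) eq h
... | o , h , inj₂ (_ , ¬s) = contradiction s ¬s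

decider-sound : ∀ i x b → Halts (Decider i) (strIn x) (outBit b) → b ≡ true × Survivor i x
decider-sound i x b h with decider i x
... | o , h′ , d with halts-unique (Decider i) {strIn x} h (decideCost i * len x ^ E i , h′)
decider-sound i x true  h | o , h′ , inj₁ (_ , s)   | eq = refl , s
decider-sound i x false h | o , h′ , inj₁ (refl , _) | ()
decider-sound i x true  h | o , h′ , inj₂ (refl , _) | ()
decider-sound i x false h | o , h′ , inj₂ (refl , _) | ()

decider-approx : ∀ i → PApprox A (Decider i)
decider-approx i = (E i , decideCost i , λ x → let (o , h , _) = decider i x in o , h) ,
  λ x → (λ h → inj₁ (i , proj₂ (decider-sound i x true h))) , (λ h → contradiction (proj₁ (decider-sound i x false h)) λ ())

dom? : ∀ Φ x → (∃ λ o → Halts Φ (strIn x) o) → Dec (Dom Φ x)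
dom? Φ x (o , h) with bitOf o in eq
... | just b  = yes (b , subst (Halts Φ (strIn x)) (outBit-bitOf o eq) h)
... | nothing = no λ (b , h′) → contradiction (trans (sym (bitOf-outBit b)) (trans (cong bitOf (halts-unique Φ {strIn x} h′ h)) eq)) λ ()

-- Allows an exponent to be used as a level: a machine with time bound O(n^c) is fast enough to be
-- captured by the slice of level c.
E-mono : ∀ i → i ≤ E i
E-mono zero    = z≤n
E-mono (suc i) = ≤-trans (s≤s (E-mono i)) (≤-trans (m≤m+n (suc (D i + 2)) (5 * D i + 19))
  (≤-reflexive (solve 1 (λ d → (con 1 :+ (d :+ con 2)) :+ (con 5 :* d :+ con 19) := (con 6 :* d :+ con 20) :+ con 2) refl (D i))))
  where open +-*-Solver

-- Fewer codes than candidates are considered, so some candidate is not excluded.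
not-all-killed : ∀ a L′ → ¬ (∀ m → m < suc L′ → killedBy a (suc L′) m L′ ≡ true)
not-all-killed a L′ all = collide (Fₚ.pigeonhole ≤-refl f)
  where
    killer : ∀ (m : Fin (suc L′)) → ∃ λ j → j < L′ × lastAcc (code j) a (suc L′) (suc L′) ≡ just (toℕ m)
    killer m = killedBy-code a (suc L′) (toℕ m) L′ (all (toℕ m) (Fₚ.toℕ<n m))
    f : Fin (suc L′) → Fin L′
    f m = F.fromℕ< (proj₁ (proj₂ (killer m)))
    f-toℕ : ∀ m → toℕ (f m) ≡ proj₁ (killer m)
    f-toℕ m = Fₚ.toℕ-fromℕ< (proj₁ (proj₂ (killer m)))
    collide : (∃₂ λ m m′ → toℕ m < toℕ m′ × f m ≡ f m′) → ⊥
    collide (m , m′ , lt , eq) = <⇒≢ lt (just-injective (begin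
      just (toℕ m)                                                    ≡⟨ sym (proj₂ (proj₂ (killer m))) ⟩
      lastAcc (code (proj₁ (killer m))) a (suc L′) (suc L′)   ≡⟨ cong (λ j → lastAcc (code j) a (suc L′) (suc L′))
                                                                   (trans (sym (f-toℕ m)) (trans (cong toℕ eq) (f-toℕ m′))) ⟩
      lastAcc (code (proj₁ (killer m′))) a (suc L′) (suc L′)  ≡⟨ proj₂ (proj₂ (killer m′)) ⟩
      just (toℕ m′) ∎))
      where open ≡-Reasoning

-- For L = a + n + 1 not all candidates of level a are excluded. This L is at least a, as a survivor
-- requires, and it makes the candidates longer than n; a string has only one level, so none of them
-- survives at a lower one.
slice-unbounded : ∀ a n → ¬ (∀ x → Survivor a x → ¬ (∃ λ i → i < a × Survivor i x) → len x ≤ n)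
slice-unbounded a n bound = not-all-killed a (a + n) λ m lt → alive-or-killed m (a + n ∸ m) (m+[n∸m]≡n (≤-pred lt))
  where
    alive-or-killed : ∀ m r → m + r ≡ a + n → killedBy a (suc (a + n)) m (a + n) ≡ true
    alive-or-killed m r eq with killedBy a (suc (a + n)) m (a + n) in keq
    ... | true  = refl
    ... | false = contradiction (bound x (survivor ≤-refl a≤L (cand-list a m (suc r)) alive) lower) (<⇒≱ long)
      where
        x : Str
        x = cand a m (suc r)
        L≡ : m + suc r ≡ suc (a + n)
        L≡ = trans (+-suc m r) (cong suc eq)
        a≤L : a ≤ m + suc r
        a≤L = ≤-trans (≤-trans (m≤m+n a n) (n≤1+n _)) (≤-reflexive (sym L≡))
        alive : killedBy a (m + suc r) m (m + r) ≡ false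
        alive = trans (cong₂ (λ L J → killedBy a L m J) L≡ eq) keq
        lower : ¬ (∃ λ i → i < a × Survivor i x)
        lower (i , i<a , survivor {a′} {m′} {r′} a′≤i _ shape _) =
          <⇒≱ i<a (≤-trans (≤-reflexive (proj₁ (cand-injective a m r a′ m′ r′ (trans (sym (cand-list a m (suc r))) shape)))) a′≤i)
        long : n < len x
        long = ≤-trans (s≤s (m≤n+m n a)) (≤-trans (≤-trans (≤-reflexive (sym L≡)) (≤-trans (n≤1+n _) (m≤n+m (suc (m + suc r)) a)))
          (≤-reflexive (sym (len-cand a m (suc r)))))

A-P-levelable : PLevelable A
A-P-levelable (Φ , ((c , d , total) , correct) , maximal) =
  slice-bounded Φ [] strIn (λ x → refl) c d total correct c (E-mono c) λ (n₀ , inside) →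
    let (n₁ , outside) = finite-bounded (maximal (Decider (suc c)) (decider-approx (suc c)))
    -- The survivors that are new at level c + 1 are short in either case: those in the domain of Φ
    -- because they lie outside the slice of level c, the others by the assumed maximality.
    in slice-unbounded (suc c) (n₀ ⊔ n₁) λ x s ¬lower → case dom? Φ x (let (o , h) = total x in o , _ , h) of λ where
         (yes dom) → ≤-trans (<⇒≤ (inside x dom λ s′ → ¬lower (c , ≤-refl , s′))) (m≤m⊔n n₀ n₁)
         (no ¬dom) → ≤-trans (outside x (decider-dom (suc c) x s , ¬dom)) (m≤n⊔m n₀ n₁)

-- Extending an approximation by a slice

sy′ : ∀ {e} → InSym → Fin (3 + e)
sy′ i0    = zero
sy′ i1    = suc zero
sy′ ihash = suc (suc zero)

inT-nz : ∀ {e} w → inT {e} w ≡ posR [] (nz (L.map sy′ w))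
inT-nz []      = refl
inT-nz (a ∷ w) = cong₂ (tape []) (sy-suc a) (trans (Lₚ.map-cong sy-suc w) (Lₚ.map-∘ w))
  where
    sy-suc : ∀ {e} a → sy {e} a ≡ suc (sy′ a)
    sy-suc i0    = refl
    sy-suc i1    = refl
    sy-suc ihash = refl

notHash isBit : ∀ {e} → Γ e → Bool
notHash (suc (suc (suc zero))) = false
notHash _                      = true
isBit (suc zero)       = true
isBit (suc (suc zero)) = true
isBit _                = false

blank? : ∀ {e} → Γ e → Bool
blank? s = not (nonblank s)

skipKey : ∀ {e} → Frag e 1
skipKey = while (notHash ∘ hd₁) goR ⨟ goR

exec-skip : ∀ {e} key d (s : List (Γ e)) → Exec (while (notHash ∘ hd₁) goR) (posR (nz d) (nz (L.map sy′ (bits key)) ++ 3F ∷ s) ∷ [])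
  (suc (2 * length key)) (posR (nz (L.map sy′ (bits key) L.ʳ++ d)) (3F ∷ s) ∷ [])
exec-skip []            d s = exec-done refl
exec-skip (false ∷ key) d s = weakenR (≤-reflexive (cong suc (double (length key))))
  (exec-loop refl (exec-act opR (posR (nz d) (1F ∷ (nz (L.map sy′ (bits key)) ++ 3F ∷ s)) ∷ []) {0}) (exec-skip key (zero ∷ d) s))
exec-skip (true ∷ key)  d s = weakenR (≤-reflexive (cong suc (double (length key))))
  (exec-loop refl (exec-act opR (posR (nz d) (2F ∷ (nz (L.map sy′ (bits key)) ++ 3F ∷ s)) ∷ []) {0}) (exec-skip key (suc zero ∷ d) s))

-- The second machine counts only if the first gives no answer. When both are correct on the same
-- set, their answers cannot conflict.
combine : List ℕ → List ℕ → List ℕ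
combine o o′ = maybe outBit o′ (bitOf o)

replicateV-++ : ∀ {A : Set} m n (x : A) → V.replicate (m + n) x ≡ V.replicate m x V.++ V.replicate n x
replicateV-++ zero    n x = refl
replicateV-++ (suc m) n x = cong (x ∷_) (replicateV-++ m n x)

module Union (Ψ Φ : TM) where

  e k l : ℕ
  e = TM.extra Ψ ⊔ TM.extra Φ
  k = TM.work Ψ
  l = TM.work Φ

  ΨP : Frag e (suc k)
  ΨP = ofTM Ψ (m≤m⊔n _ _)

  ΦP : Frag e (suc l)
  ΦP = ofTM Φ (m≤n⊔m (TM.extra Ψ) _)

  φ : Fin (suc k + suc l)
  φ = suc k ↑ʳ zero

  -- Φ is run only where it outputs the bit 1 or nothing, so the symbol under its head tells the
  -- result. What the first machine has left on the output tape is unknown; therefore the cell to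
  -- the right of the result is blanked afterwards.
  opShow : Vec (Γ e) 2 → Vec (Op e) 2
  opShow (_ ∷ b ∷ []) = ((if nonblank b then 2F else 0F) , mR) ∷ (b , mS) ∷ []

  fallback unionP : Frag e (suc k + suc l)
  fallback = onRight (suc k) ΦP ⨟ (onPair zero φ (act opShow) ⨟ onTape zero (act λ _ → (0F , mL) ∷ []))
  unionP = onTape zero skipKey ⨟ (onPair zero φ (copyWith id) ⨟ (onTape zero rewind ⨟ (onTape φ rewind ⨟ (onLeft (suc k) ΨP ⨟
    ifte (isBit ∘ V.head) (onTape zero goR ⨟ ifte (blank? ∘ V.head) (onTape zero goL) fallback) fallback))))

  at-φ : ∀ (s : Tapes e (suc k)) t u → V.lookup (s V.++ t ∷ u) φ ≡ t
  at-φ s t u = Vₚ.lookup-++ʳ s (t ∷ u) zero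

  set-φ : ∀ (s : Tapes e (suc k)) t u {t′} → (s V.++ t ∷ u) [ φ ]≔ t′ ≡ s V.++ t′ ∷ u
  set-φ s t u = Vₚ.[]≔-++-↑ʳ s (t ∷ u) zero

  blanks : ∀ n → Tapes e n
  blanks n = V.replicate n blankT

  show-out : ∀ (t : Tape (Γ e)) b → outT (mv (0F , mL) (mv ((if b then 2F else 0F) , mR) t)) ≡ (if b then outBit true else [])
  show-out (tape l h r) true with posR (2F ∷ l) r in eq
  show-out (tape l h []) true | _ with eq
  ... | refl = refl
  show-out (tape l h (x ∷ [])) true | _ with eq
  ... | refl = refl
  show-out (tape l h (x ∷ y ∷ r)) true | _ with eq
  ... | refl = refl
  show-out (tape [] h []) false          = refl
  show-out (tape [] h (x ∷ r)) false     = refl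
  show-out (tape (y ∷ l) h []) false     = refl
  show-out (tape (y ∷ l) h (x ∷ r)) false = refl

  result-of : ∀ (t : Tape (Γ e)) {o} → outT t ≡ o → (o ≡ outBit true ⊎ o ≡ []) → (if nonblank (Tape.hd t) then outBit true else []) ≡ o
  result-of (tape l zero r)    refl _          = refl
  result-of (tape l (suc h) r) refl (inj₁ eq)  = sym eq

  run-fallback : ∀ (t : Tape (Γ e)) (u : Tapes e k) {x T o} → HaltsWithin Φ x T o → (o ≡ outBit true ⊎ o ≡ []) →
    ∃ λ s → Exec fallback ((t ∷ u) V.++ initS l x) (suc T + 2) s × outS s ≡ o
  run-fallback t u {x} {T} {o} h cases with ofTM-halts Φ (m≤n⊔m (TM.extra Ψ) _) {x} {T} h
  ... | s′@(v ∷ vs) , run , out = _ , exec-seq (run-right {j = suc k} (t ∷ u) run) (exec-seq shown (run-onTape zero _ refl (exec-act (λ _ → (0F , mL) ∷ []) _ {0}))) ,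
      trans (show-out t (nonblank (Tape.hd v))) (result-of v out cases)
    where
      shown : Exec (onPair zero φ (act opShow)) ((t ∷ u) V.++ v ∷ vs) 1 ((mv ((if nonblank (Tape.hd v) then 2F else 0F) , mR) t ∷ u) V.++ v ∷ vs)
      shown = subst (Exec (onPair zero φ (act opShow)) ((t ∷ u) V.++ v ∷ vs) 1)
        (trans (set-φ (mv ((if nonblank (Tape.hd v) then 2F else 0F) , mR) t ∷ u) v vs) (cong (λ z → (mv ((if nonblank (Tape.hd v) then 2F else 0F) , mR) t ∷ u) V.++ z ∷ vs) (stays v)))
        (run-onPair zero φ (λ ()) ((t ∷ u) V.++ v ∷ vs) refl (at-φ (t ∷ u) v vs) (exec-act opShow (t ∷ v ∷ []) {0}))
        where
          stays : ∀ (v : Tape (Γ e)) → mv (Tape.hd v , mS) v ≡ v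
          stays (tape _ _ _) = refl

  tailP : Frag e (suc k + suc l)
  tailP = ifte (isBit ∘ V.head) (onTape zero goR ⨟ ifte (blank? ∘ V.head) (onTape zero goL) fallback) fallback

  Tail : Tape (Γ e) → Tapes e k → List InSym → ℕ → List ℕ → Set
  Tail t u x T o = ∃ λ s → Exec tailP ((t ∷ u) V.++ initS l x) (suc (suc (suc (suc T + 2)))) s × outS s ≡ combine (outT t) o

  run-tail : ∀ (t : Tape (Γ e)) (u : Tapes e k) {x T o} → HaltsWithin Φ x T o → (o ≡ outBit true ⊎ o ≡ []) →
    Tail t u x T o
  run-tail (tape a zero r) u {x} {T} h cases with run-fallback (tape a zero r) u {x} h cases
  ... | s , run , out = s , weakenR (n≤1+n _) (weakenR (n≤1+n _) (exec-else refl run)) , out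
  run-tail (tape a (suc (suc (suc b))) r) u {x} {T} h cases with run-fallback (tape a (suc (suc (suc b))) r) u {x} h cases
  ... | s , run , out = s , weakenR (n≤1+n _) (weakenR (n≤1+n _) (exec-else refl run)) , trans out (sym (nonbit r))
    where
      nonbit : ∀ r → combine (outT (tape a (suc (suc (suc b))) r)) _ ≡ _
      nonbit []          = refl
      nonbit (zero ∷ r)  = refl
      nonbit (suc _ ∷ r) = refl
  run-tail (tape a 1F []) u h cases = _ , exec-then refl (exec-seq (run-onTape zero _ refl (exec-act opR _ {0}))
    (exec-then refl (run-onTape zero _ refl (exec-act opL _)))) , refl
  run-tail (tape a 1F (zero ∷ [])) u h cases = _ , exec-then refl (exec-seq (run-onTape zero _ refl (exec-act opR _ {0}))
    (exec-then refl (run-onTape zero _ refl (exec-act opL _)))) , refl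
  run-tail (tape a 1F (zero ∷ y ∷ r)) u h cases = _ , exec-then refl (exec-seq (run-onTape zero _ refl (exec-act opR _ {0}))
    (exec-then refl (run-onTape zero _ refl (exec-act opL _)))) , refl
  run-tail (tape a 1F (suc y ∷ r)) u {x} {T} h cases with run-fallback (tape (1F ∷ a) (suc y) r) u {x} {T} h cases
  ... | s , run , out = s , exec-then refl (exec-seq (run-onTape zero _ refl (exec-act opR _ {0})) (exec-else refl run)) , out
  run-tail (tape a 2F []) u h cases = _ , exec-then refl (exec-seq (run-onTape zero _ refl (exec-act opR _ {0}))
    (exec-then refl (run-onTape zero _ refl (exec-act opL _)))) , refl
  run-tail (tape a 2F (zero ∷ [])) u h cases = _ , exec-then refl (exec-seq (run-onTape zero _ refl (exec-act opR _ {0}))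
    (exec-then refl (run-onTape zero _ refl (exec-act opL _)))) , refl
  run-tail (tape a 2F (zero ∷ y ∷ r)) u h cases = _ , exec-then refl (exec-seq (run-onTape zero _ refl (exec-act opR _ {0}))
    (exec-then refl (run-onTape zero _ refl (exec-act opL _)))) , refl
  run-tail (tape a 2F (suc y ∷ r)) u {x} {T} h cases with run-fallback (tape (2F ∷ a) (suc y) r) u {x} {T} h cases
  ... | s , run , out = s , exec-then refl (exec-seq (run-onTape zero _ refl (exec-act opR _ {0})) (exec-else refl run)) , out

  unionTM : TM
  unionTM = toTM unionP

  union-halts : ∀ key x {T o T′ o′} → let w = bits key ++ ihash ∷ bits x in
    HaltsWithin Ψ w T o → HaltsWithin Φ (bits x) T′ o′ → (o′ ≡ outBit true ⊎ o′ ≡ []) →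
    HaltsWithin unionTM w (T + T′ + 4 * length key + 6 * length x + 18) (combine o o′)
  union-halts key x {T} {o} {T′} {o′} hΨ hΦ cases with ofTM-halts Ψ (m≤m⊔n _ _) {bits key ++ ihash ∷ bits x} {T} hΨ
  ... | t ∷ u , run , oeq with run-tail t u {bits x} {T′} hΦ cases
  ... | s , run′ , out = subst (HaltsWithin unionTM w τ) (trans out (cong (λ z → combine z o′) oeq)) (toTM-halts {p = unionP} {w = w} (weakenR (≤-reflexive time) (subst (λ z → Exec unionP z τ′ s) (sym (replicate-init w))
      (exec-seq skipped (exec-seq copied′ (exec-seq rewound (exec-seq rewoundΦ (exec-seq (run-left {k = suc l} (initS l (bits x)) run) run′))))))))
    where
      w = bits key ++ ihash ∷ bits x
      τ = T + T′ + 4 * length key + 6 * length x + 18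
      K X W : List (Fin (3 + e))
      K = L.map sy′ (bits key)
      X = L.map sy′ (bits x)
      W = L.map sy′ w
      d : List (Fin (3 + e))
      d = 2F ∷ (K L.ʳ++ [])
      start′ : Tape (Γ e) → Tape (Γ e) → Tapes e (suc k + suc l)
      start′ a b = (a ∷ blanks k) V.++ b ∷ blanks l
      replicate-init : ∀ v → initS (k + suc l) v ≡ start′ (inT v) blankT
      replicate-init v = cong (inT v ∷_) (replicateV-++ k (suc l) blankT)
      W-eq : W ≡ K ++ 2F ∷ X
      W-eq = Lₚ.map-++ sy′ (bits key) (ihash ∷ bits x)
      input : inT w ≡ posR [] (nz K ++ 3F ∷ nz X)
      input = trans (inT-nz w) (cong (posR []) (trans (cong nz W-eq) (Lₚ.map-++ suc K (2F ∷ X))))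
      skipped : Exec (onTape zero skipKey) (start′ (inT w) blankT) (suc (2 * length key) + 1) (start′ (posR (nz d) (nz X)) blankT)
      skipped = run-onTape zero (start′ (inT w) blankT) input (exec-seq (exec-skip key [] (nz X)) (exec-act opR (posR (nz (K L.ʳ++ [])) (3F ∷ nz X) ∷ []) {0}))
      copied′ : Exec (onPair zero φ (copyWith id)) (start′ (posR (nz d) (nz X)) blankT) (suc (2 * length X))
                     (start′ (posR (nz (X L.ʳ++ d)) []) (posR (nz (X L.ʳ++ [])) []))
      copied′ = subst (Exec (onPair zero φ (copyWith id)) (start′ (posR (nz d) (nz X)) blankT) (suc (2 * length X)))
        (trans (set-φ (posR (nz (X L.ʳ++ d)) [] ∷ blanks k) blankT (blanks l))
               (cong (λ z → start′ (posR (nz (X L.ʳ++ d)) []) (posR (nz (z L.ʳ++ [])) [])) (Lₚ.map-id X)))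
        (run-onPair zero φ (λ ()) (start′ (posR (nz d) (nz X)) blankT) refl (at-φ (posR (nz d) (nz X) ∷ blanks k) blankT (blanks l))
          (exec-copyWith {f = id} {id} (λ _ → refl) X d []))
      rewound : Exec (onTape zero rewind) (start′ (posR (nz (X L.ʳ++ d)) []) (posR (nz (X L.ʳ++ [])) [])) (2 * length W + 3)
                     (start′ (inT w) (posR (nz (X L.ʳ++ [])) []))
      rewound = subst (λ z → Exec (onTape zero rewind) (start′ (posR (nz (X L.ʳ++ d)) []) (posR (nz (X L.ʳ++ [])) [])) (2 * length W + 3) (start′ z (posR (nz (X L.ʳ++ [])) [])))
        (sym (inT-nz w)) (run-onTape zero (start′ (posR (nz (X L.ʳ++ d)) []) (posR (nz (X L.ʳ++ [])) []))
          (cong (λ z → posR (nz z) []) (sym (trans (cong (L._ʳ++ []) W-eq) (Lₚ.++-ʳ++ K)))) (exec-rewind W))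
      rewoundΦ : Exec (onTape φ rewind) (start′ (inT w) (posR (nz (X L.ʳ++ [])) [])) (2 * length X + 3) (start′ (inT w) (inT (bits x)))
      rewoundΦ = subst (Exec (onTape φ rewind) (start′ (inT w) (posR (nz (X L.ʳ++ [])) [])) (2 * length X + 3))
        (trans (set-φ (inT w ∷ blanks k) (posR (nz (X L.ʳ++ [])) []) (blanks l)) (cong (start′ (inT w)) (sym (inT-nz (bits x)))))
        (run-onTape φ (start′ (inT w) (posR (nz (X L.ʳ++ [])) [])) (at-φ (inT w ∷ blanks k) (posR (nz (X L.ʳ++ [])) []) (blanks l)) (exec-rewind X))
      lenX : length X ≡ length x
      lenX = trans (Lₚ.length-map sy′ (bits x)) (Lₚ.length-map _ x)
      lenW : length W ≡ length key + suc (length x)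
      lenW = trans (cong length W-eq) (trans (Lₚ.length-++ K) (cong₂ (λ a b → a + suc b) (trans (Lₚ.length-map sy′ (bits key)) (Lₚ.length-map _ key)) lenX))
      τ′ = suc (2 * length key) + 1 + (suc (2 * length X) + (2 * length W + 3 + (2 * length X + 3 + (suc T + suc (suc (suc (suc T′ + 2)))))))
      time : suc (2 * length key) + 1 + (suc (2 * length X) + (2 * length W + 3 + (2 * length X + 3 + (suc T + suc (suc (suc (suc T′ + 2))))))) ≡ τ
      time = trans (cong₂ (λ a b → suc (2 * length key) + 1 + (suc (2 * a) + (2 * b + 3 + (2 * a + 3 + (suc T + suc (suc (suc (suc T′ + 2)))))))) lenX lenW)
        (solve 4 (λ κ n t t′ → con 1 :+ con 2 :* κ :+ con 1 :+ (con 1 :+ con 2 :* n :+ (con 2 :* (κ :+ (con 1 :+ n)) :+ con 3 :+ (con 2 :* n :+ con 3 :+ (con 1 :+ t :+ (con 1 :+ (con 1 :+ (con 1 :+ (con 1 :+ t′ :+ con 2))))))))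
           := t :+ t′ :+ con 4 :* κ :+ con 6 :* n :+ con 18) refl (length key) (length x) T T′)
        where open +-*-Solver

abstract
  _∪ᴹ_ : TM → TM → TM
  Ψ ∪ᴹ Φ = Union.unionTM Ψ Φ

  ∪ᴹ-halts : ∀ Ψ Φ key x {T o T′ o′} → let w = bits key ++ ihash ∷ bits x in
    HaltsWithin Ψ w T o → HaltsWithin Φ (bits x) T′ o′ → (o′ ≡ outBit true ⊎ o′ ≡ []) →
    HaltsWithin (Ψ ∪ᴹ Φ) w (T + T′ + 4 * length key + 6 * length x + 18) (combine o o′)
  ∪ᴹ-halts Ψ Φ = Union.union-halts Ψ Φ

-- Computability of the new time bound

module Lengthen (M : TM) where

  e k : ℕ
  e = TM.extra M
  k = TM.work M

  MP : Frag e (suc k)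
  MP = ofTM M ≤-refl

  ζ : Fin (suc k + 1)
  ζ = suc k ↑ʳ zero

  opMark : Vec (Γ e) 2 → Vec (Op e) 2
  opMark _ = (2F , mS) ∷ (0F , mL) ∷ []

  -- Tape ζ keeps a tally of the input while M runs. The new symbols are put to the left of the
  -- head, where the output begins, so its end need not be searched.
  prependP lengthenP : Frag e (suc k + 1)
  prependP  = while (λ v → nonblank (V.lookup v ζ)) (onTape zero goL ⨟ onPair zero ζ (act opMark))
  lengthenP = onPair zero ζ (copyWith (λ _ → 2F)) ⨟ (onTape zero rewind ⨟ (onLeft (suc k) MP ⨟ (onTape ζ goL ⨟ prependP)))

  at-ζ : ∀ (s : Tapes e (suc k)) t → V.lookup (s V.++ t ∷ []) ζ ≡ t
  at-ζ s t = Vₚ.lookup-++ʳ s (t ∷ []) zero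

  set-ζ : ∀ (s : Tapes e (suc k)) t {t′} → (s V.++ t ∷ []) [ ζ ]≔ t′ ≡ s V.++ t′ ∷ []
  set-ζ s t = Vₚ.[]≔-++-↑ʳ s (t ∷ []) zero

  out-prepend : ∀ (t : Tape (Γ e)) → outT (mv (2F , mS) (mv (Tape.hd t , mL) t)) ≡ 2 ∷ outT t
  out-prepend (tape [] h r)      = cong (λ z → 2 ∷ L.map toℕ z) (takeWhile-push h r)
  out-prepend (tape (x ∷ l) h r) = cong (λ z → 2 ∷ L.map toℕ z) (takeWhile-push h r)

  run-prepend : ∀ d t (u : Tapes e k) → ∃₂ λ τ s → Exec prependP ((t ∷ u) V.++ posL (nz d) [] ∷ []) τ s × outS s ≡ replicate (length d) 2 ++ outT t
  run-prepend []      t u = 1 , _ , exec-done (cong nonblank (trans (lookup-heads ζ ((t ∷ u) V.++ blankT ∷ [])) (cong Tape.hd (at-ζ (t ∷ u) blankT)))) , refl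
  run-prepend (a ∷ d) t u with run-prepend d (mv (2F , mS) (mv (Tape.hd t , mL) t)) u
  ... | τ , s , run , out = _ , s ,
    exec-loop (cong nonblank (trans (lookup-heads ζ ((t ∷ u) V.++ z ∷ [])) (cong Tape.hd (at-ζ (t ∷ u) z))))
      (exec-seq moved marked) run ,
    trans out (trans (cong (replicate (length d) 2 ++_) (out-prepend t)) (replicate-snoc (length d) 2 (outT t)))
    where
      z : Tape (Γ e)
      z = posL (nz (a ∷ d)) []
      t₁ : Tape (Γ e)
      t₁ = mv (Tape.hd t , mL) t
      moved : Exec (onTape zero goL) ((t ∷ u) V.++ z ∷ []) 1 ((t₁ ∷ u) V.++ z ∷ [])
      moved = run-onTape zero ((t ∷ u) V.++ z ∷ []) refl (exec-act opL (t ∷ []) {0})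
      marked : Exec (onPair zero ζ (act opMark)) ((t₁ ∷ u) V.++ z ∷ []) 1 ((mv (2F , mS) t₁ ∷ u) V.++ posL (nz d) [] ∷ [])
      marked = subst (Exec (onPair zero ζ (act opMark)) ((t₁ ∷ u) V.++ z ∷ []) 1) (set-ζ (mv (2F , mS) t₁ ∷ u) z)
        (run-onPair zero ζ (λ ()) ((t₁ ∷ u) V.++ z ∷ []) refl (at-ζ (t₁ ∷ u) z) (exec-act opMark (t₁ ∷ z ∷ []) {0}))

  replicate-++ : ∀ m n → replicate m 2 ++ unary n ≡ unary (m + n)
  replicate-++ zero    n = refl
  replicate-++ (suc m) n = cong (2 ∷_) (replicate-++ m n)

  lengthen-halts : ∀ x n → Halts M (bits x) (unary n) → Halts (toTM lengthenP) (bits x) (unary (length x + n))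
  lengthen-halts x n (T , h) with ofTM-halts M ≤-refl {bits x} {T} h
  ... | t ∷ u , run , oeq with run-prepend (L.map (λ _ → suc zero) X L.ʳ++ []) t u
    where
      X : List (Fin (3 + e))
      X = L.map sy′ (bits x)
  ... | τ , s , run′ , out = τ′ , subst (HaltsWithin (toTM lengthenP) (bits x) τ′) final
      (toTM-halts {p = lengthenP} {w = bits x} (subst (λ z → Exec lengthenP z τ′ s) (sym (cong (inT (bits x) ∷_) (replicateV-++ k 1 blankT)))
        (exec-seq copied′ (exec-seq rewound (exec-seq (run-left {k = 1} (Z ∷ []) run) (exec-seq back run′))))))
    where
      X D′ : List (Fin (3 + e))
      X = L.map sy′ (bits x)
      D′ = L.map (λ _ → suc zero) X L.ʳ++ []
      Z : Tape (Γ e)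
      Z = posR (nz D′) []
      τ′ = suc (2 * length X) + (2 * length X + 3 + (suc T + (1 + τ)))
      st : Tape (Γ e) → Tape (Γ e) → Tapes e (suc k + 1)
      st a b = (a ∷ V.replicate k blankT) V.++ b ∷ []
      copied′ : Exec (onPair zero ζ (copyWith (λ _ → 2F))) (st (inT (bits x)) blankT) (suc (2 * length X)) (st (posR (nz (X L.ʳ++ [])) []) Z)
      copied′ = subst (Exec (onPair zero ζ (copyWith (λ _ → 2F))) (st (inT (bits x)) blankT) (suc (2 * length X)))
        (set-ζ (posR (nz (X L.ʳ++ [])) [] ∷ V.replicate k blankT) blankT)
        (run-onPair zero ζ (λ ()) (st (inT (bits x)) blankT) (inT-nz (bits x)) (at-ζ (inT (bits x) ∷ V.replicate k blankT) blankT)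
          (exec-copyWith {f = λ _ → 2F} {λ _ → suc zero} (λ _ → refl) X [] []))
      rewound : Exec (onTape zero rewind) (st (posR (nz (X L.ʳ++ [])) []) Z) (2 * length X + 3) (st (inT (bits x)) Z)
      rewound = subst (λ z → Exec (onTape zero rewind) (st (posR (nz (X L.ʳ++ [])) []) Z) (2 * length X + 3) (st z Z)) (sym (inT-nz (bits x)))
        (run-onTape zero (st (posR (nz (X L.ʳ++ [])) []) Z) refl (exec-rewind X))
      back : Exec (onTape ζ goL) ((t ∷ u) V.++ Z ∷ []) 1 ((t ∷ u) V.++ posL (nz D′) [] ∷ [])
      back = subst (Exec (onTape ζ goL) ((t ∷ u) V.++ Z ∷ []) 1) (set-ζ (t ∷ u) Z)
        (run-onTape ζ ((t ∷ u) V.++ Z ∷ []) (at-ζ (t ∷ u) Z) (exec-act opL (Z ∷ []) {0}))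
      lenD : length D′ ≡ length x
      lenD = trans (Lₚ.length-ʳ++ (L.map (λ _ → suc zero) X)) (trans (+-identityʳ _) (trans (Lₚ.length-map _ X)
               (trans (Lₚ.length-map sy′ (bits x)) (Lₚ.length-map _ x))))
      final : outS s ≡ unary (length x + n)
      final = trans out (trans (cong₂ (λ a b → replicate a 2 ++ b) lenD oeq) (replicate-++ (length x) n))

module _ {P : ParamSpace} where
  open ParamSpace P

  -- The extended machine has to skip the parameter, which costs time proportional to its length.
  -- The uniform class demands that the enlarged factor is still computable.
  computable-length : ∀ {f : Ω → ℕ} → ComputableΩ {P} f → ComputableΩ {P} (λ k → ∣ k ∣ + f k)
  computable-length {f} (M , h) = toTM (Lengthen.lengthenP M) , λ k →
    subst (λ n → Halts (toTM (Lengthen.lengthenP M)) (strIn (enc k)) (unary (n + f k))) (sym (length-toList (enc k)))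
      (Lengthen.lengthen-halts M (toList (enc k)) (f k) (h k))

  computable-lengths : ∀ {f : Ω → ℕ} C → ComputableΩ {P} f → ComputableΩ {P} (λ k → C * ∣ k ∣ + f k)
  computable-lengths {f} zero    h = h
  computable-lengths {f} (suc C) h =
    let (M , h′) = computable-length (computable-lengths C h)
    in M , λ k → subst (λ n → Halts M (strIn (enc k)) (unary n)) (sym (+-assoc ∣ k ∣ (C * ∣ k ∣) (f k))) (h′ k)

computable-id : ComputableNat (λ n → n)
computable-id = toTM dropP , λ n → 1 , subst (HaltsWithin (toTM dropP) (replicate (suc n) i1) 1) (out n)
    (toTM-halts {p = dropP} {w = replicate (suc n) i1} (exec-act (λ _ → (0F , mR) ∷ []) (initS 0 (replicate (suc n) i1)) {0}))
  where
    dropP : Frag 0 1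
    -- The number n is presented by n + 1 ones, so one of them is dropped.
    dropP = act λ _ → (0F , mR) ∷ []
    out : ∀ n → outT (posR {3} [] (L.map sy (replicate n i1))) ≡ unary n
    out zero    = refl
    out (suc n) = cong (2 ∷_) (tail n)
      where
        tail : ∀ n → L.map toℕ (takeWhile (λ s → ¬? (toℕ s ≟ 0)) (L.map (sy {0}) (replicate n i1))) ≡ unary n
        tail zero    = refl
        tail (suc n) = cong (2 ∷_) (tail n)

-- The summand 28 is 4 + 6 + 18, the coefficients in the time bound of the union machine.
overhead : ℕ → ℕ
overhead i = decideCost i + 28

-- Adding one slice to a whole parameterization

module Extend {P : ParamSpace} (η : Param P) (i : ℕ) (Ψ : TM) where
  open ParamSpace P

  unionTM : TM
  unionTM = Ψ ∪ᴹ Decider i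

  extended : Param P
  extended = record
    { η       = λ x k → Param.η η x k ⊎ Survivor i x
    ; nonempt = λ x → let (k , r) = Param.nonempt η x in k , inj₁ r
    ; upward  = λ x le → [ inj₁ ∘ Param.upward η x le , inj₂ ]′ }

  -- The factor `d` of the time bound is kept arbitrary: it is a constant depending on k in the
  -- strongly uniform case and the computable value `f k` in the other.
  module _ (k : Ω) (d : ℕ) (total : ∀ x → ∃ λ o → HaltsWithin Ψ (pairIn {P} k x) (d * len x ^ E i) o) (slice : SliceFor {P} A η Ψ k) where

    data Runs (x : Str) : Set where
      runs : ∀ {o o′} → Halts Ψ (pairIn {P} k x) o → Decided i x o′ → Halts unionTM (pairIn {P} k x) (combine o o′) → Runs x

    time≤ : ∀ x → d * len x ^ E i + decideCost i * len x ^ E i + 4 * length (toList (enc k)) + 6 * length (toList x) + 18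
                  ≤ (overhead i * ∣ k ∣ + d) * len x ^ E i
    time≤ x = begin
      d * X + c * X + 4 * length (toList (enc k)) + 6 * length (toList x) + 18
        ≡⟨ cong₂ (λ a b → d * X + c * X + 4 * a + 6 * b + 18) (sym (length-toList (enc k))) (sym (length-toList x)) ⟩
      d * X + c * X + 4 * κ + 6 * len x + 18
        ≤⟨ +-mono-≤ (+-mono-≤ (+-mono-≤ (+-monoʳ-≤ (d * X) (*-monoˡ-≤ X (scale c κ≥1))) (≤-trans (scale (4 * κ) X≥1) ≤-refl))
             (≤-trans (*-monoʳ-≤ 6 (n≤n^d (len≥1 x) (≤-trans (s≤s z≤n) (m≤n+m 2 (D i))))) (*-monoˡ-≤ X (scale 6 κ≥1))))
             (≤-trans (scale 18 X≥1) (*-monoˡ-≤ X (scale 18 κ≥1))) ⟩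
      d * X + c * κ * X + 4 * κ * X + 6 * κ * X + 18 * κ * X
        ≡⟨ solve 4 (λ d c κ X → d :* X :+ c :* κ :* X :+ con 4 :* κ :* X :+ con 6 :* κ :* X :+ con 18 :* κ :* X := ((c :+ con 28) :* κ :+ d) :* X) refl d c κ X ⟩
      (overhead i * κ + d) * X ∎
      where
        open ≤-Reasoning
        open +-*-Solver
        X = len x ^ E i
        c = decideCost i
        κ = ∣ k ∣
        κ≥1 : 1 ≤ κ
        κ≥1 = len≥1 (enc k)
        X≥1 : 1 ≤ X
        X≥1 = ^-≥1 (E i) (len≥1 x)

    outputs : ∀ {x o} → Decided i x o → o ≡ outBit true ⊎ o ≡ []
    outputs (inj₁ (eq , _)) = inj₁ eq
    outputs (inj₂ (eq , _)) = inj₂ eq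

    bound : Str → ℕ
    bound x = (overhead i * ∣ k ∣ + d) * len x ^ E i

    union-within : ∀ x {o o′} → HaltsWithin Ψ (pairIn {P} k x) (d * len x ^ E i) o →
      HaltsWithin (Decider i) (strIn x) (decideCost i * len x ^ E i) o′ → Decided i x o′ →
      HaltsWithin unionTM (pairIn {P} k x) (bound x) (combine o o′)
    union-within x h h′ D = halts-mono unionTM {pairIn {P} k x} (time≤ x)
      (∪ᴹ-halts Ψ (Decider i) (toList (enc k)) (toList x) h h′ (outputs D))

    extended-total : ∀ x → ∃ λ o → HaltsWithin unionTM (pairIn {P} k x) (bound x) o
    extended-total x = let (o , h) = total x ; (o′ , h′ , D) = decider i x in combine o o′ , union-within x {o} {o′} h h′ D

    run-union : ∀ x → Runs x
    run-union x =
      let (o , h) = total x ; (o′ , h′ , D) = decider i x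
      in runs {o = o} {o′} (d * len x ^ E i , h) D (bound x , union-within x {o} {o′} h h′ D)

    combined : ∀ x {o o′} → Halts Ψ (pairIn {P} k x) o → Decided i x o′ → ∀ {b} → combine o o′ ≡ outBit b →
               Halts Ψ (pairIn {P} k x) (outBit b) ⊎ (b ≡ true × Survivor i x)
    combined x {o} h D {b} eq with bitOf o in beq
    ... | just b′ = inj₁ (subst (Halts Ψ (pairIn {P} k x)) (trans (outBit-bitOf o beq) eq) h)
    combined x h (inj₁ (refl , s)) {true}  eq | nothing = inj₂ (refl , s)
    combined x h (inj₁ (refl , s)) {false} () | nothing
    combined x h (inj₂ (refl , _)) {true}  () | nothing
    combined x h (inj₂ (refl , _)) {false} () | nothing

    union-bit : ∀ x b → Runs x → Halts unionTM (pairIn {P} k x) (outBit b) → Halts Ψ (pairIn {P} k x) (outBit b) ⊎ (b ≡ true × Survivor i x)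
    union-bit x b (runs {o} {o′} h D u) hu = combined x {o} {o′} h D (halts-unique unionTM {pairIn {P} k x} {combine o o′} {outBit b} u hu)

    combined-dom : ∀ x {o o′} → Halts Ψ (pairIn {P} k x) o → Decided i x o′ → DomVia Ψ (pairIn {P} k) x ⊎ Survivor i x → ∃ λ b → combine o o′ ≡ outBit b
    combined-dom x {o} h D r with bitOf o in beq
    ... | just b = b , refl
    combined-dom x h D (inj₁ (b , h′)) | nothing =
      contradiction (trans (sym (bitOf-outBit b)) (trans (cong bitOf (halts-unique Ψ {pairIn {P} k x} h′ h)) beq)) λ ()
    combined-dom x h (inj₁ (refl , _)) (inj₂ s) | nothing = true , refl
    combined-dom x h (inj₂ (_ , ¬s))   (inj₂ s) | nothing = contradiction s ¬s

    union-dom : ∀ x → Runs x → Param.η extended x k → DomVia unionTM (pairIn {P} k) x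
    union-dom x (runs {o} {o′} h D u) r =
      let (b , eq) = combined-dom x {o} {o′} h D ([ inj₁ ∘ proj₂ (proj₂ slice x) , inj₂ ]′ r)
      in b , subst (Halts unionTM (pairIn {P} k x)) eq u

    extended-slice : SliceFor {P} A extended unionTM k
    extended-slice =
      (λ x → (λ h → [ proj₁ (proj₁ slice x) , (λ (_ , s) → inj₁ (i , s)) ]′ (union-bit x true (run-union x) h)) ,
             (λ h → [ proj₂ (proj₁ slice x) , (λ ()) ]′ (union-bit x false (run-union x) h))) ,
      (λ x → (λ (b , h) → [ (λ h′ → inj₁ (proj₁ (proj₂ slice x) (b , h′))) , (λ (_ , s) → inj₂ s) ]′ (union-bit x b (run-union x) h)) , union-dom x (run-union x))

    -- The running time has exactly the exponent `E i`, so each original slice lies in `S_i` up to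
    -- finitely many strings. As `S_i` has been added to the slice of k₀ too, only finitely many
    -- strings can be gained.
    not-imix : ∀ k₀ → ¬ Infinite (λ x → Param.η extended x k × ¬ Param.η extended x k₀)
    not-imix k₀ inf = slice-bounded Ψ (strIn (enc k) ++ ihash ∷ []) (pairIn {P} k) (λ x → sym (Lₚ.++-assoc (strIn (enc k)) _ _))
      (E i) d total (proj₁ slice) i ≤-refl λ (n₀ , inside) → inf (bounded-finite n₀ λ where
        x (inj₁ r , out) → inside x (proj₂ (proj₂ slice x) r) (out ∘ inj₂)
        x (inj₂ s , out) → contradiction (inj₂ s) out)

-- Levelability is refuted at the exponent `E c₀`, which is at least c₀: with this exponent the
-- survivors up to level c₀ can be added without leaving the class. Slices only grow and parameters
-- are kept, so the identity bounds the gap.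
A-not-FPTsu-levelable : ¬ FPTsuLevelable A
A-not-FPTsu-levelable (c₀ , levelable) with levelable (E c₀) (E-mono c₀)
... | P , η , (Ψ , spec) , imix =
  let (k , inf) = imix P extended (λ n → n , λ x k r le → k , inj₁ r , le)
                    (unionTM , λ k → let ((d , total) , slice) = spec k in
                      (overhead c₀ * ParamSpace.∣_∣ P k + d , extended-total k d total slice) , extended-slice k d total slice)
                    (ParamSpace.elem P)
      ((d , total) , slice) = spec k
  in not-imix k d total slice (ParamSpace.elem P) inf
  where
    open Extend η c₀ Ψ

A-not-FPT-levelable : ¬ FPTLevelable A
A-not-FPT-levelable (c₀ , levelable) with levelable (E c₀) (E-mono c₀)
... | P , η , (Ψ , f , computable , spec) , imix =
  let (k , inf) = imix P extended ((λ n → n) , computable-id , λ n x k r le → k , inj₁ r , le)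
                    (unionTM , (λ k → overhead c₀ * ParamSpace.∣_∣ P k + f k) , computable-lengths {P} {f} (overhead c₀) computable , λ k →
                      let (total , slice) = spec k in extended-total k (f k) total slice , extended-slice k (f k) total slice)
                    (ParamSpace.elem P)
      (total , slice) = spec k
  in not-imix k (f k) total slice (ParamSpace.elem P) inf
  where
    open Extend η c₀ Ψ

theorem11 : Σ (Str → Set) λ A → PLevelable A × ¬ FPTsuLevelable A × ¬ FPTLevelable A
theorem11 = A , A-P-levelable , A-not-FPTsu-levelable , A-not-FPT-levelable
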